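{- For any CBGT instance $(E,\mathcal{I},g)$ where $(E,\mathcal{I})$ is a graphic matroid, there is an infinite valid schedule $\pi$ with $h(\pi)<4$. Furthermore, $\pi$ can be implemented in polynomial time.
   Context: An instance of Combinatorial Bamboo Garden Trimming (CBGT) is a triple $(E,\mathcal{I},g)$ where $E$ is a finite set (of "bamboos"), $\mathcal{I}\subseteq 2^E$ is a family of subsets of $E$, and $g\in\mathbb{Q}_{\ge 0}^E$ is a vector of growth rates such that there are coefficients $\lambda(I)\ge 0$ ($I\in\mathcal{I}$) with $\sum_{I\in\mathcal{I}}\lambda(I)=1$ and $g(e)=\sum_{I\in\mathcal{I}:\, e\in I}\lambda(I)$ for every $e\in E$. Let $\mathbb{N}=\{1,2,\dots\}$. An infinite schedule is a sequence $\pi=\pi(1),\pi(2),\dots$ of subsets of $E$; it is valid if $\pi(t)\in\mathcal{I}$ for all $t\in\mathbb{N}$. $h^\pi_t(e)$ denotes the height of $e$ on day $t$ after growing but before $\pi(t)$ is cut, i.e. $h^\pi_1(e)=g(e)$, and $h^\pi_{t+1}(e)=g(e)$ if $e\in\pi(t)$, $h^\pi_{t+1}(e)=h^\pi_t(e)+g(e)$ otherwise. The height of $\pi$ is $h(\pi)=\max_{e\in E}\sup_{t\in\mathbb{N}}h^\pi_t(e)$. A graphic matroid $(E,\mathcal{I})$ has an associated undirected graph $G$ with edge set $E$, and $\mathcal{I}=\{I\subseteq E : I \text{ is the edge set of a forest in } G\}$; it is given to an algorithm by $G$. An algorithm implements $\pi$ if it outputs $\pi(1),\pi(2),\dots$ one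 step at a time; polynomial time means that preprocessing and the computation of each next set take time polynomial in the input size. -}

module Defs where

open import Data.Bool.Base using (Bool; true; false; if_then_else_)
open import Data.Fin.Base using (Fin; toℕ)
open import Data.Fin.Subset using (Subset; inside; outside; _∈_)
open import Data.Integer.Base using (∣_∣)
open import Data.List.Base using (List; []; _∷_; map; allFin)
open import Data.List.Relation.Unary.All using (All)
open import Data.List.Relation.Unary.Unique.Propositional using (Unique)
open import Data.Nat.Base as ℕ using (ℕ; zero; suc)
open import Data.Product.Base using (Σ-syntax; ∃-syntax; _×_; _,_; proj₁; proj₂)
open import Data.Rational.Base using (ℚ; 0ℚ; 1ℚ; _+_; _≤_; _<_; ↥_; ↧ₙ_)
open import Data.Sum.Base using (_⊎_)
import Data.Vec.Base as Vec
open import Relation.Binary.PropositionalEquality.Core using (_≡_; _≢_)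
open import Relation.Nullary.Negation.Core using (¬_)

------------------------------------------------------------------------
-- Combinatorial Bamboo Garden Trimming, with ground set E = Fin m

∑-subsets : ∀ m → (Subset m → ℚ) → ℚ
∑-subsets zero    f = f Vec.[]
∑-subsets (suc m) f = ∑-subsets m (λ I → f (inside  Vec.∷ I))
                    + ∑-subsets m (λ I → f (outside Vec.∷ I))

-- The coefficients λ(I), I ∈ ℐ, are extended by zero to all subsets of E,
-- so that sums over ℐ can be written as sums over all subsets.  They are
-- rational: since g is rational, rational coefficients exist iff real ones do.
record IsCBGT {m : ℕ} (ℐ : Subset m → Set) (g : Fin m → ℚ) : Set where
  field
    g-nonneg      : ∀ e → 0ℚ ≤ g e
    coeff         : Subset m → ℚ
    coeff-nonneg  : ∀ I → 0ℚ ≤ coeff I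
    coeff-support : ∀ I → ¬ ℐ I → coeff I ≡ 0ℚ
    coeff-total   : ∑-subsets m coeff ≡ 1ℚ
    coeff-rate    : ∀ e →
      g e ≡ ∑-subsets m (λ I → if Vec.lookup I e then coeff I else 0ℚ)

-- Days are numbered 1, 2, … in the mathematics; here π t is the set cut on
-- day t + 1, and likewise height g π t is the vector of heights on day t + 1.
Schedule : ℕ → Set
Schedule m = ℕ → Subset m

Valid : ∀ {m} → (Subset m → Set) → Schedule m → Set
Valid ℐ π = ∀ t → ℐ (π t)

height : ∀ {m} → (Fin m → ℚ) → Schedule m → ℕ → Fin m → ℚ
height g π zero    e = g e
height g π (suc t) e =
  if Vec.lookup (π t) e then g e else height g π t e + g e

-- h(π) < b.  The supremum is strictly below b exactly when some rational
-- B < b bounds all heights; a pointwise bound by b itself would only give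
-- h(π) ≤ b.
MaxHeight< : ∀ {m} → (Fin m → ℚ) → Schedule m → ℚ → Set
MaxHeight< g π b = ∃[ B ] (B < b × (∀ t e → height g π t e ≤ B))

------------------------------------------------------------------------
-- Undirected graphs (loops and parallel edges allowed) with vertex set
-- Fin n and edge set Fin m.  The order of the two endpoints is irrelevant.

Graph : ℕ → ℕ → Set
Graph n m = Fin m → Fin n × Fin n

module _ {n m : ℕ} (G : Graph n m) where

  Joins : Fin m → Fin n → Fin n → Set
  Joins e u v = G e ≡ (u , v) ⊎ G e ≡ (v , u)

  data Walk : Fin n → Fin n → Set where
    stop : ∀ {u} → Walk u u
    step : ∀ {u v w} (e : Fin m) → Joins e u v → Walk v w → Walk u w

  edges : ∀ {u v} → Walk u v → List (Fin m)
  edges stop         = []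
  edges (step e _ w) = e ∷ edges w

  -- All visited vertices except the final one.
  sources : ∀ {u v} → Walk u v → List (Fin n)
  sources stop                 = []
  sources (step {u = u} _ _ w) = u ∷ sources w

  -- A loop is a cycle of length 1, two parallel edges form one of length 2.
  IsCycle : ∀ {v} → Walk v v → Set
  IsCycle w = edges w ≢ [] × Unique (edges w) × Unique (sources w)

  IsForest : Subset m → Set
  IsForest I = ∀ {v} (w : Walk v v) → All (_∈ I) (edges w) → ¬ IsCycle w

------------------------------------------------------------------------
-- Model of computation: programs over binary trees, a variable-free form of
-- Jones' language WHILE.  The only data are trees built from the atom nil,
-- and the only operations are building a pair, taking a component, and
-- testing for nil.  Each takes constant time on a pointer machine, so time
-- in this model is polynomially related to time on a Turing machine.

infixr 5 _∙_

data Tree : Set where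
  nil : Tree
  _∙_ : Tree → Tree → Tree

size : Tree → ℕ
size nil     = 1
size (x ∙ y) = suc (size x ℕ.+ size y)

infixl 4 _⨾_

data Program : Set where
  skip nil hd tl : Program
  pair           : Program → Program → Program
  _⨾_            : Program → Program → Program
  cond           : (test yes no : Program) → Program
  while          : (test body : Program) → Program

-- p ⊢ x ⇓ y [ c ]: on input x, program p halts with output y after c steps.
-- In tests nil is false and every other tree is true; hd and tl of nil are nil.
infix 3 _⊢_⇓_[_]

data _⊢_⇓_[_] : Program → Tree → Tree → ℕ → Set where
  skip  : ∀ {x} → skip ⊢ x ⇓ x [ 1 ]
  nil   : ∀ {x} → nil ⊢ x ⇓ nil [ 1 ]
  hd-∙  : ∀ {x y} → hd ⊢ x ∙ y ⇓ x [ 1 ]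
  hd-nil : hd ⊢ nil ⇓ nil [ 1 ]
  tl-∙  : ∀ {x y} → tl ⊢ x ∙ y ⇓ y [ 1 ]
  tl-nil : tl ⊢ nil ⇓ nil [ 1 ]
  pair  : ∀ {p q x y z a b} →
          p ⊢ x ⇓ y [ a ] → q ⊢ x ⇓ z [ b ] →
          pair p q ⊢ x ⇓ y ∙ z [ suc (a ℕ.+ b) ]
  _⨾_   : ∀ {p q x y z a b} →
          p ⊢ x ⇓ y [ a ] → q ⊢ y ⇓ z [ b ] →
          p ⨾ q ⊢ x ⇓ z [ suc (a ℕ.+ b) ]
  cond-yes : ∀ {p q r x u v y a b} →
          p ⊢ x ⇓ u ∙ v [ a ] → q ⊢ x ⇓ y [ b ] →
          cond p q r ⊢ x ⇓ y [ suc (a ℕ.+ b) ]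
  cond-no : ∀ {p q r x y a b} →
          p ⊢ x ⇓ nil [ a ] → r ⊢ x ⇓ y [ b ] →
          cond p q r ⊢ x ⇓ y [ suc (a ℕ.+ b) ]
  while-done : ∀ {p q x a} →
          p ⊢ x ⇓ nil [ a ] →
          while p q ⊢ x ⇓ x [ suc a ]
  while-step : ∀ {p q x u v y z a b c} →
          p ⊢ x ⇓ u ∙ v [ a ] → q ⊢ x ⇓ y [ b ] → while p q ⊢ y ⇓ z [ c ] →
          while p q ⊢ x ⇓ z [ suc (a ℕ.+ b ℕ.+ c) ]

_⊢_⇓_within_ : Program → Tree → Tree → ℕ → Set
p ⊢ x ⇓ y within T = ∃[ c ] (c ℕ.≤ T × (p ⊢ x ⇓ y [ c ]))

------------------------------------------------------------------------
-- Encodings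

encodeList : List Tree → Tree
encodeList []       = nil
encodeList (x ∷ xs) = x ∙ encodeList xs

encodeBool : Bool → Tree
encodeBool false = nil
encodeBool true  = nil ∙ nil

-- Binary digits, least significant first, without leading zeros.
increment : List Bool → List Bool
increment []           = true ∷ []
increment (false ∷ bs) = true ∷ bs
increment (true  ∷ bs) = false ∷ increment bs

bits : ℕ → List Bool
bits zero    = []
bits (suc n) = increment (bits n)

encodeℕ : ℕ → Tree
encodeℕ n = encodeList (map encodeBool (bits n))

encodeFin : ∀ {n} → Fin n → Tree
encodeFin i = encodeℕ (toℕ i)

-- Only used for nonnegative rationals, hence no sign.
encodeℚ : ℚ → Tree
encodeℚ q = encodeℕ ∣ ↥ q ∣ ∙ encodeℕ (↧ₙ q)

-- The list of vertices, and the list of edges with endpoints and growth rate.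
encodeInstance : ∀ {n m} → Graph n m → (Fin m → ℚ) → Tree
encodeInstance {n} {m} G g =
    encodeList (map encodeFin (allFin n))
  ∙ encodeList (map edge (allFin m))
  where
  edge : Fin m → Tree
  edge e = (encodeFin (proj₁ (G e)) ∙ encodeFin (proj₂ (G e))) ∙ encodeℚ (g e)

-- Characteristic vector, in the order in which the input lists the edges.
encodeSubset : ∀ {m} → Subset m → Tree
encodeSubset I = encodeList (map encodeBool (Vec.toList I))

------------------------------------------------------------------------
-- Algorithms producing an infinite schedule one step at a time.  The first
-- program turns the input into an initial state; the second turns each state
-- into the next set of the schedule, paired with the successor state.

record Algorithm : Set where
  field
    preprocess : Program
    next       : Program

-- T bounds separately the preprocessing and the computation of each set.
ImplementsWithin : ∀ {m} → ℕ → Algorithm → Tree → Schedule m → Set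
ImplementsWithin T A input π =
  Σ[ state ∈ (ℕ → Tree) ]
    (preprocess ⊢ input ⇓ state 0 within T) ×
    (∀ t → next ⊢ state t ⇓ encodeSubset (π t) ∙ state (suc t) within T)
  where open Algorithm A

{-# OPTIONS --safe #-}

-- For a positive rate g(e) let k be least with 2 ≤ 2ᵏ g(e); then 2ᵏ g(e) < 4, so it suffices to cut e every 2ᵏ days.
-- A forest whose edges have all their endpoints in S has at most |S| edges.  Averaging this over the given convex
-- combination of forests, among the vertices of any nonempty set of edges there is one at which the rates of these edges
-- sum to at most 2, and hence the numbers 2⁻ᵏ to at most 1.  The vertices are therefore eliminated one by one: the edges
-- that join v to vertices not yet eliminated receive pairwise incompatible bit strings of lengths k (as in Kraft's
-- inequality), and e is cut on the days t ≡ -p (mod 2ᵏ), where p is its string read with the least significant bit first.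
-- At most one of these edges is cut on any day, so a closed trail of edges cut on the same day cannot pass through v.
--
-- No arithmetic on rates other than shifts and comparisons is needed, and counting days modulo 2ᵏ separately for every
-- edge keeps the state of the algorithm at a fixed polynomial size.
module Submission where

open import Defs
open import Data.Bool.Base using (Bool; true; false; if_then_else_; not; _∧_; _∨_; _xor_)
open import Data.Empty using (⊥; ⊥-elim)
open import Data.Fin.Base using (Fin; zero; suc; toℕ)
open import Data.Fin.Properties using (_≟_; any?; injective⇒≤; toℕ-injective)
open import Data.Fin.Subset using (Subset; inside; outside; _∈_; _∉_; _⊆_; _∩_; _-_; Nonempty) renaming (∣_∣ to card)
open import Data.Fin.Subset.Properties using (_∈?_; nonempty?; Empty-unique; ∣⊥∣≡0; ∣p∣≤n; p⊆q⇒∣p∣≤∣q∣; p⊂q⇒∣p∣<∣q∣; p∩q⊆p; p∩q⊆q; p─q⊆p; p─⊥≡p; x∈p∧x≢y⇒x∈p-y; x∈p⇒∣p-x∣<∣p∣)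
open import Data.Integer.Base as ℤ using (+_; -[1+_])
import Data.Integer.Properties as ℤ
open import Data.List.Base as List using (List; []; _∷_; _++_; _ʳ++_; allFin; foldl; length; lookup; map; reverse)
open import Data.List.Membership.DecPropositional using () renaming (_∈?_ to member?)
open import Data.List.Membership.Propositional using () renaming (_∈_ to _∈ˡ_; _∉_ to _∉ˡ_)
open import Data.List.Membership.Propositional.Properties using (∈-allFin; ∈-lookup)
open import Data.List.Properties using (++-identityʳ; length-map; length-reverse; length-tabulate; length-ʳ++; map-∘; map-tabulate; reverse-involutive; unfold-reverse)
open import Data.List.Relation.Unary.All as All using (All; []; _∷_)
open import Data.List.Relation.Unary.AllPairs using ([]; _∷_)
open import Data.List.Relation.Unary.Any using (here; there)
open import Data.List.Relation.Unary.Unique.Propositional using (Unique)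
open import Data.List.Relation.Unary.Unique.Propositional.Properties using (allFin⁺)
open import Data.Nat.Base using (ℕ; zero; suc; z≤n; s≤s; _+_; _*_; _^_; _≤_; _<_)
open import Data.Nat.Properties hiding (_≟_)
open import Data.Nat.Tactic.RingSolver using (solve-∀)
open import Data.Product.Base using (Σ-syntax; ∃-syntax; _×_; _,_; proj₁; proj₂)
open import Data.Rational.Base as ℚ using (ℚ; 0ℚ; 1ℚ; mkℚ; toℚᵘ; ↥_; ↧ₙ_; _/_)
import Data.Rational.Properties as ℚ
open import Data.Rational.Unnormalised.Base as ℚᵘ using (mkℚᵘ; *≡*)
import Data.Rational.Unnormalised.Properties as ℚᵘ
open import Data.Sum.Base using (_⊎_; inj₁; inj₂)
open import Data.Vec.Base as Vec using ([]; _∷_; here; there)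
import Data.Vec.Properties as Vec
open import Function.Base using (_∘_; id)
open import Relation.Binary.PropositionalEquality
open import Relation.Nullary using (Dec; yes; no; ¬_; does)
open import Relation.Nullary.Decidable using (_×-dec_; _⊎-dec_; ¬?; dec-true; dec-false)
open import Relation.Nullary.Reflects using (Reflects; ofʸ; ofⁿ)
open import Algebra.Properties.CommutativeMonoid.Sum ℚ.+-0-commutativeMonoid using () renaming (sum to ∑; sum-cong-≗ to ∑-cong; ∑-distrib-+ to ∑-+; ∑-comm to ∑-swap)

-- Polynomial bounds

-- The constant 4 is the product of two factors 2: every edge adds to the degree at both of its
-- ends, so averaging yields a vertex of degree at most 2; and rounding the period to a power of two
-- costs a factor below 2, since rates are at most 1, hence `k` is positive and its leastness gives
-- the strict bound. Sparse vertices are never identified, as that would require adding rates. Every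
-- vertex is tried, and a try that leaves a live edge at the vertex is undone. Greedy assignment by
-- increasing length fails only where the live rates sum to more than 2, so each sweep over the
-- vertices retires an edge as long as one is live. Two incompatible strings differ at a first
-- position, which adding 1 to both numbers preserves because equal lower digits produce equal
-- carries. So the counters stay incompatible and are never 0 together. Edges of rate 0, among them
-- all loops, are kept out of the elimination altogether. A program can double a tree in constantly
-- many steps, so a step count does not bound sizes; every function therefore carries a bound on the
-- size of its output too.

infixl 6 _⊕_
infixl 7 _⊛_
infixl 8 _⊙_

-- Bounds are syntax rather than functions so that monotonicity and a monomial bound follow by
-- induction. Composition `_⊙_` is included because the second of two programs is timed on the
-- output of the first.
data Poly : Set where
  κ           : ℕ → Poly
  X           : Poly
  _⊕_ _⊛_ _⊙_ : Poly → Poly → Poly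

⟦_⟧ : Poly → ℕ → ℕ
⟦ κ c ⟧   n = c
⟦ X ⟧     n = n
⟦ p ⊕ q ⟧ n = ⟦ p ⟧ n + ⟦ q ⟧ n
⟦ p ⊛ q ⟧ n = ⟦ p ⟧ n * ⟦ q ⟧ n
⟦ p ⊙ q ⟧ n = ⟦ p ⟧ (⟦ q ⟧ n)

⟦⟧-mono : ∀ p {m n} → m ≤ n → ⟦ p ⟧ m ≤ ⟦ p ⟧ n
⟦⟧-mono (κ c)   m≤n = ≤-refl
⟦⟧-mono X       m≤n = m≤n
⟦⟧-mono (p ⊕ q) m≤n = +-mono-≤ (⟦⟧-mono p m≤n) (⟦⟧-mono q m≤n)
⟦⟧-mono (p ⊛ q) m≤n = *-mono-≤ (⟦⟧-mono p m≤n) (⟦⟧-mono q m≤n)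
⟦⟧-mono (p ⊙ q) m≤n = ⟦⟧-mono p (⟦⟧-mono q m≤n)

-- A positive coefficient makes the monomial at least 1, so that in a composition the outer bound,
-- valid only from 1 on, applies to the inner one.
record BoundedByMonomial (f : ℕ → ℕ) : Set where
  constructor monomial
  field
    coefficient exponent : ℕ
    coefficient>0        : 1 ≤ coefficient
    bounded              : ∀ {n} → 1 ≤ n → f n ≤ coefficient * n ^ exponent

1≤^ : ∀ {n} d → 1 ≤ n → 1 ≤ n ^ d
1≤^ zero    1≤n = ≤-refl
1≤^ (suc d) 1≤n = *-mono-≤ 1≤n (1≤^ d 1≤n)

^-distribʳ-* : ∀ d m n → (m * n) ^ d ≡ m ^ d * n ^ d
^-distribʳ-* zero    m n = refl
^-distribʳ-* (suc d) m n = trans (cong (m * n *_) (^-distribʳ-* d m n)) (swap m n (m ^ d) (n ^ d))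
  where
  swap : ∀ a b c d → a * b * (c * d) ≡ a * c * (b * d)
  swap = solve-∀

poly-bounded : ∀ p → BoundedByMonomial ⟦ p ⟧
poly-bounded (κ c) = monomial (suc c) 0 (s≤s z≤n)
  λ _ → ≤-trans (n≤1+n c) (≤-reflexive (sym (*-identityʳ (suc c))))
poly-bounded X = monomial 1 1 ≤-refl
  λ {n} _ → ≤-reflexive (sym (trans (*-identityˡ (n ^ 1)) (*-identityʳ n)))
poly-bounded (p ⊕ q) with poly-bounded p | poly-bounded q
... | monomial c d c>0 b | monomial c′ d′ c′>0 b′ =
  monomial (c + c′) (d + d′) (≤-trans c>0 (m≤m+n c c′)) λ {n} 1≤n → begin
    ⟦ p ⟧ n + ⟦ q ⟧ n                          ≤⟨ +-mono-≤ (b 1≤n) (b′ 1≤n) ⟩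
    c * n ^ d + c′ * n ^ d′                    ≤⟨ +-mono-≤ (*-monoʳ-≤ c (^≤ d 1≤n)) (*-monoʳ-≤ c′ (^≤′ d′ 1≤n)) ⟩
    c * n ^ (d + d′) + c′ * n ^ (d + d′)       ≡⟨ *-distribʳ-+ (n ^ (d + d′)) c c′ ⟨
    (c + c′) * n ^ (d + d′)                    ∎
  where
  open ≤-Reasoning
  ^≤ : ∀ {n} d → 1 ≤ n → n ^ d ≤ n ^ (d + d′)
  ^≤ {n} d 1≤n = begin
    n ^ d            ≡⟨ *-identityʳ (n ^ d) ⟨
    n ^ d * 1        ≤⟨ *-monoʳ-≤ (n ^ d) (1≤^ d′ 1≤n) ⟩
    n ^ d * n ^ d′   ≡⟨ ^-distribˡ-+-* n d d′ ⟨
    n ^ (d + d′)     ∎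
  ^≤′ : ∀ {n} d′ → 1 ≤ n → n ^ d′ ≤ n ^ (d + d′)
  ^≤′ {n} d′ 1≤n = begin
    n ^ d′           ≡⟨ *-identityˡ (n ^ d′) ⟨
    1 * n ^ d′       ≤⟨ *-monoˡ-≤ (n ^ d′) (1≤^ d 1≤n) ⟩
    n ^ d * n ^ d′   ≡⟨ ^-distribˡ-+-* n d d′ ⟨
    n ^ (d + d′)     ∎
poly-bounded (p ⊛ q) with poly-bounded p | poly-bounded q
... | monomial c d c>0 b | monomial c′ d′ c′>0 b′ =
  monomial (c * c′) (d + d′) (*-mono-≤ c>0 c′>0) λ {n} 1≤n → begin
    ⟦ p ⟧ n * ⟦ q ⟧ n              ≤⟨ *-mono-≤ (b 1≤n) (b′ 1≤n) ⟩
    c * n ^ d * (c′ * n ^ d′)      ≡⟨ swap c (n ^ d) c′ (n ^ d′) ⟩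
    c * c′ * (n ^ d * n ^ d′)      ≡⟨ cong (c * c′ *_) (^-distribˡ-+-* n d d′) ⟨
    c * c′ * n ^ (d + d′)          ∎
  where
  open ≤-Reasoning
  swap : ∀ a b c d → a * b * (c * d) ≡ a * c * (b * d)
  swap = solve-∀
poly-bounded (p ⊙ q) with poly-bounded p | poly-bounded q
... | monomial c d c>0 b | monomial c′ d′ c′>0 b′ =
  monomial (c * c′ ^ d) (d′ * d) (*-mono-≤ c>0 (1≤^ d c′>0)) λ {n} 1≤n → begin
    ⟦ p ⟧ (⟦ q ⟧ n)               ≤⟨ ⟦⟧-mono p (b′ 1≤n) ⟩
    ⟦ p ⟧ (c′ * n ^ d′)           ≤⟨ b (*-mono-≤ c′>0 (1≤^ d′ 1≤n)) ⟩
    c * (c′ * n ^ d′) ^ d         ≡⟨ cong (c *_) (^-distribʳ-* d c′ (n ^ d′)) ⟩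
    c * (c′ ^ d * (n ^ d′) ^ d)   ≡⟨ cong (λ z → c * (c′ ^ d * z)) (^-*-assoc n d′ d) ⟩
    c * (c′ ^ d * n ^ (d′ * d))   ≡⟨ *-assoc c (c′ ^ d) (n ^ (d′ * d)) ⟨
    c * c′ ^ d * n ^ (d′ * d)     ∎
  where open ≤-Reasoning

-- Typed data and polynomial-time computable functions on them

infixr 5 _⊗_

data Ty : Set where
  bool : Ty
  list : Ty → Ty
  _⊗_  : Ty → Ty → Ty

El : Ty → Set
El bool     = Bool
El (list A) = List (El A)
El (A ⊗ B)  = El A × El B

enc : ∀ A → El A → Tree
enc bool     b       = encodeBool b
enc (list A) xs      = encodeList (map (enc A) xs)
enc (A ⊗ B)  (x , y) = enc A x ∙ enc B y

⟨_⟩∣_∣ : ∀ A → El A → ℕ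
⟨ A ⟩∣ x ∣ = size (enc A x)

-- `space` is independent of `time`: `pair skip skip` doubles the size of a tree in three steps.
record Comp (A B : Ty) (f : El A → El B) : Set where
  field
    program    : Program
    time space : Poly
    runs       : ∀ x → program ⊢ enc A x ⇓ enc B (f x) within ⟦ time ⟧ ⟨ A ⟩∣ x ∣
    fits       : ∀ x → ⟨ B ⟩∣ f x ∣ ≤ ⟦ space ⟧ ⟨ A ⟩∣ x ∣

open Comp

castC : ∀ {A B f g} → (∀ x → f x ≡ g x) → Comp A B f → Comp A B g
castC f≗g c = record
  { program = program c
  ; time    = time c
  ; space   = space c
  ; runs    = λ x → subst (λ y → program c ⊢ _ ⇓ enc _ y within _) (f≗g x) (runs c x)
  ; fits    = λ x → subst (λ y → ⟨ _ ⟩∣ y ∣ ≤ _) (f≗g x) (fits c x)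
  }

infixl 4 _>>>_

_>>>_ : ∀ {A B C f g} → Comp A B f → Comp B C g → Comp A C (g ∘ f)
_>>>_ {A} {B} {C} {f} {g} p q = record
  { program = program p ⨾ program q
  ; time    = κ 1 ⊕ time p ⊕ time q ⊙ space p
  ; space   = space q ⊙ space p
  ; runs    = λ x → let a , a≤ , r = runs p x ; b , b≤ , s = runs q (f x) in
      suc (a + b) , s≤s (+-mono-≤ a≤ (≤-trans b≤ (⟦⟧-mono (time q) (fits p x)))) , (r ⨾ s)
  ; fits    = λ x → ≤-trans (fits q (f x)) (⟦⟧-mono (space q) (fits p x))
  }

idC : ∀ {A} → Comp A A id
idC = record { program = skip ; time = κ 1 ; space = X
             ; runs = λ x → 1 , ≤-refl , skip ; fits = λ x → ≤-refl }

pairC : ∀ {A B C f g} → Comp A B f → Comp A C g → Comp A (B ⊗ C) (λ x → f x , g x)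
pairC p q = record
  { program = pair (program p) (program q)
  ; time    = κ 1 ⊕ time p ⊕ time q
  ; space   = κ 1 ⊕ space p ⊕ space q
  ; runs    = λ x → let a , a≤ , r = runs p x ; b , b≤ , s = runs q x in
      suc (a + b) , s≤s (+-mono-≤ a≤ b≤) , pair r s
  ; fits    = λ x → s≤s (+-mono-≤ (fits p x) (fits q x))
  }

fstC : ∀ {A B} → Comp (A ⊗ B) A proj₁
fstC = record { program = hd ; time = κ 1 ; space = X ; runs = λ x → 1 , ≤-refl , hd-∙
              ; fits = λ x → ≤-trans (m≤m+n _ _) (n≤1+n _) }

sndC : ∀ {A B} → Comp (A ⊗ B) B proj₂
sndC = record { program = tl ; time = κ 1 ; space = X ; runs = λ x → 1 , ≤-refl , tl-∙
              ; fits = λ x → ≤-trans (m≤n+m _ _) (n≤1+n _) }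

falseC : ∀ {A} → Comp A bool (λ _ → false)
falseC = record { program = nil ; time = κ 1 ; space = κ 1 ; runs = λ x → 1 , ≤-refl , nil ; fits = λ x → ≤-refl }

trueC : ∀ {A} → Comp A bool (λ _ → true)
trueC = record { program = pair nil nil ; time = κ 3 ; space = κ 3
               ; runs = λ x → 3 , ≤-refl , pair nil nil ; fits = λ x → ≤-refl }

nilC : ∀ {A B} → Comp A (list B) (λ _ → [])
nilC = record { program = nil ; time = κ 1 ; space = κ 1 ; runs = λ x → 1 , ≤-refl , nil ; fits = λ x → ≤-refl }

consC : ∀ {A B f g} → Comp A B f → Comp A (list B) g → Comp A (list B) (λ x → f x ∷ g x)
consC {A} {B} p q = record { program = program r ; time = time r ; space = space r ; runs = runs r ; fits = fits r }
  where r = pairC p q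

ifC : ∀ {A B b f g} → Comp A bool b → Comp A B f → Comp A B g →
      Comp A B (λ x → if b x then f x else g x)
ifC {A} {B} {b} {f} {g} t p q = record
  { program = cond (program t) (program p) (program q)
  ; time    = κ 1 ⊕ time t ⊕ (time p ⊕ time q)
  ; space   = space p ⊕ space q
  ; runs    = run
  ; fits    = fit
  }
  where
  run : ∀ x → cond (program t) (program p) (program q) ⊢ enc A x ⇓ enc B (if b x then f x else g x)
          within ⟦ κ 1 ⊕ time t ⊕ (time p ⊕ time q) ⟧ ⟨ A ⟩∣ x ∣
  run x with b x | runs t x
  ... | true  | a , a≤ , r = let c , c≤ , s = runs p x in
    suc (a + c) , s≤s (+-mono-≤ a≤ (≤-trans c≤ (m≤m+n _ _))) , cond-yes r s
  ... | false | a , a≤ , r = let c , c≤ , s = runs q x in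
    suc (a + c) , s≤s (+-mono-≤ a≤ (≤-trans c≤ (m≤n+m _ _))) , cond-no r s
  fit : ∀ x → ⟨ B ⟩∣ (if b x then f x else g x) ∣ ≤ ⟦ space p ⊕ space q ⟧ ⟨ A ⟩∣ x ∣
  fit x with b x
  ... | true  = ≤-trans (fits p x) (m≤m+n _ _)
  ... | false = ≤-trans (fits q x) (m≤n+m _ _)

caseList : {A B : Set} → List A → B → (A → List A → B) → B
caseList []       n c = n
caseList (x ∷ xs) n c = c x xs

caseC : ∀ {A B C l n c} → Comp A (list B) l → Comp A C n → Comp (A ⊗ B ⊗ list B) C c →
        Comp A C (λ x → caseList (l x) (n x) (λ y ys → c (x , y , ys)))
caseC {A} {B} {C} {l} {n} {c} t p q = record
  { program = P
  ; time    = T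
  ; space   = space p ⊕ space q ⊙ (κ 1 ⊕ X ⊕ space t)
  ; runs    = run
  ; fits    = fit
  }
  where
  r = pairC idC t
  -- `cond` does not pass on the tested value, so `r` computes the list again. A nonempty list is
  -- encoded as the pair of its head and tail, which is the form that `q` expects.
  P = cond (program t) (program r ⨾ program q) (program p)
  T = κ 1 ⊕ time t ⊕ (time p ⊕ (κ 1 ⊕ time r ⊕ time q ⊙ (κ 1 ⊕ X ⊕ space t)))
  run : ∀ x → P ⊢ enc A x ⇓ enc C (caseList (l x) (n x) (λ y ys → c (x , y , ys)))
          within ⟦ T ⟧ ⟨ A ⟩∣ x ∣
  run x with l x | runs t x | runs r x | fits t x
  ... | []     | a , a≤ , e | _ | _ = let b , b≤ , s = runs p x in
    suc (a + b) , s≤s (+-mono-≤ a≤ (≤-trans b≤ (m≤m+n _ _))) , cond-no e s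
  ... | y ∷ ys | a , a≤ , e | b , b≤ , s | fit = let d , d≤ , u = runs q (x , y , ys) in
    suc (a + suc (b + d)) ,
    s≤s (+-mono-≤ a≤ (≤-trans (s≤s (+-mono-≤ b≤
      (≤-trans d≤ (⟦⟧-mono (time q) (s≤s (+-monoʳ-≤ ⟨ A ⟩∣ x ∣ fit)))))) (m≤n+m _ _))) ,
    cond-yes e (s ⨾ u)
  fit : ∀ x → ⟨ C ⟩∣ caseList (l x) (n x) (λ y ys → c (x , y , ys)) ∣ ≤
              ⟦ space p ⊕ space q ⊙ (κ 1 ⊕ X ⊕ space t) ⟧ ⟨ A ⟩∣ x ∣
  fit x with l x | fits t x
  ... | []     | _ = ≤-trans (fits p x) (m≤m+n _ _)
  ... | y ∷ ys | b = ≤-trans (≤-trans (fits q (x , y , ys)) (⟦⟧-mono (space q) (s≤s (+-monoʳ-≤ ⟨ A ⟩∣ x ∣ b))))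
                             (m≤n+m _ _)

length≤size : ∀ A xs → length xs ≤ ⟨ list A ⟩∣ xs ∣
length≤size A []       = z≤n
length≤size A (x ∷ xs) = s≤s (≤-trans (length≤size A xs) (m≤n+m _ _))

size-prefix : ∀ A xs ys → ⟨ list A ⟩∣ xs ∣ ≤ ⟨ list A ⟩∣ xs ++ ys ∣
size-prefix A []       []       = ≤-refl
size-prefix A []       (y ∷ ys) = s≤s z≤n
size-prefix A (x ∷ xs) ys       = s≤s (+-monoʳ-≤ ⟨ A ⟩∣ x ∣ (size-prefix A xs ys))

-- The space bound quantifies over all lists and initial states, so that it also bounds the intermediate states.
foldC : ∀ {A B S l i st} → Comp A (list B) l → Comp A S i → Comp ((A ⊗ S) ⊗ B) S st →
  (P : Poly) →
  (∀ x s ys → ⟨ S ⟩∣ foldl (λ s y → st ((x , s) , y)) s ys ∣ ≤ ⟦ P ⟧ (⟨ A ⟩∣ x ∣ + ⟨ S ⟩∣ s ∣ + ⟨ list B ⟩∣ ys ∣)) →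
  Comp A S (λ x → foldl (λ s y → st ((x , s) , y)) (i x) (l x))
foldC {A} {B} {S} {l} {i} {st} cl ci cst P bound = record
  { program = program setup ⨾ (while hd body ⨾ (tl ⨾ tl))
  ; time    = κ 7 ⊕ time setup ⊕ space cl ⊛ (κ 16 ⊕ step-time)
  ; space   = total
  ; runs    = run
  ; fits    = λ x → ≤-trans (bound x (i x) (l x))
      (⟦⟧-mono P (+-mono-≤ (+-monoʳ-≤ ⟨ A ⟩∣ x ∣ (fits ci x)) (fits cl x)))
  }
  where
  -- The loop runs on triples of remaining items, environment and state. The test `hd` works because
  -- exactly the empty list is encoded as `nil`.
  body : Program
  body = pair (hd ⨾ tl) (pair (tl ⨾ hd) (pair tl (hd ⨾ hd) ⨾ program cst))

  setup : Comp A (list B ⊗ A ⊗ S) (λ x → l x , x , i x)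
  setup = pairC cl (pairC idC ci)

  total step-time : Poly
  total     = P ⊙ (X ⊕ space ci ⊕ space cl)
  step-time = time cst ⊙ (κ 2 ⊕ X ⊕ total ⊕ space cl)

  -- The state bound `M` is required after every prefix, since each iteration is timed on an
  -- intermediate state. An iteration takes 16 steps besides those of `cst`, and the failing final
  -- test takes 2.
  loop : ∀ x s ys M N → ⟨ list B ⟩∣ ys ∣ ≤ N →
    (∀ zs ws → zs ++ ws ≡ ys → ⟨ S ⟩∣ foldl (λ s y → st ((x , s) , y)) s zs ∣ ≤ M) →
    while hd body ⊢ (enc (list B) ys ∙ enc A x ∙ enc S s)
      ⇓ (nil ∙ enc A x ∙ enc S (foldl (λ s y → st ((x , s) , y)) s ys))
      within (2 + length ys * (16 + ⟦ time cst ⟧ (2 + ⟨ A ⟩∣ x ∣ + M + N)))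
  loop x s []       M N ys≤ small = 2 , ≤-refl , while-done hd-∙
  loop x s (y ∷ ys) M N ys≤ small =
    let a , a≤ , r = runs cst ((x , s) , y)
        c , c≤ , e = loop x (st ((x , s) , y)) ys M N
                       (≤-trans (≤-trans (m≤n+m _ _) (n≤1+n _)) ys≤)
                       (λ zs ws eq → small (y ∷ zs) ws (cong (y ∷_) eq))
    in 16 + (a + c) ,
       (begin
         16 + (a + c)                         ≤⟨ +-monoʳ-≤ 16 (+-mono-≤ (≤-trans a≤ (⟦⟧-mono (time cst) arg)) c≤) ⟩
         16 + (τ + (2 + length ys * (16 + τ))) ≡⟨ rearrange τ (length ys * (16 + τ)) ⟩
         2 + (16 + τ + length ys * (16 + τ))   ∎) ,
       while-step hd-∙ (pair (hd-∙ ⨾ tl-∙) (pair (tl-∙ ⨾ hd-∙) (pair tl-∙ (hd-∙ ⨾ hd-∙) ⨾ r))) e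
    where
    open ≤-Reasoning
    τ = ⟦ time cst ⟧ (2 + ⟨ A ⟩∣ x ∣ + M + N)
    rearrange : ∀ τ l → 16 + (τ + (2 + l)) ≡ 2 + (16 + τ + l)
    rearrange = solve-∀
    arg : ⟨ (A ⊗ S) ⊗ B ⟩∣ (x , s) , y ∣ ≤ 2 + ⟨ A ⟩∣ x ∣ + M + N
    arg = s≤s (s≤s (+-mono-≤ (+-monoʳ-≤ ⟨ A ⟩∣ x ∣ (small [] (y ∷ ys) refl))
                             (≤-trans (≤-trans (m≤m+n _ _) (n≤1+n _)) ys≤)))

  run : ∀ x → (program setup ⨾ (while hd body ⨾ (tl ⨾ tl))) ⊢ enc A x
      ⇓ enc S (foldl (λ s y → st ((x , s) , y)) (i x) (l x))
      within ⟦ κ 7 ⊕ time setup ⊕ space cl ⊛ (κ 16 ⊕ step-time) ⟧ ⟨ A ⟩∣ x ∣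
  run x =
    let a , a≤ , r = runs setup x
        b , b≤ , e = loop x (i x) (l x) (⟦ total ⟧ ⟨ A ⟩∣ x ∣) (⟦ space cl ⟧ ⟨ A ⟩∣ x ∣) (fits cl x) small
    in suc (a + suc (b + 3)) ,
       (begin
         suc (a + suc (b + 3))                       ≤⟨ s≤s (+-mono-≤ a≤ (s≤s (+-monoˡ-≤ 3 b≤))) ⟩
         suc (σ + suc (2 + length (l x) * τ + 3))    ≡⟨ rearrange σ (length (l x) * τ) ⟩
         7 + σ + length (l x) * τ                    ≤⟨ +-monoʳ-≤ (7 + σ) (*-monoˡ-≤ τ (≤-trans (length≤size B (l x)) (fits cl x))) ⟩
         7 + σ + ⟦ space cl ⟧ ⟨ A ⟩∣ x ∣ * τ ∎) ,
       (r ⨾ (e ⨾ (tl-∙ ⨾ tl-∙)))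
    where
    open ≤-Reasoning
    σ = ⟦ time setup ⟧ ⟨ A ⟩∣ x ∣
    τ = 16 + ⟦ step-time ⟧ ⟨ A ⟩∣ x ∣
    rearrange : ∀ σ l → suc (σ + suc (2 + l + 3)) ≡ 7 + σ + l
    rearrange = solve-∀
    small : ∀ zs ws → zs ++ ws ≡ l x →
            ⟨ S ⟩∣ foldl (λ s y → st ((x , s) , y)) (i x) zs ∣ ≤ ⟦ total ⟧ ⟨ A ⟩∣ x ∣
    small zs ws eq = ≤-trans (bound x (i x) zs) (⟦⟧-mono P
      (+-mono-≤ (+-monoʳ-≤ ⟨ A ⟩∣ x ∣ (fits ci x))
        (≤-trans (subst (λ ys → ⟨ list B ⟩∣ zs ∣ ≤ ⟨ list B ⟩∣ ys ∣) eq (size-prefix B zs ws)) (fits cl x))))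

-- The growth per step must not depend on the state: steps that multiply its size could make a fold
-- exponential.
foldl-size : ∀ {A B S} (st : El A → El S → El B → El S) (Q : Poly) →
  (∀ x s y → ⟨ S ⟩∣ st x s y ∣ ≤ ⟨ S ⟩∣ s ∣ + ⟦ Q ⟧ (⟨ A ⟩∣ x ∣ + ⟨ B ⟩∣ y ∣)) →
  ∀ x s ys → ⟨ S ⟩∣ foldl (st x) s ys ∣ ≤ ⟦ X ⊕ X ⊛ Q ⟧ (⟨ A ⟩∣ x ∣ + ⟨ S ⟩∣ s ∣ + ⟨ list B ⟩∣ ys ∣)
foldl-size {A} {B} {S} st Q grow x s ys = begin
  ⟨ S ⟩∣ foldl (st x) s ys ∣                        ≤⟨ go s ys (⟨ A ⟩∣ x ∣ + ⟨ list B ⟩∣ ys ∣) ≤-refl ⟩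
  ⟨ S ⟩∣ s ∣ + length ys * ⟦ Q ⟧ (⟨ A ⟩∣ x ∣ + ⟨ list B ⟩∣ ys ∣)
    ≤⟨ +-mono-≤ (≤-trans (m≤n+m _ ⟨ A ⟩∣ x ∣) (m≤m+n _ _))
         (*-mono-≤ (≤-trans (length≤size B ys) (m≤n+m _ (⟨ A ⟩∣ x ∣ + ⟨ S ⟩∣ s ∣))) (⟦⟧-mono Q (+-monoˡ-≤ ⟨ list B ⟩∣ ys ∣ (m≤m+n ⟨ A ⟩∣ x ∣ ⟨ S ⟩∣ s ∣)))) ⟩
  ⟦ X ⊕ X ⊛ Q ⟧ (⟨ A ⟩∣ x ∣ + ⟨ S ⟩∣ s ∣ + ⟨ list B ⟩∣ ys ∣) ∎
  where
  open ≤-Reasoning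
  go : ∀ s ys N → ⟨ A ⟩∣ x ∣ + ⟨ list B ⟩∣ ys ∣ ≤ N → ⟨ S ⟩∣ foldl (st x) s ys ∣ ≤ ⟨ S ⟩∣ s ∣ + length ys * ⟦ Q ⟧ N
  go s []       N ≤N = m≤m+n _ _
  go s (y ∷ ys) N ≤N = begin
    ⟨ S ⟩∣ foldl (st x) (st x s y) ys ∣          ≤⟨ go (st x s y) ys N (≤-trans (+-monoʳ-≤ ⟨ A ⟩∣ x ∣ (≤-trans (m≤n+m _ _) (n≤1+n _))) ≤N) ⟩
    ⟨ S ⟩∣ st x s y ∣ + length ys * ⟦ Q ⟧ N       ≤⟨ +-monoˡ-≤ _ (grow x s y) ⟩
    ⟨ S ⟩∣ s ∣ + ⟦ Q ⟧ (⟨ A ⟩∣ x ∣ + ⟨ B ⟩∣ y ∣) + length ys * ⟦ Q ⟧ N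
      ≤⟨ +-monoˡ-≤ _ (+-monoʳ-≤ ⟨ S ⟩∣ s ∣ (⟦⟧-mono Q (≤-trans (+-monoʳ-≤ ⟨ A ⟩∣ x ∣ (≤-trans (m≤m+n _ _) (n≤1+n _))) ≤N))) ⟩
    ⟨ S ⟩∣ s ∣ + ⟦ Q ⟧ N + length ys * ⟦ Q ⟧ N    ≡⟨ +-assoc ⟨ S ⟩∣ s ∣ _ _ ⟩
    ⟨ S ⟩∣ s ∣ + (⟦ Q ⟧ N + length ys * ⟦ Q ⟧ N)  ∎

reverseC : ∀ {A B f} → Comp A (list B) f → Comp A (list B) (λ x → reverse (f x))
reverseC {A} {B} c = foldC c nilC (consC sndC (fstC >>> sndC)) (X ⊕ X ⊛ (X ⊕ κ 1))
  (foldl-size (λ _ s y → y ∷ s) (X ⊕ κ 1) λ x s y → begin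
    suc (⟨ B ⟩∣ y ∣ + ⟨ list B ⟩∣ s ∣)                    ≤⟨ s≤s (+-monoˡ-≤ _ (m≤n+m _ ⟨ A ⟩∣ x ∣)) ⟩
    suc (⟨ A ⟩∣ x ∣ + ⟨ B ⟩∣ y ∣ + ⟨ list B ⟩∣ s ∣)       ≡⟨ rearrange (⟨ A ⟩∣ x ∣ + ⟨ B ⟩∣ y ∣) ⟨ list B ⟩∣ s ∣ ⟩
    ⟨ list B ⟩∣ s ∣ + (⟨ A ⟩∣ x ∣ + ⟨ B ⟩∣ y ∣ + 1)       ∎)
  where
  open ≤-Reasoning
  rearrange : ∀ a b → suc (a + b) ≡ b + (a + 1)
  rearrange = solve-∀

mapAccum : {S A B : Set} → (S → A → S × B) → S → List A → S × List B
mapAccum f s []       = s , []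
mapAccum f s (x ∷ xs) =
  let s′ , y = f s x ; s″ , ys = mapAccum f s′ xs in s″ , y ∷ ys

mapAccum-foldl : {S A B : Set} (f : S → A → S × B) → ∀ s acc xs →
  foldl (λ (s , acc) x → proj₁ (f s x) , proj₂ (f s x) ∷ acc) (s , acc) xs
    ≡ (proj₁ (mapAccum f s xs) , (proj₂ (mapAccum f s xs) ʳ++ acc))
mapAccum-foldl f s acc []       = refl
mapAccum-foldl f s acc (x ∷ xs) = mapAccum-foldl f (proj₁ (f s x)) (proj₂ (f s x) ∷ acc) xs

size-ʳ++ : ∀ A xs ys → ⟨ list A ⟩∣ xs ʳ++ ys ∣ ≤ ⟨ list A ⟩∣ xs ∣ + ⟨ list A ⟩∣ ys ∣
size-ʳ++ A []       ys = n≤1+n _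
size-ʳ++ A (x ∷ xs) ys = begin
  ⟨ list A ⟩∣ xs ʳ++ (x ∷ ys) ∣                                ≤⟨ size-ʳ++ A xs (x ∷ ys) ⟩
  ⟨ list A ⟩∣ xs ∣ + suc (⟨ A ⟩∣ x ∣ + ⟨ list A ⟩∣ ys ∣)       ≡⟨ rearrange ⟨ list A ⟩∣ xs ∣ ⟨ A ⟩∣ x ∣ ⟨ list A ⟩∣ ys ∣ ⟩
  suc (⟨ A ⟩∣ x ∣ + ⟨ list A ⟩∣ xs ∣) + ⟨ list A ⟩∣ ys ∣       ∎
  where
  open ≤-Reasoning
  rearrange : ∀ a b c → a + suc (b + c) ≡ suc (b + a) + c
  rearrange = solve-∀

-- The outputs are collected by a fold in reverse order and reversed at the end.
mapAccumC : ∀ {A B C S l i st} → Comp A (list B) l → Comp A S i → Comp ((A ⊗ S) ⊗ B) (S ⊗ C) st →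
  (P : Poly) →
  (∀ x s ys → ⟨ S ⊗ list C ⟩∣ mapAccum (λ s y → st ((x , s) , y)) s ys ∣
              ≤ ⟦ P ⟧ (⟨ A ⟩∣ x ∣ + ⟨ S ⟩∣ s ∣ + ⟨ list B ⟩∣ ys ∣)) →
  Comp A (S ⊗ list C) (λ x → mapAccum (λ s y → st ((x , s) , y)) (i x) (l x))
mapAccumC {A} {B} {C} {S} {l} {i} {st} cl ci cst P bound =
  castC (λ x → cong₂ _,_ (cong proj₁ (eq x)) (trans (cong (reverse ∘ proj₂) (eq x)) (reverse-involutive _)))
    (folded >>> pairC fstC (reverseC sndC))
  where
  open ≤-Reasoning
  folded = foldC cl (pairC ci nilC)
    (pairC (pairC (pairC (fstC >>> fstC) (fstC >>> sndC >>> fstC)) sndC >>> cst >>> fstC)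
           (consC (pairC (pairC (fstC >>> fstC) (fstC >>> sndC >>> fstC)) sndC >>> cst >>> sndC) (fstC >>> sndC >>> sndC)))
    (P ⊕ X) λ { x (s , acc) ys → begin
      ⟨ S ⊗ list C ⟩∣ foldl _ (s , acc) ys ∣
        ≡⟨ cong ⟨ S ⊗ list C ⟩∣_∣ (mapAccum-foldl (λ s y → st ((x , s) , y)) s acc ys) ⟩
      ⟨ S ⊗ list C ⟩∣ proj₁ (res x s ys) , (proj₂ (res x s ys) ʳ++ acc) ∣
        ≤⟨ s≤s (+-monoʳ-≤ ⟨ S ⟩∣ proj₁ (res x s ys) ∣ (size-ʳ++ C (proj₂ (res x s ys)) acc)) ⟩
      suc (⟨ S ⟩∣ proj₁ (res x s ys) ∣ + (⟨ list C ⟩∣ proj₂ (res x s ys) ∣ + ⟨ list C ⟩∣ acc ∣))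
        ≡⟨ cong suc (+-assoc ⟨ S ⟩∣ proj₁ (res x s ys) ∣ _ _) ⟨
      ⟨ S ⊗ list C ⟩∣ res x s ys ∣ + ⟨ list C ⟩∣ acc ∣
        ≤⟨ +-mono-≤ (≤-trans (bound x s ys)
             (⟦⟧-mono P (+-monoˡ-≤ _ (+-monoʳ-≤ ⟨ A ⟩∣ x ∣ (≤-trans (m≤m+n _ _) (n≤1+n _))))))
             (≤-trans (≤-trans (m≤n+m _ _) (n≤1+n _)) (≤-trans (m≤n+m _ ⟨ A ⟩∣ x ∣) (m≤m+n _ _))) ⟩
      ⟦ P ⊕ X ⟧ (⟨ A ⟩∣ x ∣ + ⟨ S ⊗ list C ⟩∣ s , acc ∣ + ⟨ list B ⟩∣ ys ∣) ∎ }
    where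
    res : ∀ x s ys → El S × List (El C)
    res x s ys = mapAccum (λ s y → st ((x , s) , y)) s ys
  eq : ∀ x → _ ≡ _
  eq x = mapAccum-foldl (λ s y → st ((x , s) , y)) (i x) [] (l x)

-- New state and output are bounded jointly: what leaves the state may enter the output at no cost.
mapAccum-size : ∀ {A B C S} (st : El A → El S → El B → El S × El C) (Q : Poly) →
  (∀ x s y → ⟨ S ⟩∣ proj₁ (st x s y) ∣ + ⟨ C ⟩∣ proj₂ (st x s y) ∣
             ≤ ⟨ S ⟩∣ s ∣ + ⟦ Q ⟧ (⟨ A ⟩∣ x ∣ + ⟨ B ⟩∣ y ∣)) →
  ∀ x s ys → ⟨ S ⊗ list C ⟩∣ mapAccum (st x) s ys ∣
             ≤ ⟦ κ 2 ⊕ (X ⊕ X ⊛ (κ 1 ⊕ Q)) ⟧ (⟨ A ⟩∣ x ∣ + ⟨ S ⟩∣ s ∣ + ⟨ list B ⟩∣ ys ∣)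
mapAccum-size {A} {B} {C} {S} st Q grow x s ys = begin
  ⟨ S ⊗ list C ⟩∣ mapAccum (st x) s ys ∣    ≤⟨ go s ys (⟨ A ⟩∣ x ∣ + ⟨ list B ⟩∣ ys ∣) ≤-refl ⟩
  2 + (⟨ S ⟩∣ s ∣ + length ys * suc (⟦ Q ⟧ (⟨ A ⟩∣ x ∣ + ⟨ list B ⟩∣ ys ∣)))
    ≤⟨ +-monoʳ-≤ 2 (+-mono-≤ (≤-trans (m≤n+m _ ⟨ A ⟩∣ x ∣) (m≤m+n _ _))
         (*-mono-≤ (≤-trans (length≤size B ys) (m≤n+m _ (⟨ A ⟩∣ x ∣ + ⟨ S ⟩∣ s ∣))) (s≤s (⟦⟧-mono Q (+-monoˡ-≤ ⟨ list B ⟩∣ ys ∣ (m≤m+n ⟨ A ⟩∣ x ∣ ⟨ S ⟩∣ s ∣)))))) ⟩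
  ⟦ κ 2 ⊕ (X ⊕ X ⊛ (κ 1 ⊕ Q)) ⟧ (⟨ A ⟩∣ x ∣ + ⟨ S ⟩∣ s ∣ + ⟨ list B ⟩∣ ys ∣) ∎
  where
  open ≤-Reasoning
  rearrange : ∀ a b c → 1 + (a + suc (b + c)) ≡ 1 + (b + suc (a + c))
  rearrange = solve-∀
  rearrange′ : ∀ a b c d → suc (a + (2 + (b + d))) ≡ 3 + ((b + a) + d)
  rearrange′ = solve-∀
  rearrange″ : ∀ a b c → 3 + (a + b + c) ≡ 2 + (a + (suc b + c))
  rearrange″ = solve-∀
  go : ∀ s ys N → ⟨ A ⟩∣ x ∣ + ⟨ list B ⟩∣ ys ∣ ≤ N →
       ⟨ S ⊗ list C ⟩∣ mapAccum (st x) s ys ∣ ≤ 2 + (⟨ S ⟩∣ s ∣ + length ys * suc (⟦ Q ⟧ N))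
  go s []       N ≤N = s≤s (≤-reflexive (trans (+-comm ⟨ S ⟩∣ s ∣ 1) (cong suc (sym (+-identityʳ _)))))
  go s (y ∷ ys) N ≤N =
    let s′ = proj₁ (st x s y) ; z = proj₂ (st x s y) ; s″ = proj₁ (mapAccum (st x) s′ ys) in begin
    suc (⟨ S ⟩∣ s″ ∣ + suc (⟨ C ⟩∣ z ∣ + ⟨ list C ⟩∣ proj₂ (mapAccum (st x) s′ ys) ∣))
      ≡⟨ rearrange ⟨ S ⟩∣ s″ ∣ ⟨ C ⟩∣ z ∣ _ ⟩
    suc (⟨ C ⟩∣ z ∣ + ⟨ S ⊗ list C ⟩∣ mapAccum (st x) s′ ys ∣)
      ≤⟨ s≤s (+-monoʳ-≤ ⟨ C ⟩∣ z ∣ (go s′ ys N (≤-trans (+-monoʳ-≤ ⟨ A ⟩∣ x ∣ (≤-trans (m≤n+m _ _) (n≤1+n _))) ≤N))) ⟩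
    suc (⟨ C ⟩∣ z ∣ + (2 + (⟨ S ⟩∣ s′ ∣ + length ys * suc (⟦ Q ⟧ N))))
      ≡⟨ rearrange′ ⟨ C ⟩∣ z ∣ ⟨ S ⟩∣ s′ ∣ 0 (length ys * suc (⟦ Q ⟧ N)) ⟩
    3 + ((⟨ S ⟩∣ s′ ∣ + ⟨ C ⟩∣ z ∣) + length ys * suc (⟦ Q ⟧ N))
      ≤⟨ +-monoʳ-≤ 3 (+-monoˡ-≤ _ (≤-trans (grow x s y) (+-monoʳ-≤ ⟨ S ⟩∣ s ∣
           (⟦⟧-mono Q (≤-trans (+-monoʳ-≤ ⟨ A ⟩∣ x ∣ (≤-trans (m≤m+n _ _) (n≤1+n _))) ≤N))))) ⟩
    3 + (⟨ S ⟩∣ s ∣ + ⟦ Q ⟧ N + length ys * suc (⟦ Q ⟧ N))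
      ≡⟨ rearrange″ ⟨ S ⟩∣ s ∣ (⟦ Q ⟧ N) _ ⟩
    2 + (⟨ S ⟩∣ s ∣ + (suc (⟦ Q ⟧ N) + length ys * suc (⟦ Q ⟧ N))) ∎

mapC : ∀ {A B C l f} → Comp A (list B) l → Comp (A ⊗ B) C f → Comp A (list C) (λ x → map (λ y → f (x , y)) (l x))
mapC {A} {B} {C} {l} {f} cl cf = castC (λ x → eq x (l x)) (mapAccumC cl falseC
    (pairC falseC (pairC (fstC >>> fstC) sndC >>> cf)) (κ 2 ⊕ (X ⊕ X ⊛ (κ 1 ⊕ space cf ⊙ (κ 1 ⊕ X))))
    (mapAccum-size (λ x s y → false , f (x , y)) (space cf ⊙ (κ 1 ⊕ X))
      λ x s y → +-mono-≤ (1≤bool s) (fits cf (x , y))) >>> sndC)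
  where
  1≤bool : ∀ b → 1 ≤ ⟨ bool ⟩∣ b ∣
  1≤bool false = s≤s z≤n
  1≤bool true  = s≤s z≤n
  eq : ∀ x ys {s} → proj₂ (mapAccum (λ s y → false , f (x , y)) s ys) ≡ map (λ y → f (x , y)) ys
  eq x []       = refl
  eq x (y ∷ ys) = cong (f (x , y) ∷_) (eq x ys)

-- The algorithm

Bits : Set
Bits = List Bool

sameLength : Bits → Bits → Bool
sameLength []       []       = true
sameLength []       (_ ∷ _)  = false
sameLength (_ ∷ _)  []       = false
sameLength (_ ∷ xs) (_ ∷ ys) = sameLength xs ys

sameBits : Bits → Bits → Bool
sameBits []       []       = true
sameBits []       (_ ∷ _)  = false
sameBits (_ ∷ _)  []       = false
sameBits (x ∷ xs) (y ∷ ys) = if x xor y then false else sameBits xs ys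

-- Addition of 1 to a number of fixed width (least significant bit first), with the outgoing carry.
inc : Bits → Bool × Bits
inc []           = true , []
inc (false ∷ bs) = false , true ∷ bs
inc (true  ∷ bs) = let c , bs′ = inc bs in c , false ∷ bs′

-- The Boolean r is the result of the comparison of the less significant digits.
compareStep : Bits × Bool → Bool → Bits × Bool
compareStep (xs , r) y =
  caseList xs ([] , (if y then false else r)) (λ x xs′ → xs′ , (if x xor y then x else r))

geq : Bits → Bits → Bool
geq xs ys =
  let rest , r = foldl compareStep (xs , true) ys
  -- The digits of `xs` beyond the length of `ys` are the most significant ones, so a single 1 among
  -- them decides in favour of `xs`.
  in  foldl (λ r x → if x then true else r) r rest

exponentStep : Bits → Bits × Bits → Bits × Bits
exponentStep den (a , x) = if geq a (false ∷ den) then (a , x) else (false ∷ a , true ∷ x)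

-- A list of the least length k with 2 den ≤ 2ᵏ num.
exponentList : Bits → Bits → Bits
exponentList num den = proj₂ (foldl (λ s _ → exponentStep den s) (num , []) (false ∷ den))

-- An edge is live if its rate is positive and it is not yet scheduled.  The last component of a live edge is a list of
-- length k (the exponent); that of a scheduled edge is a counter of k bits, and the edge is cut whenever its counter is 0.
-- Edges of rate 0 have an empty counter and are never cut.
Rec : Set
Rec = Bool × (Bits × Bits) × Bits

live : Rec → Bool
live = proj₁

ends : Rec → Bits × Bits
ends r = proj₁ (proj₂ r)

counter : Rec → Bits
counter r = proj₂ (proj₂ r)

edgeRecord : (Bits × Bits) × (Bits × Bits) → Rec
edgeRecord (uv , num , den) =
  caseList num (false , uv , []) (λ _ _ → true , uv , exponentList num den)

touches : Bits → Rec → Bool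
touches v r = if sameBits v (proj₁ (ends r)) then true else sameBits v (proj₂ (ends r))

candidate : Bits → Bits → Rec → Bool
candidate v o r = if live r then (if touches v r then sameLength (counter r) o else false) else false

-- The first free bit string o is kept with its last bit first, so that it can be incremented; read from its other end,
-- it is the counter, and edges whose counters have no common extension are never cut on the same day.
assign : Bits → Bool × Bits → Rec → (Bool × Bits) × Rec
assign v (full , o) r =
  if full then ((full , o) , r) else
  (if candidate v o r then (inc o , false , ends r , reverse o) else ((full , o) , r))

-- Prefixing `false` to `o` appends a 0 to the string it stands for, which moves to the first free
-- string that is one bit longer. Since shorter strings are handed out before longer ones, the
-- strings in use always form an initial segment and none is wasted.
assignLevel : Bits → (Bool × Bits) × List Rec → (Bool × Bits) × List Rec
assignLevel v ((full , o) , rs) = mapAccum (assign v) (full , false ∷ o) rs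

assignLevels : Bits → (Bool × Bits) × List Rec → Bits → (Bool × Bits) × List Rec
assignLevels v = foldl (λ s _ → assignLevel v s)

-- At least as long as every counter: the loop bound of assignAll.
levels : List Rec → Bits
levels = foldl (λ acc r → counter r ʳ++ acc) []

assignAll : Bits → List Rec → List Rec
assignAll v rs = proj₂ (assignLevels v ((false , []) , rs) (levels rs))

stuck : Bits → List Rec → Bool
stuck v = foldl (λ acc r → if live r then (if touches v r then true else acc) else acc) false

-- A partial assignment is undone, so that each vertex is eliminated entirely or not at all. Success
-- at a vertex of degree above 2 is possible and harmless.
try : Bits → List Rec → List Rec
try v rs = if stuck v (assignAll v rs) then rs else assignAll v rs

sweep : List Bits → List Rec → List Rec
sweep vs rs = foldl (λ s v → try v s) rs vs

-- The list of edges also serves as the clock: a sweep retires at least one live edge if there is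
-- any, so one sweep per edge is enough.
plan : List Bits × List ((Bits × Bits) × (Bits × Bits)) → List Rec
plan (vs , es) = foldl (λ s _ → sweep vs s) (map edgeRecord es) es

hit : Rec → Bool
-- The case distinction sets apart the empty counter, whose value is 0 as well: an edge of rate 0
-- may be a loop and must not be cut.
hit r = foldl (λ acc b → if b then false else acc) (caseList (counter r) false (λ _ _ → true)) (counter r)

tick : Rec → Rec
tick r = live r , ends r , proj₂ (inc (counter r))

advance : List Rec → List Bool × List Rec
advance rs = map hit rs , map tick rs

-- Implementation by programs

bitsT recT edgeT : Ty
bitsT = list bool
recT  = bool ⊗ (bitsT ⊗ bitsT) ⊗ bitsT
edgeT = (bitsT ⊗ bitsT) ⊗ (bitsT ⊗ bitsT)

size-bool : ∀ b → ⟨ bool ⟩∣ b ∣ ≤ 3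
size-bool false = s≤s z≤n
size-bool true  = ≤-refl

1≤size-bool : ∀ b → 1 ≤ ⟨ bool ⟩∣ b ∣
1≤size-bool false = s≤s z≤n
1≤size-bool true  = s≤s z≤n

size≤length : ∀ xs → ⟨ bitsT ⟩∣ xs ∣ ≤ 1 + 4 * length xs
size≤length []       = ≤-refl
size≤length (x ∷ xs) = begin
  suc (⟨ bool ⟩∣ x ∣ + ⟨ bitsT ⟩∣ xs ∣)  ≤⟨ s≤s (+-mono-≤ (size-bool x) (size≤length xs)) ⟩
  suc (3 + (1 + 4 * length xs))          ≡⟨ eq (length xs) ⟩
  1 + 4 * suc (length xs)                ∎
  where
  open ≤-Reasoning
  eq : ∀ l → suc (3 + (1 + 4 * l)) ≡ 1 + 4 * suc l
  eq = solve-∀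

length≤size-bits : ∀ xs → 2 + 4 * length xs ≤ 2 * ⟨ bitsT ⟩∣ xs ∣
length≤size-bits []       = ≤-refl
length≤size-bits (x ∷ xs) = begin
  2 + 4 * suc (length xs)                   ≡⟨ eq (length xs) ⟩
  2 * 2 + (2 + 4 * length xs)               ≤⟨ +-mono-≤ (*-monoʳ-≤ 2 (s≤s (1≤size-bool x))) (length≤size-bits xs) ⟩
  2 * suc ⟨ bool ⟩∣ x ∣ + 2 * ⟨ bitsT ⟩∣ xs ∣ ≡⟨ *-distribˡ-+ 2 (suc ⟨ bool ⟩∣ x ∣) _ ⟨
  2 * (suc ⟨ bool ⟩∣ x ∣ + ⟨ bitsT ⟩∣ xs ∣)   ∎
  where
  open ≤-Reasoning
  eq : ∀ l → 2 + 4 * suc l ≡ 2 * 2 + (2 + 4 * l)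
  eq = solve-∀

private
  envC : ∀ {A S B} → Comp ((A ⊗ S) ⊗ B) A _
  envC = fstC >>> fstC

  stateC : ∀ {A S B} → Comp ((A ⊗ S) ⊗ B) S _
  stateC = fstC >>> sndC

  itemC : ∀ {A S B} → Comp ((A ⊗ S) ⊗ B) B _
  itemC = sndC

xorC : ∀ {A f g} → Comp A bool f → Comp A bool g → Comp A bool (λ x → f x xor g x)
xorC {f = f} {g} p q = castC (λ x → eq (f x) (g x)) (ifC p (ifC q falseC trueC) q)
  where
  eq : ∀ a b → (if a then (if b then false else true) else b) ≡ a xor b
  eq false b     = refl
  eq true  false = refl
  eq true  true  = refl

-- sameBits and sameLength as a single loop over ys that drops the digits of xs one by one.
alignStep : (Bool → Bool → Bool) → Bits × Bool → Bool → Bits × Bool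
alignStep d (xs , r) y = caseList xs ([] , false) (λ x xs′ → xs′ , (if d x y then false else r))

align : (Bool → Bool → Bool) → Bits → Bits → Bool
align d xs ys = let rest , r = foldl (alignStep d) (xs , true) ys in caseList rest r (λ _ _ → false)

alignC : ∀ {A f g d} → Comp (bool ⊗ bool) bool (λ (x , y) → d x y) → Comp A bitsT f → Comp A bitsT g →
         Comp A bool (λ x → align d (f x) (g x))
alignC {d = d} cd p q =
  foldC q (pairC p trueC)
    (caseC (stateC >>> fstC) (pairC nilC falseC)
      (pairC (sndC >>> sndC)
             (ifC (pairC (sndC >>> fstC) (fstC >>> itemC) >>> cd) falseC (fstC >>> stateC >>> sndC))))
    (X ⊕ X ⊛ κ 3) (foldl-size (λ _ → alignStep d) (κ 3) (λ _ s y → grow s y))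
  >>> caseC fstC sndC falseC
  where
  grow : ∀ s y → ⟨ bitsT ⊗ bool ⟩∣ alignStep d s y ∣ ≤ ⟨ bitsT ⊗ bool ⟩∣ s ∣ + 3
  grow ([] , r) y = +-monoʳ-≤ 2 (≤-trans (s≤s z≤n) (m≤n+m 3 _))
  grow (x ∷ xs , r) y = begin
    suc (⟨ bitsT ⟩∣ xs ∣ + ⟨ bool ⟩∣ if d x y then false else r ∣)
      ≤⟨ s≤s (+-mono-≤ (≤-trans (m≤n+m _ _) (n≤1+n _)) (size-bool (if d x y then false else r))) ⟩
    suc (⟨ bitsT ⟩∣ x ∷ xs ∣ + 3)  ≤⟨ s≤s (+-monoˡ-≤ 3 (m≤m+n ⟨ bitsT ⟩∣ x ∷ xs ∣ ⟨ bool ⟩∣ r ∣)) ⟩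
    ⟨ bitsT ⊗ bool ⟩∣ x ∷ xs , r ∣ + 3 ∎
    where open ≤-Reasoning

align-false : ∀ d xs ys → (let rest , r = foldl (alignStep d) (xs , false) ys in caseList rest r (λ _ _ → false)) ≡ false
align-false d []       []       = refl
align-false d (x ∷ xs) []       = refl
align-false d []       (y ∷ ys) = align-false d [] ys
align-false d (x ∷ xs) (y ∷ ys) with d x y
... | true  = align-false d xs ys
... | false = align-false d xs ys

align-sameBits : ∀ xs ys → align _xor_ xs ys ≡ sameBits xs ys
align-sameBits []       []       = refl
align-sameBits (x ∷ xs) []       = refl
align-sameBits []       (y ∷ ys) = align-false _xor_ [] ys
align-sameBits (x ∷ xs) (y ∷ ys) with x xor y
... | true  = align-false _xor_ xs ys
... | false = align-sameBits xs ys

align-sameLength : ∀ xs ys → align (λ _ _ → false) xs ys ≡ sameLength xs ys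
align-sameLength []       []       = refl
align-sameLength (x ∷ xs) []       = refl
align-sameLength []       (y ∷ ys) = align-false _ [] ys
align-sameLength (x ∷ xs) (y ∷ ys) = align-sameLength xs ys

sameBitsC : ∀ {A f g} → Comp A bitsT f → Comp A bitsT g → Comp A bool (λ x → sameBits (f x) (g x))
sameBitsC {f = f} {g} p q = castC (λ x → align-sameBits (f x) (g x)) (alignC (xorC fstC sndC) p q)

sameLengthC : ∀ {A f g} → Comp A bitsT f → Comp A bitsT g → Comp A bool (λ x → sameLength (f x) (g x))
sameLengthC {f = f} {g} p q = castC (λ x → align-sameLength (f x) (g x)) (alignC falseC p q)

-- A ripple-carry scan: the state is the carry, initially 1.
incC : Comp bitsT (bool ⊗ bitsT) inc
incC = castC eq (mapAccumC {A = bitsT} {S = bool} idC trueC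
  (pairC (ifC stateC itemC falseC) (xorC stateC itemC)) (κ 2 ⊕ (X ⊕ X ⊛ (κ 1 ⊕ κ 6)))
  (mapAccum-size (λ _ s b → (if s then b else false) , s xor b) (κ 6)
    λ _ s b → ≤-trans (+-mono-≤ (size-bool (if s then b else false)) (size-bool (s xor b))) (m≤n+m 6 _)))
  where
  eq₀ : ∀ bs → mapAccum (λ s b → (if s then b else false) , s xor b) false bs ≡ (false , bs)
  eq₀ []       = refl
  eq₀ (b ∷ bs) rewrite eq₀ bs = refl
  eq : ∀ bs → mapAccum (λ s b → (if s then b else false) , s xor b) true bs ≡ inc bs
  eq []           = refl
  eq (false ∷ bs) rewrite eq₀ bs = refl
  eq (true ∷ bs)  rewrite eq bs = refl

-- A Boolean has size at most 3, so no growth estimate is asked for.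
foldBoolC : ∀ {A B l i st} → Comp A (list B) l → Comp A bool i → Comp ((A ⊗ bool) ⊗ B) bool st →
  Comp A bool (λ x → foldl (λ s y → st ((x , s) , y)) (i x) (l x))
foldBoolC {A} {B} {st = st} cl ci cst = foldC cl ci cst (κ 3) λ x s ys → size-bool (foldl _ s ys)

geqC : ∀ {A f g} → Comp A bitsT f → Comp A bitsT g → Comp A bool (λ x → geq (f x) (g x))
geqC p q =
  foldC q (pairC p trueC)
    (caseC (stateC >>> fstC)
      (pairC nilC (ifC itemC falseC (stateC >>> sndC)))
      (pairC (sndC >>> sndC)
             (ifC (xorC (sndC >>> fstC) (fstC >>> itemC)) (sndC >>> fstC) (fstC >>> stateC >>> sndC))))
    (X ⊕ X ⊛ κ 3) (foldl-size (λ _ → compareStep) (κ 3) (λ _ s y → grow s y))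
  >>> foldBoolC fstC sndC (ifC itemC trueC stateC)
  where
  grow : ∀ s y → ⟨ bitsT ⊗ bool ⟩∣ compareStep s y ∣ ≤ ⟨ bitsT ⊗ bool ⟩∣ s ∣ + 3
  grow ([] , r) y = +-monoʳ-≤ 2 (≤-trans (size-bool (if y then false else r)) (m≤n+m 3 _))
  grow (x ∷ xs , r) y = begin
    suc (⟨ bitsT ⟩∣ xs ∣ + ⟨ bool ⟩∣ if x xor y then x else r ∣)
      ≤⟨ s≤s (+-mono-≤ (≤-trans (m≤n+m _ _) (n≤1+n _)) (size-bool (if x xor y then x else r))) ⟩
    suc (⟨ bitsT ⟩∣ x ∷ xs ∣ + 3)  ≤⟨ s≤s (+-monoˡ-≤ 3 (m≤m+n ⟨ bitsT ⟩∣ x ∷ xs ∣ ⟨ bool ⟩∣ r ∣)) ⟩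
    ⟨ bitsT ⊗ bool ⟩∣ x ∷ xs , r ∣ + 3 ∎
    where open ≤-Reasoning

exponentListC : Comp (bitsT ⊗ bitsT) bitsT (λ (num , den) → exponentList num den)
exponentListC =
  foldC (consC falseC sndC) (pairC fstC nilC)
    (ifC (geqC (stateC >>> fstC) (consC falseC (envC >>> sndC))) stateC
         (pairC (consC falseC (stateC >>> fstC)) (consC trueC (stateC >>> sndC))))
    (X ⊕ X ⊛ κ 6) (foldl-size (λ (_ , den) s _ → exponentStep den s) (κ 6) λ (_ , den) s _ → grow den s)
  >>> sndC
  where
  grow : ∀ den s → ⟨ bitsT ⊗ bitsT ⟩∣ exponentStep den s ∣ ≤ ⟨ bitsT ⊗ bitsT ⟩∣ s ∣ + 6
  grow den (a , x) with geq a (false ∷ den)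
  ... | true  = m≤m+n _ 6
  ... | false = ≤-reflexive (eq ⟨ bitsT ⟩∣ a ∣ ⟨ bitsT ⟩∣ x ∣)
    where
    eq : ∀ a x → suc (2 + a + (4 + x)) ≡ suc (a + x) + 6
    eq = solve-∀

recordC : Comp edgeT recT edgeRecord
recordC = caseC (sndC >>> fstC) (pairC falseC (pairC fstC nilC))
  (fstC >>> pairC trueC (pairC fstC (sndC >>> exponentListC)))

touchesC : Comp (bitsT ⊗ recT) bool (λ (v , r) → touches v r)
touchesC = ifC (sameBitsC fstC (sndC >>> sndC >>> fstC >>> fstC)) trueC
               (sameBitsC fstC (sndC >>> sndC >>> fstC >>> sndC))

stateT : Ty
stateT = bool ⊗ bitsT

assignC : Comp ((bitsT ⊗ stateT) ⊗ recT) (stateT ⊗ recT) (λ ((v , s) , r) → assign v s r)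
assignC =
  ifC (stateC >>> fstC) (pairC stateC itemC)
    (ifC (ifC (itemC >>> fstC)
              (ifC (pairC envC itemC >>> touchesC)
                   (sameLengthC (itemC >>> sndC >>> sndC) (stateC >>> sndC)) falseC) falseC)
         (pairC (stateC >>> sndC >>> incC)
                (pairC falseC (pairC (itemC >>> sndC >>> fstC) (reverseC (stateC >>> sndC)))))
         (pairC stateC itemC))

length-inc : ∀ bs → length (proj₂ (inc bs)) ≡ length bs
length-inc []           = refl
length-inc (false ∷ bs) = refl
length-inc (true ∷ bs)  = cong suc (length-inc bs)

sameLength-sound : ∀ xs ys → sameLength xs ys ≡ true → length xs ≡ length ys
sameLength-sound []       []       eq = refl
sameLength-sound (x ∷ xs) (y ∷ ys) eq = cong suc (sameLength-sound xs ys eq)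

-- The size of a list of records when all Booleans in it have their maximal size; scheduling does not change it.
width : List Rec → ℕ
width []                  = 1
width ((_ , uv , x) ∷ rs) = 7 + ⟨ bitsT ⊗ bitsT ⟩∣ uv ∣ + 4 * length x + width rs

size≤width : ∀ rs → ⟨ list recT ⟩∣ rs ∣ ≤ width rs
size≤width []                  = ≤-refl
size≤width ((a , uv , x) ∷ rs) = begin
  suc (suc (⟨ bool ⟩∣ a ∣ + suc (⟨ bitsT ⊗ bitsT ⟩∣ uv ∣ + ⟨ bitsT ⟩∣ x ∣)) + ⟨ list recT ⟩∣ rs ∣)
    ≤⟨ s≤s (+-mono-≤ (s≤s (+-mono-≤ (size-bool a) (s≤s (+-monoʳ-≤ ⟨ bitsT ⊗ bitsT ⟩∣ uv ∣ (size≤length x))))) (size≤width rs)) ⟩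
  suc (suc (3 + suc (⟨ bitsT ⊗ bitsT ⟩∣ uv ∣ + (1 + 4 * length x))) + width rs)
    ≡⟨ eq ⟨ bitsT ⊗ bitsT ⟩∣ uv ∣ (4 * length x) (width rs) ⟩
  7 + ⟨ bitsT ⊗ bitsT ⟩∣ uv ∣ + 4 * length x + width rs ∎
  where
  open ≤-Reasoning
  eq : ∀ u l w → suc (suc (3 + suc (u + (1 + l))) + w) ≡ 7 + u + l + w
  eq = solve-∀

-- The sizes of Booleans lie between 1 and 3, so maximal sizes cost at most a factor 3. It is paid
-- once, however many rounds preserve the width.
width≤size : ∀ rs → width rs ≤ 3 * ⟨ list recT ⟩∣ rs ∣
width≤size []                  = s≤s z≤n
width≤size ((a , uv , x) ∷ rs) = begin
  7 + u + 4 * length x + width rs          ≤⟨ +-monoʳ-≤ (7 + u + 4 * length x) (width≤size rs) ⟩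
  7 + u + 4 * length x + 3 * w             ≤⟨ m≤m+n _ (5 + 2 * u) ⟩
  7 + u + 4 * length x + 3 * w + (5 + 2 * u) ≡⟨ eq u (4 * length x) w ⟩
  (10 + 3 * u + 3 * w) + (2 + 4 * length x) ≤⟨ +-monoʳ-≤ (10 + 3 * u + 3 * w) (≤-trans (length≤size-bits x) (*-monoˡ-≤ y (s≤s (s≤s (z≤n {1}))))) ⟩
  (10 + 3 * u + 3 * w) + 3 * y             ≤⟨ +-monoʳ-≤ (10 + 3 * u + 3 * w) (m≤n+m (3 * y) 2) ⟩
  (10 + 3 * u + 3 * w) + (2 + 3 * y)       ≡⟨ eq′ u y w ⟩
  3 * suc (suc (1 + suc (u + y)) + w)      ≤⟨ *-monoʳ-≤ 3 (s≤s (+-monoˡ-≤ w (s≤s (+-monoˡ-≤ (suc (u + y)) (1≤size-bool a))))) ⟩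
  3 * suc (suc (⟨ bool ⟩∣ a ∣ + suc (u + y)) + w) ∎
  where
  open ≤-Reasoning
  u = ⟨ bitsT ⊗ bitsT ⟩∣ uv ∣
  y = ⟨ bitsT ⟩∣ x ∣
  w = ⟨ list recT ⟩∣ rs ∣
  eq : ∀ u l w → 7 + u + l + 3 * w + (5 + 2 * u) ≡ (10 + 3 * u + 3 * w) + (2 + l)
  eq = solve-∀
  eq′ : ∀ u y w → (10 + 3 * u + 3 * w) + (2 + 3 * y) ≡ 3 * suc (suc (1 + suc (u + y)) + w)
  eq′ = solve-∀

-- A string is handed out only to an edge whose exponent list has its length, so the replacement
-- keeps the length.
assign-length : ∀ v s r → length (proj₂ (proj₁ (assign v s r))) ≡ length (proj₂ s)
                        × ends (proj₂ (assign v s r)) ≡ ends r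
                        × length (counter (proj₂ (assign v s r))) ≡ length (counter r)
assign-length v (true  , o) r = refl , refl , refl
assign-length v (false , o) (false , r) = refl , refl , refl
assign-length v (false , o) (true , uv , x) with touches v (true , uv , x)
... | false = refl , refl , refl
... | true with sameLength x o in eq
...   | true  = length-inc o , refl , trans (length-reverse o) (sym (sameLength-sound x o eq))
...   | false = refl , refl , refl

assignLevel-length : ∀ v s rs → length (proj₂ (proj₁ (mapAccum (assign v) s rs))) ≡ length (proj₂ s)
                              × width (proj₂ (mapAccum (assign v) s rs)) ≡ width rs
assignLevel-length v s []       = refl , refl
assignLevel-length v s (r ∷ rs) =
  let lo , uv , lx = assign-length v s r
      ls , ws      = assignLevel-length v (proj₁ (assign v s r)) rs
  in trans ls lo , cong₂ _+_ (cong₂ (λ e l → 7 + ⟨ bitsT ⊗ bitsT ⟩∣ e ∣ + 4 * l) uv lx) ws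

budget : ∀ {l w p q} → 2 + 4 * l ≤ 2 * p → w ≤ 3 * q → suc (suc (3 + (1 + 4 * l)) + w) ≤ 5 + 3 * (p + q)
budget {l} {w} {p} {q} l≤ w≤ = begin
  4 + (2 + 4 * l) + w        ≤⟨ +-mono-≤ (+-monoʳ-≤ 4 l≤) w≤ ⟩
  4 + 2 * p + 3 * q          ≤⟨ m≤m+n _ (1 + p) ⟩
  4 + 2 * p + 3 * q + (1 + p) ≡⟨ eq p q ⟩
  5 + 3 * (p + q)            ∎
  where
  open ≤-Reasoning
  eq : ∀ p q → 4 + 2 * p + 3 * q + (1 + p) ≡ 5 + 3 * (p + q)
  eq = solve-∀

size-state : ∀ (s : (Bool × Bits) × List Rec) {l w} → length (proj₂ (proj₁ s)) ≡ l → width (proj₂ s) ≡ w →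
  ⟨ stateT ⊗ list recT ⟩∣ s ∣ ≤ suc (suc (3 + (1 + 4 * l)) + w)
size-state ((f , o) , rs) refl refl =
  s≤s (+-mono-≤ (s≤s (+-mono-≤ (size-bool f) (size≤length o))) (size≤width rs))

assignLevelC : Comp (bitsT ⊗ (stateT ⊗ list recT)) (stateT ⊗ list recT) (λ (v , s) → assignLevel v s)
assignLevelC =
  pairC fstC (pairC (pairC (sndC >>> fstC >>> fstC) (consC falseC (sndC >>> fstC >>> sndC))) (sndC >>> sndC)) >>>
  mapAccumC {st = λ ((x , s) , r) → assign (proj₁ x) s r} (sndC >>> sndC) (sndC >>> fstC)
    (pairC (pairC (envC >>> fstC) stateC) itemC >>> assignC)
    (κ 5 ⊕ κ 3 ⊛ X)
    λ { x@(v , _) (f , o) rs → let lo , wr = assignLevel-length v (f , o) rs in begin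
      ⟨ stateT ⊗ list recT ⟩∣ mapAccum (assign v) (f , o) rs ∣
        ≤⟨ size-state (mapAccum (assign v) (f , o) rs) lo wr ⟩
      suc (suc (3 + (1 + 4 * length o)) + width rs)
        ≤⟨ budget {length o} {p = ⟨ bitsT ⟩∣ o ∣} {⟨ list recT ⟩∣ rs ∣} (length≤size-bits o) (width≤size rs) ⟩
      5 + 3 * (⟨ bitsT ⟩∣ o ∣ + ⟨ list recT ⟩∣ rs ∣)
        ≤⟨ +-monoʳ-≤ 5 (*-monoʳ-≤ 3 (+-monoˡ-≤ ⟨ list recT ⟩∣ rs ∣
             (≤-trans (≤-trans (m≤n+m _ ⟨ bool ⟩∣ f ∣) (n≤1+n _)) (m≤n+m _ ⟨ bitsT ⊗ (stateT ⊗ list recT) ⟩∣ x ∣)))) ⟩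
      5 + 3 * (⟨ bitsT ⊗ (stateT ⊗ list recT) ⟩∣ x ∣ + ⟨ stateT ⟩∣ f , o ∣ + ⟨ list recT ⟩∣ rs ∣) ∎ }
  where open ≤-Reasoning

-- One level may rewrite all records, so its effect on the size is not bounded independently of the
-- state as in `foldl-size`. Preserved lengths and widths replace that estimate; only `o` grows, by
-- one bit per level.
assignLevels-length : ∀ v (s : (Bool × Bits) × List Rec) ys → let s′ = assignLevels v s ys in
  length (proj₂ (proj₁ s′)) ≡ length (proj₂ (proj₁ s)) + length ys × width (proj₂ s′) ≡ width (proj₂ s)
assignLevels-length v s []       = sym (+-identityʳ _) , refl
assignLevels-length v ((f , o) , rs) (_ ∷ ys) =
  let lo , wr = assignLevel-length v (f , false ∷ o) rs
      lo′ , wr′ = assignLevels-length v (assignLevel v ((f , o) , rs)) ys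
  in trans lo′ (trans (cong (_+ length ys) lo) (sym (+-suc (length o) (length ys)))) , trans wr′ wr

assignLevelsC : ∀ {A f s l} → Comp A bitsT f → Comp A (stateT ⊗ list recT) s → Comp A bitsT l →
  Comp A (stateT ⊗ list recT) (λ x → assignLevels (f x) (s x) (l x))
assignLevelsC {A} {f} {s} cv cs cl = foldC cl cs (pairC (envC >>> cv) stateC >>> assignLevelC) (κ 5 ⊕ κ 3 ⊛ X)
  λ { x ((g , o) , rs) ys → let lo , wr = assignLevels-length (f x) ((g , o) , rs) ys in begin
    ⟨ stateT ⊗ list recT ⟩∣ assignLevels (f x) ((g , o) , rs) ys ∣
      ≤⟨ size-state (assignLevels (f x) ((g , o) , rs) ys) lo wr ⟩
    suc (suc (3 + (1 + 4 * (length o + length ys))) + width rs)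
      ≤⟨ budget {length o + length ys} {p = ⟨ bitsT ⟩∣ o ∣ + ⟨ bitsT ⟩∣ ys ∣} {⟨ list recT ⟩∣ rs ∣} (sum-bound o ys) (width≤size rs) ⟩
    5 + 3 * ((⟨ bitsT ⟩∣ o ∣ + ⟨ bitsT ⟩∣ ys ∣) + ⟨ list recT ⟩∣ rs ∣)
      ≤⟨ +-monoʳ-≤ 5 (*-monoʳ-≤ 3 (m≤m+n (⟨ bitsT ⟩∣ o ∣ + ⟨ bitsT ⟩∣ ys ∣ + ⟨ list recT ⟩∣ rs ∣) (⟨ A ⟩∣ x ∣ + 2 + ⟨ bool ⟩∣ g ∣))) ⟩
    5 + 3 * ((⟨ bitsT ⟩∣ o ∣ + ⟨ bitsT ⟩∣ ys ∣) + ⟨ list recT ⟩∣ rs ∣ + (⟨ A ⟩∣ x ∣ + 2 + ⟨ bool ⟩∣ g ∣))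
      ≡⟨ eq ⟨ bitsT ⟩∣ o ∣ ⟨ bitsT ⟩∣ ys ∣ ⟨ list recT ⟩∣ rs ∣ ⟨ A ⟩∣ x ∣ ⟨ bool ⟩∣ g ∣ ⟩
    5 + 3 * (⟨ A ⟩∣ x ∣ + ⟨ stateT ⊗ list recT ⟩∣ (g , o) , rs ∣ + ⟨ bitsT ⟩∣ ys ∣) ∎ }
  where
  open ≤-Reasoning
  eq : ∀ o y r x g → 5 + 3 * ((o + y) + r + (x + 2 + g)) ≡ 5 + 3 * (x + suc (suc (g + o) + r) + y)
  eq = solve-∀
  sum-bound : ∀ o ys → 2 + 4 * (length o + length ys) ≤ 2 * (⟨ bitsT ⟩∣ o ∣ + ⟨ bitsT ⟩∣ ys ∣)
  sum-bound o ys = begin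
    2 + 4 * (length o + length ys)              ≤⟨ m≤m+n _ 2 ⟩
    2 + 4 * (length o + length ys) + 2          ≡⟨ eq′ (length o) (length ys) ⟩
    (2 + 4 * length o) + (2 + 4 * length ys)    ≤⟨ +-mono-≤ (length≤size-bits o) (length≤size-bits ys) ⟩
    2 * ⟨ bitsT ⟩∣ o ∣ + 2 * ⟨ bitsT ⟩∣ ys ∣    ≡⟨ *-distribˡ-+ 2 ⟨ bitsT ⟩∣ o ∣ _ ⟨
    2 * (⟨ bitsT ⟩∣ o ∣ + ⟨ bitsT ⟩∣ ys ∣)      ∎
    where
    eq′ : ∀ a b → 2 + 4 * (a + b) + 2 ≡ (2 + 4 * a) + (2 + 4 * b)
    eq′ = solve-∀

levelsC : Comp (list recT) bitsT levels
levelsC = foldC idC nilC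
  (foldC (itemC >>> sndC >>> sndC) stateC (consC sndC stateC)
    (X ⊕ X ⊛ (X ⊕ κ 1)) (foldl-size (λ _ s y → y ∷ s) (X ⊕ κ 1) λ x s y → ≤-trans (≤-reflexive (eq ⟨ bool ⟩∣ y ∣ ⟨ bitsT ⟩∣ s ∣))
      (+-monoʳ-≤ ⟨ bitsT ⟩∣ s ∣ (+-monoˡ-≤ 1 (m≤n+m _ ⟨ (list recT ⊗ bitsT) ⊗ recT ⟩∣ x ∣)))))
  X (≤X)
  where
  open ≤-Reasoning
  eq : ∀ y s → suc (y + s) ≡ s + (y + 1)
  eq = solve-∀
  eq′ : ∀ a s e x r → suc (suc (a + suc (e + x)) + r) + s ≡ (x + s) + r + suc (suc (a + suc e))
  eq′ = solve-∀
  ≤X : ∀ x s rs → ⟨ bitsT ⟩∣ foldl (λ acc r → counter r ʳ++ acc) s rs ∣ ≤ ⟨ list recT ⟩∣ x ∣ + ⟨ bitsT ⟩∣ s ∣ + ⟨ list recT ⟩∣ rs ∣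
  ≤X x s []       = ≤-trans (m≤n+m _ ⟨ list recT ⟩∣ x ∣) (m≤m+n _ 1)
  ≤X x s (r ∷ rs) = begin
    ⟨ bitsT ⟩∣ foldl (λ acc r → counter r ʳ++ acc) (counter r ʳ++ s) rs ∣  ≤⟨ ≤X x (counter r ʳ++ s) rs ⟩
    ⟨ list recT ⟩∣ x ∣ + ⟨ bitsT ⟩∣ counter r ʳ++ s ∣ + ⟨ list recT ⟩∣ rs ∣
      ≤⟨ +-monoˡ-≤ _ (+-monoʳ-≤ ⟨ list recT ⟩∣ x ∣ (size-ʳ++ bool (counter r) s)) ⟩
    ⟨ list recT ⟩∣ x ∣ + (⟨ bitsT ⟩∣ counter r ∣ + ⟨ bitsT ⟩∣ s ∣) + ⟨ list recT ⟩∣ rs ∣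
      ≡⟨ +-assoc ⟨ list recT ⟩∣ x ∣ _ _ ⟩
    ⟨ list recT ⟩∣ x ∣ + ((⟨ bitsT ⟩∣ counter r ∣ + ⟨ bitsT ⟩∣ s ∣) + ⟨ list recT ⟩∣ rs ∣)
      ≤⟨ +-monoʳ-≤ ⟨ list recT ⟩∣ x ∣ (≤-trans (m≤m+n _ _)
           (≤-reflexive (sym (eq′ ⟨ bool ⟩∣ live r ∣ ⟨ bitsT ⟩∣ s ∣ ⟨ bitsT ⊗ bitsT ⟩∣ ends r ∣ ⟨ bitsT ⟩∣ counter r ∣ ⟨ list recT ⟩∣ rs ∣)))) ⟩
    ⟨ list recT ⟩∣ x ∣ + (⟨ list recT ⟩∣ r ∷ rs ∣ + ⟨ bitsT ⟩∣ s ∣)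
      ≡⟨ cong (λ k → ⟨ list recT ⟩∣ x ∣ + k) (+-comm ⟨ list recT ⟩∣ r ∷ rs ∣ _) ⟩
    ⟨ list recT ⟩∣ x ∣ + (⟨ bitsT ⟩∣ s ∣ + ⟨ list recT ⟩∣ r ∷ rs ∣)
      ≡⟨ +-assoc ⟨ list recT ⟩∣ x ∣ _ _ ⟨
    ⟨ list recT ⟩∣ x ∣ + ⟨ bitsT ⟩∣ s ∣ + ⟨ list recT ⟩∣ r ∷ rs ∣ ∎

assignAllC : Comp (bitsT ⊗ list recT) (list recT) (λ (v , rs) → assignAll v rs)
assignAllC = assignLevelsC fstC (pairC (pairC falseC nilC) sndC) (sndC >>> levelsC) >>> sndC

stuckC : Comp (bitsT ⊗ list recT) bool (λ (v , rs) → stuck v rs)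
stuckC = foldBoolC sndC falseC
  (ifC (itemC >>> fstC) (ifC (pairC (envC >>> fstC) itemC >>> touchesC) trueC stateC) stateC)

tryC : Comp (bitsT ⊗ list recT) (list recT) (λ (v , rs) → try v rs)
tryC = ifC (pairC fstC assignAllC >>> stuckC) sndC assignAllC

width-try : ∀ v rs → width (try v rs) ≡ width rs
width-try v rs with stuck v (assignAll v rs)
... | true  = refl
... | false = proj₂ (assignLevels-length v ((false , []) , rs) (levels rs))

width-sweep : ∀ vs rs → width (sweep vs rs) ≡ width rs
width-sweep []       rs = refl
width-sweep (v ∷ vs) rs = trans (width-sweep vs (try v rs)) (width-try v rs)

width-sweeps : {A : Set} (es : List A) → ∀ vs rs → width (foldl (λ s _ → sweep vs s) rs es) ≡ width rs
width-sweeps []       vs rs = refl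
width-sweeps (e ∷ es) vs rs = trans (width-sweeps es vs (sweep vs rs)) (width-sweep vs rs)

size-same-width : ∀ rs rs′ x n → width rs′ ≡ width rs → ⟨ list recT ⟩∣ rs′ ∣ ≤ 3 * (x + ⟨ list recT ⟩∣ rs ∣ + n)
size-same-width rs rs′ x n eq = begin
  ⟨ list recT ⟩∣ rs′ ∣                ≤⟨ size≤width rs′ ⟩
  width rs′                           ≡⟨ eq ⟩
  width rs                            ≤⟨ width≤size rs ⟩
  3 * ⟨ list recT ⟩∣ rs ∣             ≤⟨ *-monoʳ-≤ 3 (≤-trans (m≤n+m _ x) (m≤m+n _ n)) ⟩
  3 * (x + ⟨ list recT ⟩∣ rs ∣ + n)   ∎
  where open ≤-Reasoning

sweepC : Comp (list bitsT ⊗ list recT) (list recT) (λ (vs , rs) → sweep vs rs)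
sweepC = foldC fstC sndC (pairC itemC stateC >>> tryC) (κ 3 ⊛ X)
  λ x s vs → size-same-width s (sweep vs s) ⟨ list bitsT ⊗ list recT ⟩∣ x ∣ ⟨ list bitsT ⟩∣ vs ∣ (width-sweep vs s)

abstract
  planC : Comp (list bitsT ⊗ list edgeT) (list recT) plan
  planC = foldC sndC (mapC sndC (sndC >>> recordC)) (pairC (envC >>> fstC) stateC >>> sweepC) (κ 3 ⊛ X)
    λ x@(vs , _) s es → size-same-width s (foldl (λ s _ → sweep vs s) s es)
      ⟨ list bitsT ⊗ list edgeT ⟩∣ x ∣ ⟨ list edgeT ⟩∣ es ∣ (width-sweeps es vs s)

hitC : Comp recT bool hit
hitC = foldBoolC (sndC >>> sndC) (caseC (sndC >>> sndC) falseC trueC) (ifC itemC falseC stateC)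

tickC : Comp recT recT tick
tickC = pairC fstC (pairC (sndC >>> fstC) (sndC >>> sndC >>> incC >>> sndC))

abstract
  advanceC : Comp (list recT) (list bool ⊗ list recT) advance
  advanceC = pairC (mapC idC (sndC >>> hitC)) (mapC idC (sndC >>> tickC))

-- Binary numbers

bit : Bool → ℕ
bit false = 0
bit true  = 1

val : Bits → ℕ
val []       = 0
val (b ∷ bs) = bit b + 2 * val bs

val-increment : ∀ bs → val (increment bs) ≡ suc (val bs)
val-increment []           = refl
val-increment (false ∷ bs) = refl
val-increment (true ∷ bs)  = trans (cong (2 *_) (val-increment bs)) (eq (val bs))
  where
  eq : ∀ v → 2 * suc v ≡ suc (1 + 2 * v)
  eq = solve-∀

val-bits : ∀ n → val (bits n) ≡ n
val-bits zero    = refl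
val-bits (suc n) = trans (val-increment (bits n)) (cong suc (val-bits n))

val<2^length : ∀ bs → val bs < 2 ^ length bs
val<2^length []           = s≤s z≤n
val<2^length (b ∷ bs) = begin-strict
  bit b + 2 * val bs    <⟨ +-monoˡ-< (2 * val bs) (bit<2 b) ⟩
  2 + 2 * val bs        ≡⟨ *-suc 2 (val bs) ⟨
  2 * suc (val bs)      ≤⟨ *-monoʳ-≤ 2 (val<2^length bs) ⟩
  2 * 2 ^ length bs     ∎
  where
  open ≤-Reasoning
  bit<2 : ∀ b → bit b < 2
  bit<2 false = s≤s z≤n
  bit<2 true  = s≤s (s≤s z≤n)

sameBits-refl : ∀ xs → sameBits xs xs ≡ true
sameBits-refl []           = refl
sameBits-refl (false ∷ xs) = sameBits-refl xs
sameBits-refl (true  ∷ xs) = sameBits-refl xs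

sameBits-sound : ∀ xs ys → sameBits xs ys ≡ true → xs ≡ ys
sameBits-sound []           []           eq = refl
sameBits-sound (false ∷ xs) (false ∷ ys) eq = cong (false ∷_) (sameBits-sound xs ys eq)
sameBits-sound (true  ∷ xs) (true  ∷ ys) eq = cong (true ∷_) (sameBits-sound xs ys eq)

sameLength-complete : ∀ xs ys → length xs ≡ length ys → sameLength xs ys ≡ true
sameLength-complete []       []       eq = refl
sameLength-complete (x ∷ xs) (y ∷ ys) eq = sameLength-complete xs ys (suc-injective eq)

val-inc : ∀ bs → val (proj₂ (inc bs)) + (if proj₁ (inc bs) then 2 ^ length bs else 0) ≡ suc (val bs)
val-inc []           = refl
val-inc (false ∷ bs) = +-identityʳ _
val-inc (true ∷ bs) with inc bs | val-inc bs
... | true  , o | eq = trans (eq′ (val o) (2 ^ length bs)) (trans (cong (2 *_) eq) (eq″ (val bs)))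
  where
  eq′ : ∀ v l → 2 * v + 2 * l ≡ 2 * (v + l)
  eq′ = solve-∀
  eq″ : ∀ v → 2 * suc v ≡ suc (1 + 2 * v)
  eq″ = solve-∀
... | false , o | eq = trans (eq′ (val o)) (trans (cong (2 *_) eq) (eq″ (val bs)))
  where
  eq′ : ∀ v → 2 * v + 0 ≡ 2 * (v + 0)
  eq′ = solve-∀
  eq″ : ∀ v → 2 * suc v ≡ suc (1 + 2 * v)
  eq″ = solve-∀

hit-sound : ∀ r → hit r ≡ true → counter r ≢ [] × val (counter r) ≡ 0
hit-sound (_ , _ , x ∷ xs) h = (λ ()) , go (x ∷ xs) h
  where
  go : ∀ {acc} xs → foldl (λ acc b → if b then false else acc) acc xs ≡ true → val xs ≡ 0
  go₀ : ∀ xs → foldl (λ acc b → if b then false else acc) false xs ≢ true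
  go₀ (false ∷ xs) h = go₀ xs h
  go₀ (true ∷ xs)  h = go₀ xs h
  go []           h = refl
  go (false ∷ xs) h = cong (2 *_) (go xs h)
  go (true ∷ xs)  h = ⊥-elim (go₀ xs h)

hit-complete : ∀ r → counter r ≢ [] → val (counter r) ≡ 0 → hit r ≡ true
hit-complete (_ , _ , [])     ≢[] v≡0 = ⊥-elim (≢[] refl)
hit-complete (_ , _ , x ∷ xs) ≢[] v≡0 = go (x ∷ xs) v≡0
  where
  go : ∀ xs → val xs ≡ 0 → foldl (λ acc b → if b then false else acc) true xs ≡ true
  go []           v≡0 = refl
  go (false ∷ xs) v≡0 = go xs (m+n≡0⇒m≡0 (val xs) v≡0)

-- Correctness of the comparison of binary numbers

reflects-map : {A B : Set} {b : Bool} → (A → B) → (B → A) → Reflects A b → Reflects B b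
reflects-map f g (ofʸ a)  = ofʸ (f a)
reflects-map f g (ofⁿ ¬a) = ofⁿ (¬a ∘ g)

-- The borrow of a subtraction: if the lower digits of `xs` lost the comparison, the higher digits
-- have to make up for 1.
penalty : Bool → ℕ
penalty r = if r then 0 else 1

final-reflects : ∀ xs r → Reflects (penalty r ≤ val xs) (foldl (λ r x → if x then true else r) r xs)
final-reflects []           true  = ofʸ z≤n
final-reflects []           false = ofⁿ λ ()
final-reflects (true ∷ xs)  r     = reflects-map (λ _ → ≤-trans (penalty≤1 r) (s≤s z≤n)) (λ _ → z≤n) (final-reflects xs true)
  where
  penalty≤1 : ∀ r → penalty r ≤ 1
  penalty≤1 false = ≤-refl
  penalty≤1 true  = z≤n
final-reflects (false ∷ xs) true  = reflects-map (λ _ → z≤n) (λ _ → z≤n) (final-reflects xs true)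
final-reflects (false ∷ xs) false =
  reflects-map (λ 1≤v → ≤-trans 1≤v (m≤m+n _ _)) (λ 1≤2v → *-cancelˡ-< 2 0 (val xs) 1≤2v) (final-reflects xs false)

halve : ∀ a b → 2 * a ≤ 1 + 2 * b → a ≤ b
halve a b 2a≤ = ≤-pred (*-cancelˡ-< 2 a (suc b) (≤-trans (s≤s 2a≤) (≤-reflexive (sym (*-suc 2 b)))))

compare-reflects : ∀ ys xs r → Reflects (penalty r + val ys ≤ val xs)
  (let rest , r′ = foldl compareStep (xs , r) ys in foldl (λ r x → if x then true else r) r′ rest)
compare-reflects [] xs r =
  subst (λ p → Reflects (p ≤ val xs) (foldl (λ r x → if x then true else r) r xs)) (sym (+-identityʳ (penalty r))) (final-reflects xs r)
compare-reflects (true ∷ ys) [] r = reflects-map (λ ()) (λ h → ⊥-elim (absurd (penalty r) h)) (compare-reflects ys [] false)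
  where
  absurd : ∀ p {v} → p + suc v ≤ 0 → ⊥
  absurd (suc p) ()
  absurd zero ()
compare-reflects (false ∷ ys) [] true  = reflects-map (*-monoʳ-≤ 2) (*-cancelˡ-≤ 2) (compare-reflects ys [] true)
compare-reflects (false ∷ ys) [] false = reflects-map (λ ()) (λ ()) (compare-reflects ys [] false)
compare-reflects (false ∷ ys) (false ∷ xs) true  = reflects-map (*-monoʳ-≤ 2) (*-cancelˡ-≤ 2) (compare-reflects ys xs true)
compare-reflects (false ∷ ys) (false ∷ xs) false = reflects-map (*-monoʳ-< 2) (*-cancelˡ-< 2 _ _) (compare-reflects ys xs false)
compare-reflects (true ∷ ys) (true ∷ xs) true  =
  reflects-map (s≤s ∘ *-monoʳ-≤ 2) (*-cancelˡ-≤ 2 ∘ ≤-pred) (compare-reflects ys xs true)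
compare-reflects (true ∷ ys) (true ∷ xs) false =
  reflects-map (s≤s ∘ *-monoʳ-< 2) (*-cancelˡ-< 2 _ _ ∘ ≤-pred) (compare-reflects ys xs false)
compare-reflects (false ∷ ys) (true ∷ xs) true =
  reflects-map (λ h → ≤-trans (*-monoʳ-≤ 2 h) (n≤1+n _)) (halve _ _) (compare-reflects ys xs true)
compare-reflects (false ∷ ys) (true ∷ xs) false =
  reflects-map (s≤s ∘ *-monoʳ-≤ 2) (*-cancelˡ-≤ 2 ∘ ≤-pred) (compare-reflects ys xs true)
compare-reflects (true ∷ ys) (false ∷ xs) true =
  reflects-map (*-monoʳ-< 2) (*-cancelˡ-< 2 _ _) (compare-reflects ys xs false)
compare-reflects (true ∷ ys) (false ∷ xs) false =
  reflects-map (λ h → ≤-trans (≤-reflexive (sym (*-suc 2 _))) (*-monoʳ-≤ 2 h))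
               (λ h → *-cancelˡ-≤ 2 (≤-trans (≤-reflexive (*-suc 2 _)) h)) (compare-reflects ys xs false)

geq-reflects : ∀ xs ys → Reflects (val ys ≤ val xs) (geq xs ys)
geq-reflects xs ys = compare-reflects ys xs true

-- The least exponent of a rate

module Exponent (num den : Bits) where

  private
    N = val num
    D = val den

  -- `minimal` remembers the last doubling, which took place because the previous value was below
  -- `2 * D`. `found` says that the search has stopped for good or has doubled in each of its `j`
  -- steps.
  record Searching (j : ℕ) (s : Bits × Bits) : Set where
    field
      value   : val (proj₁ s) ≡ 2 ^ length (proj₂ s) * N
      minimal : length (proj₂ s) ≡ 0 ⊎ 2 ^ length (proj₂ s) * N < 4 * D
      found   : 2 * D ≤ val (proj₁ s) ⊎ length (proj₂ s) ≡ j

  open Searching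

  search-step : ∀ {j} s → Searching j s → Searching (suc j) (exponentStep den s)
  search-step (a , x) inv with geq a (false ∷ den) | geq-reflects a (false ∷ den)
  ... | true  | ofʸ ≥ = record { value = value inv ; minimal = minimal inv ; found = inj₁ ≥ }
  ... | false | ofⁿ ≱ = record
    { value   = double
    ; minimal = inj₂ (begin-strict
        2 ^ suc (length x) * N   ≡⟨ double ⟨
        2 * val a                <⟨ *-monoʳ-< 2 (≰⇒> ≱) ⟩
        2 * (2 * D)              ≡⟨ *-assoc 2 2 D ⟨
        4 * D                    ∎)
    ; found   = inj₂ (cong suc (go (found inv)))
    }
    where
    open ≤-Reasoning
    double : 2 * val a ≡ 2 ^ suc (length x) * N
    double = trans (cong (2 *_) (value inv)) (sym (*-assoc 2 (2 ^ length x) N))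
    go : ∀ {j} → 2 * D ≤ val a ⊎ length x ≡ j → length x ≡ j
    go (inj₁ ≥)  = ⊥-elim (≱ ≥)
    go (inj₂ eq) = eq

  search : ∀ {j} s (ys : Bits) → Searching j s → Searching (j + length ys) (foldl (λ s _ → exponentStep den s) s ys)
  search s []       inv = subst (λ j → Searching j s) (sym (+-identityʳ _)) inv
  search s (y ∷ ys) inv = subst (λ j → Searching j (foldl (λ s _ → exponentStep den s) s (y ∷ ys))) (sym (+-suc _ (length ys)))
    (search (exponentStep den s) ys (search-step s inv))

  searched : Searching (length (false ∷ den)) (foldl (λ s _ → exponentStep den s) (num , []) (false ∷ den))
  searched = search (num , []) (false ∷ den) record { value = sym (+-identityʳ _) ; minimal = inj₁ refl ; found = inj₂ refl }

  -- A search that never stops performs one doubling more than `den` has digits. Then the power of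
  -- two alone exceeds `2 * D`, and the numerator is at least 1.
  exponent-large : 1 ≤ N → 2 * D ≤ 2 ^ length (exponentList num den) * N
  exponent-large 1≤N with found searched
  ... | inj₁ ≥  = ≤-trans ≥ (≤-reflexive (value searched))
  ... | inj₂ eq = begin
    2 * D                                     ≤⟨ *-monoʳ-≤ 2 (<⇒≤ (val<2^length den)) ⟩
    2 ^ length (false ∷ den)                  ≡⟨ cong (2 ^_) eq ⟨
    2 ^ length (exponentList num den)         ≡⟨ *-identityʳ _ ⟨
    2 ^ length (exponentList num den) * 1     ≤⟨ *-monoʳ-≤ (2 ^ length (exponentList num den)) 1≤N ⟩
    2 ^ length (exponentList num den) * N     ∎
    where open ≤-Reasoning

  -- With exponent 0 the search would have found `2 * D ≤ N`, impossible for a rate in (0, 1]. This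
  -- excludes the case of `minimal` without any doubling.
  exponent-positive : 1 ≤ N → N ≤ D → length (exponentList num den) ≢ 0
  exponent-positive 1≤N N≤D eq = <-irrefl refl (begin-strict
    D           <⟨ m<m+n D (≤-trans 1≤N (≤-trans N≤D (≤-reflexive (sym (+-identityʳ D))))) ⟩
    2 * D                                     ≤⟨ exponent-large 1≤N ⟩
    2 ^ length (exponentList num den) * N     ≡⟨ cong (λ k → 2 ^ k * N) eq ⟩
    1 * N                                     ≡⟨ *-identityˡ N ⟩
    N                                         ≤⟨ N≤D ⟩
    D                                         ∎)
    where open ≤-Reasoning

  exponent-small : 1 ≤ N → N ≤ D → 2 ^ length (exponentList num den) * N < 4 * D
  exponent-small 1≤N N≤D with minimal searched
  ... | inj₁ eq = ⊥-elim (exponent-positive 1≤N N≤D eq)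
  ... | inj₂ <  = <

-- Incompatible bit strings

infix 4 _◁_ _#_

-- p ◁ q: after some common prefix, p continues with 0 and q with 1.
data _◁_ : Bits → Bits → Set where
  here  : ∀ {p q} → false ∷ p ◁ true ∷ q
  there : ∀ {b p q} → p ◁ q → b ∷ p ◁ b ∷ q

_#_ : Bits → Bits → Set
p # q = p ◁ q ⊎ q ◁ p

◁-trans : ∀ {p q r} → p ◁ q → q ◁ r → p ◁ r
◁-trans here      (there _) = here
◁-trans (there _) here      = here
◁-trans (there a) (there b) = there (◁-trans a b)

◁-++ : ∀ {p q} s s′ → p ◁ q → p ++ s ◁ q ++ s′
◁-++ s s′ here      = here
◁-++ s s′ (there a) = there (◁-++ s s′ a)

++-◁ : ∀ s {p q} → p ◁ q → s ++ p ◁ s ++ q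
++-◁ []      a = a
++-◁ (b ∷ s) a = there (++-◁ s a)

-- Without overflow some 0 becomes 1 and the more significant digits stay. After `reverse` these
-- digits come first and form the common prefix.
◁-reverse-inc : ∀ o → proj₁ (inc o) ≡ false → reverse o ◁ reverse (proj₂ (inc o))
◁-reverse-inc (false ∷ o) eq =
  subst₂ _◁_ (sym (unfold-reverse false o)) (sym (unfold-reverse true o)) (++-◁ (reverse o) here)
◁-reverse-inc (true ∷ o) eq =
  subst₂ _◁_ (sym (unfold-reverse true o)) (sym (unfold-reverse false (proj₂ (inc o))))
    (◁-++ (true ∷ []) (false ∷ []) (◁-reverse-inc o eq))

#-sym : ∀ {p q} → p # q → q # p
#-sym (inj₁ a) = inj₂ a
#-sym (inj₂ a) = inj₁ a

#-there : ∀ {b p q} → p # q → b ∷ p # b ∷ q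
#-there (inj₁ a) = inj₁ (there a)
#-there (inj₂ a) = inj₂ (there a)

-- Up to the first difference both strings agree, so the same carry arrives there: either both
-- digits flip or neither does. Flipping swaps the sides, hence `#` in the conclusion.
◁-inc : ∀ {p q} → p ◁ q → proj₂ (inc p) # proj₂ (inc q)
◁-inc here                = inj₂ here
◁-inc (there {false} a)   = inj₁ (there a)
◁-inc (there {true} a)    = #-there (◁-inc a)

#-inc : ∀ {p q} → p # q → proj₂ (inc p) # proj₂ (inc q)
#-inc (inj₁ a) = ◁-inc a
#-inc (inj₂ a) = #-sym (◁-inc a)

◁-positive : ∀ {p q} → p ◁ q → val q ≢ 0
◁-positive (there {false} {p} {q} a) v≡0 = ◁-positive a (m+n≡0⇒m≡0 (val q) v≡0)

#-not-both-zero : ∀ {p q} → p # q → val p ≡ 0 → val q ≢ 0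
#-not-both-zero (inj₁ a) _   = ◁-positive a
#-not-both-zero (inj₂ a) p≡0 = λ _ → ◁-positive a p≡0

-- Walks

unique-lookup : ∀ {n} {xs : List (Fin n)} → Unique xs → ∀ {i j} → lookup xs i ≡ lookup xs j → i ≡ j
unique-lookup (_ ∷ u) {zero}  {zero}  eq = refl
unique-lookup {xs = x ∷ xs} (d ∷ u) {zero}  {suc j} eq = ⊥-elim (All.lookup d (∈-lookup j) eq)
unique-lookup {xs = x ∷ xs} (d ∷ u) {suc i} {zero}  eq = ⊥-elim (All.lookup d (∈-lookup i) (sym eq))
unique-lookup (_ ∷ u) {suc i} {suc j} eq = cong suc (unique-lookup u eq)

unique-length : ∀ {n} {xs : List (Fin n)} → Unique xs → length xs ≤ n
unique-length u = injective⇒≤ (unique-lookup u)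

∉-remove : ∀ {n} (p : Subset n) x → x ∉ (p - x)
∉-remove (_ ∷ p) (suc x) (there x∈) = ∉-remove p x x∈

card-remove : ∀ {n} (p : Subset n) x → card p ≤ suc (card (p - x))
card-remove (inside  ∷ p) zero    = s≤s (≤-reflexive (cong card (sym (p─⊥≡p p))))
card-remove (outside ∷ p) zero    = ≤-trans (≤-reflexive (cong card (sym (p─⊥≡p p)))) (n≤1+n _)
card-remove (inside  ∷ p) (suc x) = s≤s (card-remove p x)
card-remove (outside ∷ p) (suc x) = card-remove p x

module Walks {n m : ℕ} (G : Graph n m) where

  Incident : Fin m → Fin n → Set
  Incident e v = proj₁ (G e) ≡ v ⊎ proj₂ (G e) ≡ v

  incident? : ∀ e v → Dec (Incident e v)
  incident? e v = proj₁ (G e) ≟ v ⊎-dec proj₂ (G e) ≟ v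

  joins-source : ∀ {e u v} → Joins G e u v → Incident e u
  joins-source (inj₁ eq) = inj₁ (cong proj₁ eq)
  joins-source (inj₂ eq) = inj₂ (cong proj₂ eq)

  joins-target : ∀ {e u v} → Joins G e u v → Incident e v
  joins-target (inj₁ eq) = inj₂ (cong proj₂ eq)
  joins-target (inj₂ eq) = inj₁ (cong proj₁ eq)

  joins-only : ∀ {e u v x} → Joins G e u v → Incident e x → x ≡ u ⊎ x ≡ v
  joins-only (inj₁ eq) (inj₁ p) = inj₁ (trans (sym p) (cong proj₁ eq))
  joins-only (inj₁ eq) (inj₂ p) = inj₂ (trans (sym p) (cong proj₂ eq))
  joins-only (inj₂ eq) (inj₁ p) = inj₂ (trans (sym p) (cong proj₁ eq))
  joins-only (inj₂ eq) (inj₂ p) = inj₁ (trans (sym p) (cong proj₂ eq))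

  other-end : ∀ {e x} → Incident e x → ∃[ y ] Joins G e y x
  other-end {e} (inj₁ refl) = proj₂ (G e) , inj₂ refl
  other-end {e} (inj₂ refl) = proj₁ (G e) , inj₁ refl

  last-incident : ∀ {a v} (w : Walk G a v) → a ≢ v → ∃[ e ] (e ∈ˡ edges G w × Incident e v)
  last-incident stop a≢v = ⊥-elim (a≢v refl)
  last-incident {v = v} (step {v = c} e j w) a≢v with c ≟ v
  ... | yes refl = e , here refl , joins-target j
  ... | no c≢v   = let e′ , e′∈ , inc = last-incident w c≢v in e′ , there e′∈ , inc

  module _ {J : Fin m → Set} (v : Fin n)
           (one : ∀ {e e′} → J e → J e′ → Incident e v → Incident e′ v → e ≡ e′) where

    trail-avoids-inner : ∀ {a b} (w : Walk G a b) → All J (edges G w) → Unique (edges G w) →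
                         a ≢ v → b ≢ v → All (λ e → ¬ Incident e v) (edges G w)
    trail-avoids-inner stop _ _ _ _ = []
    trail-avoids-inner (step {v = c} e j w) (Je ∷ Jw) (e∉ ∷ u) a≢v b≢v with c ≟ v
    trail-avoids-inner (step e j w) (Je ∷ Jw) (e∉ ∷ u) a≢v b≢v | no c≢v =
      (λ inc → absurd (joins-only j inc)) ∷ trail-avoids-inner w Jw u c≢v b≢v
      where
      absurd : v ≡ _ ⊎ v ≡ _ → ⊥
      absurd (inj₁ eq) = a≢v (sym eq)
      absurd (inj₂ eq) = c≢v (sym eq)
    trail-avoids-inner (step e j stop) _ _ a≢v b≢v | yes refl = ⊥-elim (b≢v refl)
    trail-avoids-inner (step e j (step e′ j′ w)) (Je ∷ Je′ ∷ _) ((e≢e′ ∷ _) ∷ _) a≢v b≢v | yes refl =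
      ⊥-elim (e≢e′ (one Je Je′ (joins-target j) (joins-source j′)))

    -- A trail passing through `v` enters and leaves by different edges, which `one` forbids. If the
    -- trail is based at `v`, its first edge and some later edge play these roles; a loop, which
    -- alone forms a closed trail, has to be excluded.
    closed-trail-avoids : (∀ {e} → J e → ¬ Joins G e v v) →
      ∀ {a} (w : Walk G a a) → All J (edges G w) → Unique (edges G w) → All (λ e → ¬ Incident e v) (edges G w)
    closed-trail-avoids no-loop {a} w Jw u with a ≟ v
    closed-trail-avoids no-loop w Jw u | no a≢v = trail-avoids-inner w Jw u a≢v a≢v
    closed-trail-avoids no-loop stop Jw u | yes refl = []
    closed-trail-avoids no-loop (step {v = c} e j w) (Je ∷ Jw) (e∉ ∷ u) | yes refl =
      let e′ , e′∈ , inc = last-incident w (λ { refl → no-loop Je j })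
      in ⊥-elim (All.lookup e∉ e′∈ (one Je (All.lookup Jw e′∈) (joins-source j) inc))

  vertices : ∀ {u v} → Walk G u v → List (Fin n)
  vertices (stop {u})         = u ∷ []
  vertices (step {u = u} _ _ w) = u ∷ vertices w

  start∈ : ∀ {u v} (w : Walk G u v) → u ∈ˡ vertices w
  start∈ stop         = here refl
  start∈ (step _ _ _) = here refl

  edge-ends∈ : ∀ {u v} (w : Walk G u v) {e x} → e ∈ˡ edges G w → Incident e x → x ∈ˡ vertices w
  edge-ends∈ (step e j w) (here refl) inc with joins-only j inc
  ... | inj₁ refl = here refl
  ... | inj₂ refl = there (start∈ w)
  edge-ends∈ (step e j w) (there e∈) inc = there (edge-ends∈ w e∈ inc)

  -- The part of a path up to `y`, to be closed to a cycle by an edge from `y` to `x`. That edge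
  -- makes `y` a source, hence `end-fresh`.
  record Prefix {x z} (w : Walk G x z) (y : Fin n) : Set where
    field
      walk           : Walk G x y
      edges-⊆        : ∀ {e} → e ∈ˡ edges G walk → e ∈ˡ edges G w
      edges-unique   : Unique (edges G walk)
      sources-⊆      : ∀ {v} → v ∈ˡ sources G walk → v ∈ˡ vertices w
      sources-unique : Unique (sources G walk)
      end-fresh      : y ∉ˡ sources G walk

  prefix : ∀ {x z} (w : Walk G x z) {y} → y ∈ˡ vertices w → Unique (vertices w) → Unique (edges G w) → Prefix w y
  prefix stop (here refl) _ _ = record
    { walk = stop ; edges-⊆ = λ () ; edges-unique = [] ; sources-⊆ = λ () ; sources-unique = [] ; end-fresh = λ () }
  prefix (step e j w) (here refl) _ _ = record
    { walk = stop ; edges-⊆ = λ () ; edges-unique = [] ; sources-⊆ = λ () ; sources-unique = [] ; end-fresh = λ () }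
  prefix (step e j w) (there y∈) (u∉ ∷ uv) (e∉ ∷ ue) = record
    { walk           = step e j walk
    ; edges-⊆        = λ { (here refl) → here refl ; (there e∈) → there (edges-⊆ e∈) }
    ; edges-unique   = All.tabulate (λ e∈ → All.lookup e∉ (edges-⊆ e∈)) ∷ edges-unique
    ; sources-⊆      = λ { (here refl) → here refl ; (there v∈) → there (sources-⊆ v∈) }
    ; sources-unique = All.tabulate (λ v∈ → All.lookup u∉ (sources-⊆ v∈)) ∷ sources-unique
    ; end-fresh      = λ { (here refl) → All.lookup u∉ y∈ refl ; (there y∈′) → end-fresh y∈′ }
    }
    where open Prefix (prefix w y∈ uv ue)

  -- The number of edges of a forest

  TwoAt : Subset m → Fin n → Set
  TwoAt I v = ∃[ e ] ∃[ e′ ] (e ≢ e′ × (e ∈ I × Incident e v) × (e′ ∈ I × Incident e′ v))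

  twoAt? : ∀ I v → Dec (TwoAt I v)
  twoAt? I v = any? λ e → any? λ e′ →
    ¬? (e ≟ e′) ×-dec (e ∈? I ×-dec incident? e v) ×-dec (e′ ∈? I ×-dec incident? e′ v)

  Within : Subset m → Subset n → Set
  Within I S = ∀ {e v} → e ∈ I → Incident e v → v ∈ S

  module _ {I : Subset m} {S : Subset n} (forest : IsForest G I) (within : Within I S)
           (two : ∀ {v} → v ∈ S → TwoAt I v) where

    -- A path does not return to `x`, so at most its first edge is incident with `x`, and one of two
    -- edges at `x` differs from it.
    fresh-edge : ∀ {x z} (w : Walk G x z) → x ∈ S → Unique (vertices w) →
                 ∃[ e ] (e ∈ I × Incident e x × e ∉ˡ edges G w)
    fresh-edge stop x∈S _ = let e , _ , _ , (e∈ , inc) , _ = two x∈S in e , e∈ , inc , λ ()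
    fresh-edge (step e₁ j w) x∈S (x∉ ∷ _) with two x∈S
    ... | e , e′ , e≢e′ , (e∈ , inc) , (e′∈ , inc′) with e ≟ e₁
    ...   | no e≢e₁  = e , e∈ , inc , λ where
      (here e≡) → e≢e₁ e≡
      (there ∈w) → All.lookup x∉ (edge-ends∈ w ∈w inc) refl
    ...   | yes e≡e₁ = e′ , e′∈ , inc′ , λ where
      (here e′≡) → e≢e′ (trans e≡e₁ (sym e′≡))
      (there ∈w) → All.lookup x∉ (edge-ends∈ w ∈w inc′) refl

    -- A path is extended at its start by an unused edge until that edge closes a cycle.
    no-path : ∀ fuel {x z} (w : Walk G x z) → x ∈ S → All (_∈ I) (edges G w) → Unique (vertices w) →
              Unique (edges G w) → n < length (vertices w) + fuel → ⊥
    no-path zero w _ _ uv _ n< =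
      <-irrefl refl (<-≤-trans n< (≤-trans (≤-reflexive (+-identityʳ _)) (unique-length uv)))
    no-path (suc fuel) {x} w x∈S w⊆I uv ue n< with fresh-edge w x∈S uv
    ... | e , e∈I , inc , e∉w with other-end inc
    ...   | y , j with member? _≟_ y (vertices w)
    ...     | no y∉w  = no-path fuel (step e j w) (within e∈I (joins-source j)) (e∈I ∷ w⊆I)
                          (All.tabulate (λ { v∈ refl → y∉w v∈ }) ∷ uv)
                          (All.tabulate (λ { e′∈ refl → e∉w e′∈ }) ∷ ue)
                          (subst (n <_) (+-suc _ fuel) n<)
    ...     | yes y∈w = forest (step e j walk) (e∈I ∷ All.tabulate (λ e′∈ → All.lookup w⊆I (edges-⊆ e′∈)))
      ( (λ ())
      , All.tabulate (λ { e′∈ refl → e∉w (edges-⊆ e′∈) }) ∷ edges-unique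
      , All.tabulate (λ { v∈ refl → end-fresh v∈ }) ∷ sources-unique )
      where open Prefix (prefix w y∈w uv ue)

  sub-forest : ∀ {I I′} → I′ ⊆ I → IsForest G I → IsForest G I′
  sub-forest I′⊆I forest w w⊆I′ = forest w (All.map I′⊆I w⊆I′)

  -- By `no-path`, some vertex of `S` has at most one edge of a nonempty `I`. Removing that vertex
  -- with its edge, if any, loses no more edges than vertices.
  forest-card : ∀ {I S} → IsForest G I → Within I S → card I ≤ card S
  forest-card {I} {S} = go (card S) ≤-refl
    where
    go : ∀ k {I S} → card S ≤ k → IsForest G I → Within I S → card I ≤ card S
    go k {I} {S} S≤k forest within with nonempty? I
    ... | no empty = ≤-trans (≤-reflexive (trans (cong card (Empty-unique empty)) (∣⊥∣≡0 m))) z≤n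
    ... | yes (e₀ , e₀∈) with any? (λ v → v ∈? S ×-dec ¬? (twoAt? I v))
    ...   | no none = ⊥-elim (no-path forest within two n (stop {u = proj₁ (G e₀)})
                                (within e₀∈ (inj₁ refl)) [] ([] ∷ []) [] ≤-refl)
      where
      two : ∀ {v} → v ∈ S → TwoAt I v
      two {v} v∈S with twoAt? I v
      ... | yes t = t
      ... | no ¬t = ⊥-elim (none (v , v∈S , ¬t))
    ...   | yes (v , v∈S , ¬two) with k | ≤-trans (x∈p⇒∣p-x∣<∣p∣ v∈S) S≤k
    ...     | suc k′ | s≤s S′≤k′ with any? (λ e → e ∈? I ×-dec incident? e v)
    ...       | no none = ≤-trans (go k′ S′≤k′ forest within′) (<⇒≤ (x∈p⇒∣p-x∣<∣p∣ v∈S))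
      where
      within′ : Within I (S - v)
      within′ e∈ inc = x∈p∧x≢y⇒x∈p-y (within e∈ inc) λ { refl → none (_ , e∈ , inc) }
    ...       | yes (e , e∈ , inc) = begin
      card I              ≤⟨ card-remove I e ⟩
      suc (card (I - e))  ≤⟨ s≤s (go k′ S′≤k′ (sub-forest (p─q⊆p I _) forest) within′) ⟩
      suc (card (S - v))  ≤⟨ x∈p⇒∣p-x∣<∣p∣ v∈S ⟩
      card S              ∎
      where
      open ≤-Reasoning
      within′ : Within (I - e) (S - v)
      within′ {e′} e′∈ inc′ = x∈p∧x≢y⇒x∈p-y (within (p─q⊆p I _ e′∈) inc′) λ { refl → 
        ¬two (e , e′ , (λ { refl → ∉-remove I e e′∈ }) , (e∈ , inc) , (p─q⊆p I _ e′∈ , inc′)) }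

-- Finite sums of rationals

∑-mono : ∀ {n} {f g : Fin n → ℚ} → (∀ i → f i ℚ.≤ g i) → ∑ f ℚ.≤ ∑ g
∑-mono {zero}  f≤g = ℚ.≤-refl
∑-mono {suc n} f≤g = ℚ.+-mono-≤ (f≤g zero) (∑-mono (f≤g ∘ suc))

∑-mono-< : ∀ {n} {f g : Fin n → ℚ} → (∀ i → f i ℚ.≤ g i) → ∀ i → f i ℚ.< g i → ∑ f ℚ.< ∑ g
∑-mono-< f≤g zero    f<g = ℚ.+-mono-<-≤ f<g (∑-mono (f≤g ∘ suc))
∑-mono-< f≤g (suc i) f<g = ℚ.+-mono-≤-< (f≤g zero) (∑-mono-< (f≤g ∘ suc) i f<g)

∑-zero : ∀ {n} {f : Fin n → ℚ} → (∀ i → f i ≡ 0ℚ) → ∑ f ≡ 0ℚ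
∑-zero {zero}  f≡0 = refl
∑-zero {suc n} f≡0 = cong₂ ℚ._+_ (f≡0 zero) (∑-zero (f≡0 ∘ suc))

infix 8 _∣·_

_∣·_ : Bool → ℚ → ℚ
b ∣· q = if b then q else 0ℚ

∣·-nonneg : ∀ b {q} → 0ℚ ℚ.≤ q → 0ℚ ℚ.≤ b ∣· q
∣·-nonneg true  0≤q = 0≤q
∣·-nonneg false 0≤q = ℚ.≤-refl

∑-indicator : ∀ {n} (i : Fin n) q → ∑ (λ j → does (i ≟ j) ∣· q) ≡ q
∑-indicator {suc n} zero q = trans (cong (q ℚ.+_) (∑-zero {n} (λ _ → refl))) (ℚ.+-identityʳ q)
∑-indicator (suc i) q = trans (ℚ.+-identityˡ _) (trans (∑-cong eq) (∑-indicator i q))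
  where
  eq : ∀ j → does (suc i ≟ suc j) ∣· q ≡ does (i ≟ j) ∣· q
  eq j with i ≟ j
  ... | yes _ = refl
  ... | no  _ = refl

-- The embedding of the natural numbers, by recursion, so that its laws follow by induction without
-- normalising fractions.
ι : ℕ → ℚ
ι zero    = 0ℚ
ι (suc n) = 1ℚ ℚ.+ ι n

ι-mono : ∀ {m n} → m ≤ n → ι m ℚ.≤ ι n
ι-mono {n = zero}  z≤n = ℚ.≤-refl
ι-mono {n = suc n} z≤n = ℚ.+-mono-≤ (ℚ.nonNegative⁻¹ 1ℚ) (ι-mono (z≤n {n}))
ι-mono (s≤s m≤n) = ℚ.+-monoʳ-≤ 1ℚ (ι-mono m≤n)

∑-card : ∀ {n} (p : Subset n) q → ∑ (λ i → Vec.lookup p i ∣· q) ≡ q ℚ.* ι (card p)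
∑-card []            q = sym (ℚ.*-zeroʳ q)
∑-card (outside ∷ p) q = trans (ℚ.+-identityˡ _) (∑-card p q)
∑-card (inside  ∷ p) q = begin
  q ℚ.+ ∑ (λ i → Vec.lookup p i ∣· q)     ≡⟨ cong₂ ℚ._+_ (sym (ℚ.*-identityʳ q)) (∑-card p q) ⟩
  q ℚ.* 1ℚ ℚ.+ q ℚ.* ι (card p)           ≡⟨ ℚ.*-distribˡ-+ q 1ℚ (ι (card p)) ⟨
  q ℚ.* ι (suc (card p))                  ∎
  where open ≡-Reasoning

∑-subsets-cong : ∀ m {f g : Subset m → ℚ} → (∀ I → f I ≡ g I) → ∑-subsets m f ≡ ∑-subsets m g
∑-subsets-cong zero    f≡g = f≡g []
∑-subsets-cong (suc m) f≡g =
  cong₂ ℚ._+_ (∑-subsets-cong m (λ I → f≡g (inside ∷ I))) (∑-subsets-cong m (λ I → f≡g (outside ∷ I)))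

∑-subsets-mono : ∀ m {f g : Subset m → ℚ} → (∀ I → f I ℚ.≤ g I) → ∑-subsets m f ℚ.≤ ∑-subsets m g
∑-subsets-mono zero    f≤g = f≤g []
∑-subsets-mono (suc m) f≤g =
  ℚ.+-mono-≤ (∑-subsets-mono m (λ I → f≤g (inside ∷ I))) (∑-subsets-mono m (λ I → f≤g (outside ∷ I)))

∑-subsets-*ʳ : ∀ m (f : Subset m → ℚ) q → ∑-subsets m (λ I → f I ℚ.* q) ≡ ∑-subsets m f ℚ.* q
∑-subsets-*ʳ zero    f q = refl
∑-subsets-*ʳ (suc m) f q = trans
  (cong₂ ℚ._+_ (∑-subsets-*ʳ m (λ I → f (inside ∷ I)) q) (∑-subsets-*ʳ m (λ I → f (outside ∷ I)) q))
  (sym (ℚ.*-distribʳ-+ q (∑-subsets m (λ I → f (inside ∷ I))) (∑-subsets m (λ I → f (outside ∷ I)))))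

∑-subsets-∣· : ∀ m b (f : Subset m → ℚ) → b ∣· ∑-subsets m f ≡ ∑-subsets m (λ I → b ∣· f I)
∑-subsets-∣· m       true  f = refl
∑-subsets-∣· zero    false f = refl
∑-subsets-∣· (suc m) false f = cong₂ ℚ._+_ (∑-subsets-∣· m false (λ I → f (inside ∷ I)))
                                         (∑-subsets-∣· m false (λ I → f (outside ∷ I)))

∑-∑-subsets : ∀ {n} m (f : Fin n → Subset m → ℚ) →
  ∑ (λ i → ∑-subsets m (f i)) ≡ ∑-subsets m (λ I → ∑ (λ i → f i I))
∑-∑-subsets zero    f = refl
∑-∑-subsets (suc m) f = trans (∑-+ (λ i → ∑-subsets m (λ I → f i (inside ∷ I))) (λ i → ∑-subsets m (λ I → f i (outside ∷ I))))
  (cong₂ ℚ._+_ (∑-∑-subsets m (λ i I → f i (inside ∷ I))) (∑-∑-subsets m (λ i I → f i (outside ∷ I))))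

filterᵛ : ∀ {n} {P : Fin n → Set} → (∀ i → Dec (P i)) → Subset n
filterᵛ P? = Vec.tabulate (λ i → does (P? i))

∈-filterᵛ : ∀ {n} {P : Fin n → Set} (P? : ∀ i → Dec (P i)) {i} → P i → i ∈ filterᵛ P?
∈-filterᵛ P? {i} Pi = Vec.lookup⇒[]= i _ (trans (Vec.lookup∘tabulate (does ∘ P?) i) (dec-true (P? i) Pi))

-- Sparse vertices

2ℚ : ℚ
2ℚ = 1ℚ ℚ.+ 1ℚ

module Degrees {n m : ℕ} (G : Graph n m) (g : Fin m → ℚ) (inst : IsCBGT (IsForest G) g) where
  open IsCBGT inst
  open Walks G

  -- This replaces a decision whether `I` is a forest by the decidable question whether its
  -- coefficient vanishes. It is constructive because `IsForest` is a negative statement.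
  forest-or-zero : ∀ I → coeff I ≢ 0ℚ → IsForest G I
  forest-or-zero I c≢0 w w⊆I cyc = c≢0 (coeff-support I λ forest → forest w w⊆I cyc)

  total-rate≤card : ∀ {A S} → Within A S → ∑ (λ e → Vec.lookup A e ∣· g e) ℚ.≤ ι (card S)
  total-rate≤card {A} {S} within = begin
    ∑ (λ e → Vec.lookup A e ∣· g e)
      ≡⟨ ∑-cong (λ e → trans (cong (Vec.lookup A e ∣·_) (coeff-rate e)) (∑-subsets-∣· m (Vec.lookup A e) _)) ⟩
    ∑ (λ e → ∑-subsets m (λ I → Vec.lookup A e ∣· (Vec.lookup I e ∣· coeff I)))
      ≡⟨ ∑-∑-subsets m (λ e I → Vec.lookup A e ∣· (Vec.lookup I e ∣· coeff I)) ⟩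
    ∑-subsets m (λ I → ∑ (λ e → Vec.lookup A e ∣· (Vec.lookup I e ∣· coeff I)))
      ≡⟨ ∑-subsets-cong m (λ I → trans (∑-cong (meet I)) (∑-card (A ∩ I) (coeff I))) ⟩
    ∑-subsets m (λ I → coeff I ℚ.* ι (card (A ∩ I)))
      ≤⟨ ∑-subsets-mono m bound ⟩
    ∑-subsets m (λ I → coeff I ℚ.* ι (card S))
      ≡⟨ ∑-subsets-*ʳ m coeff (ι (card S)) ⟩
    ∑-subsets m coeff ℚ.* ι (card S)
      ≡⟨ cong (ℚ._* ι (card S)) coeff-total ⟩
    1ℚ ℚ.* ι (card S)
      ≡⟨ ℚ.*-identityˡ _ ⟩
    ι (card S) ∎
    where
    open ℚ.≤-Reasoning
    meet : ∀ I e → Vec.lookup A e ∣· (Vec.lookup I e ∣· coeff I) ≡ Vec.lookup (A ∩ I) e ∣· coeff I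
    meet I e rewrite Vec.lookup-zipWith _∧_ e A I with Vec.lookup A e
    ... | true  = refl
    ... | false = refl
    bound : ∀ I → coeff I ℚ.* ι (card (A ∩ I)) ℚ.≤ coeff I ℚ.* ι (card S)
    bound I with coeff I ℚ.≟ 0ℚ
    ... | yes c≡0 = ℚ.≤-reflexive (trans (trans (cong (ℚ._* _) c≡0) (ℚ.*-zeroˡ (ι (card (A ∩ I)))))
                                         (sym (trans (cong (ℚ._* _) c≡0) (ℚ.*-zeroˡ (ι (card S))))))
    ... | no c≢0  = ℚ.*-monoˡ-≤-nonNeg (coeff I) ⦃ ℚ.nonNegative (coeff-nonneg I) ⦄
      (ι-mono (forest-card (sub-forest (p∩q⊆q A I) (forest-or-zero I c≢0)) λ e∈ → within (p∩q⊆p A I e∈)))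

  touchesᵇ : Fin n → Fin m → Bool
  touchesᵇ v e = does (incident? e v)

  degree : Subset m → Fin n → ℚ
  degree A v = ∑ (λ e → touchesᵇ v e ∣· (Vec.lookup A e ∣· g e))

  degree-sum : ∀ A → ∑ (degree A) ℚ.≤ ∑ (λ e → Vec.lookup A e ∣· g e) ℚ.+ ∑ (λ e → Vec.lookup A e ∣· g e)
  degree-sum A = begin
    ∑ (λ v → ∑ (λ e → touchesᵇ v e ∣· w e))    ≡⟨ ∑-swap (λ v e → touchesᵇ v e ∣· w e) ⟩
    ∑ (λ e → ∑ (λ v → touchesᵇ v e ∣· w e))    ≤⟨ ∑-mono two-ends ⟩
    ∑ (λ e → w e ℚ.+ w e)                      ≡⟨ ∑-+ w w ⟩
    ∑ w ℚ.+ ∑ w                                ∎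
    where
    open ℚ.≤-Reasoning
    w : Fin m → ℚ
    w e = Vec.lookup A e ∣· g e
    -- Only an inequality: a loop has both ends at the vertex but counts once in `degree`.
    split : ∀ a b {q} → 0ℚ ℚ.≤ q → (a ∨ b) ∣· q ℚ.≤ a ∣· q ℚ.+ b ∣· q
    split true  b {q} 0≤q = ℚ.≤-trans (ℚ.≤-reflexive (sym (ℚ.+-identityʳ q))) (ℚ.+-monoʳ-≤ q (∣·-nonneg b 0≤q))
    split false b {q} 0≤q = ℚ.≤-reflexive (sym (ℚ.+-identityˡ _))
    two-ends : ∀ e → ∑ (λ v → touchesᵇ v e ∣· w e) ℚ.≤ w e ℚ.+ w e
    two-ends e = begin
      ∑ (λ v → touchesᵇ v e ∣· w e)
        ≤⟨ ∑-mono (λ v → split (does (proj₁ (G e) ≟ v)) (does (proj₂ (G e) ≟ v)) (∣·-nonneg (Vec.lookup A e) (g-nonneg e))) ⟩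
      ∑ (λ v → does (proj₁ (G e) ≟ v) ∣· w e ℚ.+ does (proj₂ (G e) ≟ v) ∣· w e)
        ≡⟨ ∑-+ (λ v → does (proj₁ (G e) ≟ v) ∣· w e) (λ v → does (proj₂ (G e) ≟ v) ∣· w e) ⟩
      ∑ (λ v → does (proj₁ (G e) ≟ v) ∣· w e) ℚ.+ ∑ (λ v → does (proj₂ (G e) ≟ v) ∣· w e)
        ≡⟨ cong₂ ℚ._+_ (∑-indicator (proj₁ (G e)) (w e)) (∑-indicator (proj₂ (G e)) (w e)) ⟩
      w e ℚ.+ w e ∎

  InUse : Subset m → Fin n → Set
  InUse A v = ∃[ e ] (e ∈ A × Incident e v)

  inUse? : ∀ A v → Dec (InUse A v)
  inUse? A v = any? λ e → e ∈? A ×-dec incident? e v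

  sparse-vertex : ∀ A → Nonempty A → ∃[ v ] (InUse A v × degree A v ℚ.≤ 2ℚ)
  sparse-vertex A (e₀ , e₀∈) with any? (λ v → inUse? A v ×-dec (degree A v ℚ.≤? 2ℚ))
  ... | yes found = found
  ... | no none = ⊥-elim (ℚ.<-irrefl refl (begin-strict
    2ℚ ℚ.* ι (card S)                          ≡⟨ ∑-card S 2ℚ ⟨
    -- Vertices outside `S` contribute 0 here and a nonnegative degree below; an end of `e₀` makes
    -- the inequality strict.
    ∑ (λ v → Vec.lookup S v ∣· 2ℚ)             <⟨ ∑-mono-< dense (proj₁ (G e₀)) dense₀ ⟩
    ∑ (degree A)                               ≤⟨ degree-sum A ⟩
    ∑ (λ e → Vec.lookup A e ∣· g e) ℚ.+ ∑ (λ e → Vec.lookup A e ∣· g e)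
      ≤⟨ ℚ.+-mono-≤ (total-rate≤card within) (total-rate≤card within) ⟩
    ι (card S) ℚ.+ ι (card S)                  ≡⟨ cong₂ ℚ._+_ (ℚ.*-identityˡ (ι (card S))) (ℚ.*-identityˡ (ι (card S))) ⟨
    1ℚ ℚ.* ι (card S) ℚ.+ 1ℚ ℚ.* ι (card S)    ≡⟨ ℚ.*-distribʳ-+ (ι (card S)) 1ℚ 1ℚ ⟨
    2ℚ ℚ.* ι (card S)                          ∎))
    where
    open ℚ.≤-Reasoning
    S : Subset n
    S = filterᵛ (inUse? A)
    within : Within A S
    within e∈ inc = ∈-filterᵛ (inUse? A) (_ , e∈ , inc)
    above : ∀ v → InUse A v → 2ℚ ℚ.< degree A v
    above v used = ℚ.≰⇒> λ d≤2 → none (v , used , d≤2)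
    dense : ∀ v → Vec.lookup S v ∣· 2ℚ ℚ.≤ degree A v
    dense v rewrite Vec.lookup∘tabulate (does ∘ inUse? A) v with inUse? A v
    ... | yes used = ℚ.<⇒≤ (above v used)
    ... | no  _    = ℚ.≤-trans (ℚ.≤-reflexive (sym (∑-zero {m} (λ _ → refl))))
                       (∑-mono λ e → ∣·-nonneg (touchesᵇ v e) (∣·-nonneg (Vec.lookup A e) (g-nonneg e)))
    dense₀ : Vec.lookup S (proj₁ (G e₀)) ∣· 2ℚ ℚ.< degree A (proj₁ (G e₀))
    dense₀ rewrite Vec.lookup∘tabulate (does ∘ inUse? A) (proj₁ (G e₀)) with inUse? A (proj₁ (G e₀))
    ... | yes used = above _ used
    ... | no ¬used = ⊥-elim (¬used (e₀ , e₀∈ , inj₁ refl))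

-- Scheduling the edges of one vertex

ι-+ : ∀ m n → ι (m + n) ≡ ι m ℚ.+ ι n
ι-+ zero    n = sym (ℚ.+-identityˡ (ι n))
ι-+ (suc m) n = trans (cong (1ℚ ℚ.+_) (ι-+ m n)) (sym (ℚ.+-assoc 1ℚ (ι m) (ι n)))

ι-double : ∀ n → ι (2 * n) ≡ ι n ℚ.+ ι n
ι-double n = trans (cong (λ k → ι (n + k)) (+-identityʳ n)) (ι-+ n n)

ι-positive : ∀ {n} → 1 ≤ n → 0ℚ ℚ.< ι n
ι-positive 1≤n = ℚ.<-≤-trans (ℚ.positive⁻¹ (ι 1)) (ι-mono 1≤n)

update : ∀ {m} {A : Set} → (Fin m → A) → Fin m → A → Fin m → A
update f e a e′ = if does (e ≟ e′) then a else f e′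

update-same : ∀ {m} {A : Set} (f : Fin m → A) e a → update f e a e ≡ a
update-same f e a rewrite dec-true (e ≟ e) refl = refl

update-other : ∀ {m} {A : Set} (f : Fin m → A) e a {e′} → e ≢ e′ → update f e a e′ ≡ f e′
update-other f e a {e′} enee′ rewrite dec-false (e ≟ e′) enee′ = refl

module Scheduling {m : ℕ} (g : Fin m → ℚ) (v : Bits) (r₀ : Fin m → Rec)
  (g≥0   : ∀ e → 0ℚ ℚ.≤ g e)
  (g>0   : ∀ e → live (r₀ e) ≡ true → 0ℚ ℚ.< g e)
  (heavy : ∀ e → live (r₀ e) ≡ true → 2ℚ ℚ.≤ ι (2 ^ length (counter (r₀ e))) ℚ.* g e)
  (long  : ∀ e → live (r₀ e) ≡ true → length (counter (r₀ e)) ≢ 0)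
  where

  New : (Fin m → Rec) → Fin m → Set
  New r e = live (r₀ e) ≡ true × live (r e) ≡ false

  newᵇ : (Fin m → Rec) → Fin m → Bool
  newᵇ r e = live (r₀ e) ∧ not (live (r e))

  -- The number of strings of the length of `o` that are taken, counting all extensions of shorter
  -- assigned strings: those before `o`, or all of them after the overflow, which resets `o` to 0.
  used : Bool × Bits → ℕ
  used (full , o) = val o + (if full then 2 ^ length o else 0)

  record Partial (r : Fin m → Rec) : Set where
    field
      old   : ∀ e → r e ≡ r₀ e ⊎ New r e
      touch : ∀ e → New r e → touches v (r₀ e) ≡ true
      shape : ∀ e → ends (r e) ≡ ends (r₀ e) × length (counter (r e)) ≡ length (counter (r₀ e))
      apart : ∀ e e′ → e ≢ e′ → New r e → New r e′ → counter (r e) # counter (r e′)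

  -- `load` is Kraft's sum in terms of rates: the taken fraction of all strings is at most half the
  -- total rate of the edges served. `below` is restricted to the time before overflow, when `o` is
  -- still free.
  record Inv (s : Bool × Bits) (r : Fin m → Rec) : Set where
    field
      partial : Partial r
      below   : proj₁ s ≡ false → ∀ e → New r e → counter (r e) ◁ reverse (proj₂ s)
      load    : 2ℚ ℚ.* ι (used s) ℚ.≤ ι (2 ^ length (proj₂ s)) ℚ.* ∑ (λ e → newᵇ r e ∣· g e)
    open Partial partial public

  -- Writing back an unchanged record gives a function that agrees with the old one only pointwise.
  Inv-cong : ∀ {s r r′} → (∀ e → r′ e ≡ r e) → Inv s r → Inv s r′
  Inv-cong {s} {r} {r′} eq inv = record
    { partial = record
      { old   = λ e → old′ e (old e)
      ; touch = λ e new → touch e (back e new)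
      ; shape = λ e → subst (λ x → ends x ≡ _ × length (counter x) ≡ _) (sym (eq e)) (shape e)
      ; apart = λ e e′ ne new new′ → subst₂ (λ x y → counter x # counter y) (sym (eq e)) (sym (eq e′))
                                      (apart e e′ ne (back e new) (back e′ new′))
      }
    ; below = λ nf e new → subst (λ x → counter x ◁ _) (sym (eq e)) (below nf e (back e new))
    ; load  = ℚ.≤-trans load (ℚ.≤-reflexive (cong (ι (2 ^ length (proj₂ s)) ℚ.*_)
                (∑-cong λ e → cong (λ x → (live (r₀ e) ∧ not (live x)) ∣· g e) (sym (eq e)))))
    }
    where
    open Inv inv
    back : ∀ e → New r′ e → New r e
    back e (l₀ , l) = l₀ , trans (cong live (sym (eq e))) l
    old′ : ∀ e → r e ≡ r₀ e ⊎ New r e → r′ e ≡ r₀ e ⊎ New r′ e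
    old′ e (inj₁ p)         = inj₁ (trans (eq e) p)
    old′ e (inj₂ (l₀ , l))  = inj₂ (l₀ , trans (cong live (eq e)) l)

  live-old : ∀ {s r} → Inv s r → ∀ e → live (r e) ≡ true → r e ≡ r₀ e
  live-old inv e l with Inv.old inv e
  ... | inj₁ eq = eq
  ... | inj₂ (_ , l′) with () ← trans (sym l) l′

  assign-new : ∀ {o r} → Inv (false , o) r → ∀ e → live (r e) ≡ true → touches v (r e) ≡ true →
    length (counter (r e)) ≡ length o → Inv (inc o) (update r e (false , ends (r e) , reverse o))
  assign-new {o} {r} inv e l t len = record
    { partial = record
      { old   = λ e′ → old′ e′ (e ≟ e′)
      ; touch = λ e′ → touch′ e′ (e ≟ e′)
      ; shape = λ e′ → shape′ e′ (e ≟ e′)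
      ; apart = λ e₁ e₂ → apart′ e₁ e₂ (e ≟ e₁) (e ≟ e₂)
      }
    ; below = λ nf e′ → below′ nf e′ (e ≟ e′)
    ; load  = begin
        2ℚ ℚ.* ι (used (inc o))
          ≡⟨ cong (λ k → 2ℚ ℚ.* ι k) used-inc ⟩
        2ℚ ℚ.* (1ℚ ℚ.+ ι (val o))
          ≡⟨ ℚ.*-distribˡ-+ 2ℚ 1ℚ (ι (val o)) ⟩
        2ℚ ℚ.* 1ℚ ℚ.+ 2ℚ ℚ.* ι (val o)
          ≡⟨ cong₂ ℚ._+_ (ℚ.*-identityʳ 2ℚ) (cong (λ k → 2ℚ ℚ.* ι k) (sym (+-identityʳ (val o)))) ⟩
        2ℚ ℚ.+ 2ℚ ℚ.* ι (used (false , o))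
          -- The bound 2 ≤ 2ᵏ g(e) pays for the one string that `e` takes.
          ≤⟨ ℚ.+-mono-≤ (subst (λ k → 2ℚ ℚ.≤ ι (2 ^ k) ℚ.* g e) len₀ (heavy e l₀)) load ⟩
        ι (2 ^ length o) ℚ.* g e ℚ.+ ι (2 ^ length o) ℚ.* ∑ (λ e′ → newᵇ r e′ ∣· g e′)
          ≡⟨ ℚ.*-distribˡ-+ (ι (2 ^ length o)) (g e) _ ⟨
        ι (2 ^ length o) ℚ.* (g e ℚ.+ ∑ (λ e′ → newᵇ r e′ ∣· g e′))
          ≡⟨ cong₂ ℚ._*_ (cong (λ k → ι (2 ^ k)) (length-inc o)) sum-new ⟨
        ι (2 ^ length (proj₂ (inc o))) ℚ.* ∑ (λ e′ → newᵇ r′ e′ ∣· g e′) ∎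
    }
    where
    open Inv inv
    open ℚ.≤-Reasoning
    r′ : Fin m → Rec
    r′ = update r e (false , ends (r e) , reverse o)
    re≡ : r e ≡ r₀ e
    re≡ = live-old inv e l
    l₀ : live (r₀ e) ≡ true
    l₀ = trans (cong live (sym re≡)) l
    len₀ : length (counter (r₀ e)) ≡ length o
    len₀ = trans (cong (length ∘ counter) (sym re≡)) len
    r′e : r′ e ≡ (false , ends (r e) , reverse o)
    r′e = update-same r e _
    other : ∀ {e′} → e ≢ e′ → r′ e′ ≡ r e′
    other = update-other r e _
    back : ∀ {e′} → e ≢ e′ → New r′ e′ → New r e′
    back ne (l₀ , l) = l₀ , trans (cong live (sym (other ne))) l
    old′ : ∀ e′ → Dec (e ≡ e′) → r′ e′ ≡ r₀ e′ ⊎ New r′ e′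
    old′ e′ (yes refl) = inj₂ (l₀ , cong live r′e)
    old′ e′ (no ne) with old e′
    ... | inj₁ p          = inj₁ (trans (other ne) p)
    ... | inj₂ (l₀′ , l′) = inj₂ (l₀′ , trans (cong live (other ne)) l′)
    touch′ : ∀ e′ → Dec (e ≡ e′) → New r′ e′ → touches v (r₀ e′) ≡ true
    touch′ e′ (yes refl) _   = trans (cong (touches v) (sym re≡)) t
    touch′ e′ (no ne)     new = touch e′ (back ne new)
    shape′ : ∀ e′ → Dec (e ≡ e′) → ends (r′ e′) ≡ ends (r₀ e′) × length (counter (r′ e′)) ≡ length (counter (r₀ e′))
    shape′ e′ (yes refl) = trans (cong ends r′e) (cong ends re≡) ,
      trans (cong (length ∘ counter) r′e) (trans (length-reverse o) (sym len₀))
    shape′ e′ (no ne)     = subst (λ x → ends x ≡ _ × length (counter x) ≡ _) (sym (other ne)) (shape e′)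
    new-◁ : ∀ {e′} → e ≢ e′ → New r′ e′ → counter (r′ e′) ◁ reverse o
    new-◁ ne new = subst (λ x → counter x ◁ reverse o) (sym (other ne)) (below refl _ (back ne new))
    apart′ : ∀ e₁ e₂ → Dec (e ≡ e₁) → Dec (e ≡ e₂) → e₁ ≢ e₂ → New r′ e₁ → New r′ e₂ →
             counter (r′ e₁) # counter (r′ e₂)
    apart′ e₁ e₂ (yes refl) (yes refl) ne _ _ = ⊥-elim (ne refl)
    apart′ e₁ e₂ (yes refl) (no ≢₂) _ _ new  = inj₂ (subst (λ x → counter (r′ e₂) ◁ counter x) (sym r′e) (new-◁ ≢₂ new))
    apart′ e₁ e₂ (no ≢₁) (yes refl) _ new _  = inj₁ (subst (λ x → counter (r′ e₁) ◁ counter x) (sym r′e) (new-◁ ≢₁ new))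
    apart′ e₁ e₂ (no ≢₁) (no ≢₂) ne new new′  =
      subst₂ (λ x y → counter x # counter y) (sym (other ≢₁)) (sym (other ≢₂))
        (apart e₁ e₂ ne (back ≢₁ new) (back ≢₂ new′))
    below′ : proj₁ (inc o) ≡ false → ∀ e′ → Dec (e ≡ e′) → New r′ e′ → counter (r′ e′) ◁ reverse (proj₂ (inc o))
    below′ nf e′ (yes refl) _   = subst (λ x → counter x ◁ _) (sym r′e) (◁-reverse-inc o nf)
    below′ nf e′ (no ne)     new = ◁-trans (new-◁ ne new) (◁-reverse-inc o nf)
    used-inc : used (inc o) ≡ suc (val o)
    used-inc = trans (cong (λ k → val (proj₂ (inc o)) + (if proj₁ (inc o) then 2 ^ k else 0)) (length-inc o)) (val-inc o)
    sum-new : ∑ (λ e′ → newᵇ r′ e′ ∣· g e′) ≡ g e ℚ.+ ∑ (λ e′ → newᵇ r e′ ∣· g e′)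
    sum-new = begin-equality
      ∑ (λ e′ → newᵇ r′ e′ ∣· g e′)                            ≡⟨ ∑-cong pointwise ⟩
      ∑ (λ e′ → does (e ≟ e′) ∣· g e ℚ.+ newᵇ r e′ ∣· g e′)    ≡⟨ ∑-+ (λ e′ → does (e ≟ e′) ∣· g e) (λ e′ → newᵇ r e′ ∣· g e′) ⟩
      ∑ (λ e′ → does (e ≟ e′) ∣· g e) ℚ.+ ∑ (λ e′ → newᵇ r e′ ∣· g e′) ≡⟨ cong (ℚ._+ _) (∑-indicator e (g e)) ⟩
      g e ℚ.+ ∑ (λ e′ → newᵇ r e′ ∣· g e′) ∎
      where
      pointwise : ∀ e′ → newᵇ r′ e′ ∣· g e′ ≡ does (e ≟ e′) ∣· g e ℚ.+ newᵇ r e′ ∣· g e′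
      pointwise e′ with e ≟ e′
      ... | yes refl rewrite l₀ | l = sym (ℚ.+-identityʳ (g e))
      ... | no ne     = sym (ℚ.+-identityˡ _)

  candidate-sound : ∀ o r → candidate v o r ≡ true →
                    live r ≡ true × touches v r ≡ true × length (counter r) ≡ length o
  candidate-sound o r eq with live r | touches v r
  ... | true | true = refl , refl , sameLength-sound (counter r) o eq

  candidate-complete : ∀ o r → live r ≡ true → touches v r ≡ true → length (counter r) ≡ length o →
                       candidate v o r ≡ true
  candidate-complete o r l t len with live r | touches v r
  candidate-complete o r refl refl len | true | true = sameLength-complete (counter r) o len

  record Step (s : Bool × Bits) (r : Fin m → Rec) (e : Fin m) (out : (Bool × Bits) × Rec) : Set where
    s′ = proj₁ out
    r′ = update r e (proj₂ out)
    field
      inv    : Inv s′ r′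
      stays  : live (r′ e) ≡ true → r′ e ≡ r e
      full   : proj₁ s ≡ true → proj₁ s′ ≡ true
      done   : live (r′ e) ≡ true → touches v (r′ e) ≡ true → length (counter (r′ e)) ≡ length (proj₂ s) →
               proj₁ s′ ≡ true

  update-id : ∀ (r : Fin m → Rec) e e′ → update r e (r e) e′ ≡ r e′
  update-id r e e′ with e ≟ e′
  ... | yes refl = refl
  ... | no  _    = refl

  assign-step : ∀ s r e → Inv s r → Step s r e (assign v s (r e))
  assign-step (true , o) r e inv = record
    { inv = Inv-cong (update-id r e) inv ; stays = λ _ → update-id r e e ; full = λ _ → refl ; done = λ _ _ _ → refl }
  assign-step (false , o) r e inv with candidate v o (r e) in cand
  ... | false = record
    { inv = Inv-cong (update-id r e) inv ; stays = λ _ → update-id r e e ; full = λ ()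
    ; done = subst (λ x → live x ≡ true → touches v x ≡ true → length (counter x) ≡ length o → false ≡ true)
                   (sym (update-id r e e)) not-candidate }
    where
    not-candidate : live (r e) ≡ true → touches v (r e) ≡ true → length (counter (r e)) ≡ length o → false ≡ true
    not-candidate l t len = trans (sym cand) (candidate-complete o (r e) l t len)
  ... | true with candidate-sound o (r e) cand
  ...   | l , t , len = record
    { inv = assign-new inv e l t len
    ; stays = λ l′ → ⊥-elim (dead l′) ; full = λ () ; done = λ l′ → ⊥-elim (dead l′) }
    where
    dead : live (update r e (false , ends (r e) , reverse o) e) ≢ true
    dead l′ rewrite update-same r e (false , ends (r e) , reverse o) with () ← l′

  record Pass (s : Bool × Bits) (r : Fin m → Rec) (es : List (Fin m)) (out : (Bool × Bits) × List Rec) : Set where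
    s′ = proj₁ out
    field
      r′     : Fin m → Rec
      result : proj₂ out ≡ map r′ es
      inv    : Inv s′ r′
      stays  : ∀ e → live (r′ e) ≡ true → r′ e ≡ r e
      frame  : ∀ e → e ∉ˡ es → r′ e ≡ r e
      full   : proj₁ s ≡ true → proj₁ s′ ≡ true
      done   : ∀ e → e ∈ˡ es → live (r′ e) ≡ true → touches v (r′ e) ≡ true →
               length (counter (r′ e)) ≡ length (proj₂ s) → proj₁ s′ ≡ true

  map-agree : ∀ {f h : Fin m → Rec} es → (∀ e → e ∈ˡ es → f e ≡ h e) → map f es ≡ map h es
  map-agree []       eq = refl
  map-agree (e ∷ es) eq = cong₂ _∷_ (eq e (here refl)) (map-agree es (λ e′ e′∈ → eq e′ (there e′∈)))

  pass : ∀ s r es → Unique es → Inv s r → Pass s r es (mapAccum (assign v) s (map r es))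
  pass s r []       _        inv = record
    { r′ = r ; result = refl ; inv = inv ; stays = λ _ _ → refl ; frame = λ _ _ → refl ; full = id ; done = λ _ () }
  pass s r (e ∷ es) (e∉ ∷ u) inv = record
    { r′     = P.r′
    ; result = cong₂ _∷_ (sym r′e) P.result
    ; inv    = P.inv
    ; stays  = stays
    ; frame  = λ e′ e′∉ → trans (P.frame e′ (e′∉ ∘ there)) (update-other r e _ (λ { refl → e′∉ (here refl) }))
    ; full   = P.full ∘ S.full
    ; done   = done
    }
    where
    module S = Step (assign-step s r e inv)
    -- The edges are listed without repetition, so the update at `e` is invisible on `es`. This
    -- reconciles the scan of a list with an invariant about functions on edges.
    rest : Pass S.s′ S.r′ es (mapAccum (assign v) S.s′ (map r es))
    rest = subst (λ rs → Pass S.s′ S.r′ es (mapAccum (assign v) S.s′ rs))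
      (map-agree {S.r′} {r} es (λ e′ e′∈ → update-other r e _ (λ { refl → All.lookup e∉ e′∈ refl })))
      (pass S.s′ S.r′ es u S.inv)
    module P = Pass rest
    frame-e : P.r′ e ≡ S.r′ e
    frame-e = P.frame e λ e∈ → All.lookup e∉ e∈ refl
    r′e : P.r′ e ≡ proj₂ (assign v s (r e))
    r′e = trans frame-e (update-same r e _)
    stays : ∀ e′ → live (P.r′ e′) ≡ true → P.r′ e′ ≡ r e′
    stays e′ l with e ≟ e′
    ... | yes refl = trans frame-e (S.stays (trans (cong live (sym frame-e)) l))
    ... | no ne     = trans (P.stays e′ l) (update-other r e _ ne)
    done : ∀ e′ → e′ ∈ˡ e ∷ es → live (P.r′ e′) ≡ true → touches v (P.r′ e′) ≡ true →
           length (counter (P.r′ e′)) ≡ length (proj₂ s) → proj₁ P.s′ ≡ true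
    done e′ (here refl) l t len = P.full (subst
      (λ x → live x ≡ true → touches v x ≡ true → length (counter x) ≡ length (proj₂ s) → proj₁ S.s′ ≡ true)
      (sym frame-e) S.done l t len)
    done e′ (there e′∈) l t len = P.done e′ e′∈ l t (trans len (sym (proj₁ (assign-length v s (r e)))))

  record Levels (s : Bool × Bits) (r : Fin m → Rec) : Set where
    field
      inv   : Inv s r
      swept : ∀ e → live (r e) ≡ true → touches v (r e) ≡ true → length (counter (r e)) ≤ length (proj₂ s) →
              proj₁ s ≡ true

  -- One more bit doubles both the number of taken strings and the number of all strings.
  next-level : ∀ {full o r} → Inv (full , o) r → Inv (full , false ∷ o) r
  next-level {full} {o} {r} inv = record
    { partial = partial
    ; below   = λ nf e new → subst₂ _◁_ (++-identityʳ _) (sym (unfold-reverse false o)) (◁-++ [] (false ∷ []) (below nf e new))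
    ; load    = begin
        2ℚ ℚ.* ι (used (full , false ∷ o))
          ≡⟨ cong (2ℚ ℚ.*_) (trans (cong ι (double full)) (ι-double (used (full , o)))) ⟩
        2ℚ ℚ.* (ι (used (full , o)) ℚ.+ ι (used (full , o)))
          ≡⟨ ℚ.*-distribˡ-+ 2ℚ (ι (used (full , o))) (ι (used (full , o))) ⟩
        2ℚ ℚ.* ι (used (full , o)) ℚ.+ 2ℚ ℚ.* ι (used (full , o))
          ≤⟨ ℚ.+-mono-≤ load load ⟩
        ι (2 ^ length o) ℚ.* Σn ℚ.+ ι (2 ^ length o) ℚ.* Σn
          ≡⟨ ℚ.*-distribʳ-+ Σn (ι (2 ^ length o)) (ι (2 ^ length o)) ⟨
        (ι (2 ^ length o) ℚ.+ ι (2 ^ length o)) ℚ.* Σn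
          ≡⟨ cong (ℚ._* Σn) (ι-double (2 ^ length o)) ⟨
        ι (2 ^ length (false ∷ o)) ℚ.* Σn ∎
    }
    where
    open Inv inv
    open ℚ.≤-Reasoning
    Σn : ℚ
    Σn = ∑ (λ e → newᵇ r e ∣· g e)
    double : ∀ full → used (full , false ∷ o) ≡ 2 * used (full , o)
    double false = trans (+-identityʳ _) (cong (2 *_) (sym (+-identityʳ (val o))))
    double true  = sym (*-distribˡ-+ 2 (val o) (2 ^ length o))

  level : ∀ {s r} → Levels s r →
    ∃[ r′ ] (proj₂ (assignLevel v (s , map r (allFin m))) ≡ map r′ (allFin m)
           × Levels (proj₁ (assignLevel v (s , map r (allFin m)))) r′)
  level {full , o} {r} lv = P.r′ , P.result , record { inv = P.inv ; swept = swept′ }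
    where
    module P = Pass (pass (full , false ∷ o) r (allFin m) (allFin⁺ m) (next-level (Levels.inv lv)))
    length-o : length (proj₂ P.s′) ≡ suc (length o)
    length-o = proj₁ (assignLevel-length v (full , false ∷ o) (map r (allFin m)))
    swept′ : ∀ e → live (P.r′ e) ≡ true → touches v (P.r′ e) ≡ true →
             length (counter (P.r′ e)) ≤ length (proj₂ P.s′) → proj₁ P.s′ ≡ true
    swept′ e l t len with m≤n⇒m<n∨m≡n (≤-trans len (≤-reflexive length-o))
    ... | inj₂ eq = P.done e (∈-allFin e) l t eq
    ... | inj₁ (s≤s len≤) = P.full (subst
      (λ x → live x ≡ true → touches v x ≡ true → length (counter x) ≤ length o → full ≡ true)
      (sym (P.stays e l)) (Levels.swept lv e) l t len≤)

  levels-spec : ∀ ys {s r} → Levels s r →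
    ∃[ r′ ] (proj₂ (assignLevels v (s , map r (allFin m)) ys) ≡ map r′ (allFin m)
           × Levels (proj₁ (assignLevels v (s , map r (allFin m)) ys)) r′)
  levels-spec []       lv = _ , refl , lv
  levels-spec (_ ∷ ys) {s} {r} lv with level lv
  ... | r₁ , eq , lv₁ with levels-spec ys lv₁
  ...   | r₂ , eq₂ , lv₂ rewrite sym eq = r₂ , eq₂ , lv₂

  initial : Levels (false , []) r₀
  initial = record
    { inv = record
      { partial = record
        { old   = λ _ → inj₁ refl
        ; touch = λ e new → ⊥-elim (not-new e new)
        ; shape = λ _ → refl , refl
        ; apart = λ e _ _ new → ⊥-elim (not-new e new)
        }
      ; below = λ _ e new → ⊥-elim (not-new e new)
      ; load  = ℚ.≤-reflexive (trans (ℚ.*-zeroʳ 2ℚ) (sym (trans (cong (ι 1 ℚ.*_) (∑-zero none)) (ℚ.*-zeroʳ (ι 1)))))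
      }
    -- The first level scanned has length 1; by `long` there is nothing to serve at length 0.
    ; swept = λ e l _ len≤ → ⊥-elim (long e l (n≤0⇒n≡0 len≤))
    }
    where
    not-new : ∀ e → ¬ New r₀ e
    not-new e (l , l′) with () ← trans (sym l) l′
    none : ∀ e → newᵇ r₀ e ∣· g e ≡ 0ℚ
    none e with live (r₀ e)
    ... | true  = refl
    ... | false = refl

  length-levels : ∀ es acc e → e ∈ˡ es → length (counter (r₀ e)) ≤ length (foldl (λ acc r → counter r ʳ++ acc) acc (map r₀ es))
  length-levels (e ∷ es) acc e (here refl) =
    ≤-trans (≤-trans (m≤m+n _ (length acc)) (≤-reflexive (sym (length-ʳ++ (counter (r₀ e)))))) (grow es (counter (r₀ e) ʳ++ acc))
    where
    grow : ∀ es acc → length acc ≤ length (foldl (λ acc r → counter r ʳ++ acc) acc (map r₀ es))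
    grow []       acc = ≤-refl
    grow (e ∷ es) acc = ≤-trans (≤-trans (m≤n+m _ (length (counter (r₀ e)))) (≤-reflexive (sym (length-ʳ++ (counter (r₀ e))))))
                                (grow es (counter (r₀ e) ʳ++ acc))
  length-levels (_ ∷ es) acc e (there e∈) = length-levels es _ e e∈

  stuck-true : ∀ {r : Fin m → Rec} es {acc} → foldl (λ acc r → if live r then (if touches v r then true else acc) else acc) acc (map r es) ≡ true →
               acc ≡ true ⊎ ∃[ e ] (live (r e) ≡ true × touches v (r e) ≡ true)
  stuck-true []       eq = inj₁ eq
  stuck-true {r} (e ∷ es) eq with stuck-true {r} es eq
  ... | inj₂ found = inj₂ found
  ... | inj₁ eq′ with live (r e) in l | touches v (r e) in t
  ...   | true  | true  = inj₂ (e , l , t)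
  ...   | true  | false = inj₁ eq′
  ...   | false | _     = inj₁ eq′

  stuck-false : ∀ {r : Fin m → Rec} es {acc} → foldl (λ acc r → if live r then (if touches v r then true else acc) else acc) acc (map r es) ≡ false →
                acc ≡ false × (∀ e → e ∈ˡ es → live (r e) ≡ true → touches v (r e) ≢ true)
  stuck-false []       eq = eq , λ _ ()
  stuck-false {r} (e ∷ es) eq with stuck-false {r} es eq
  ... | eq′ , none with live (r e) in l | touches v (r e) in t
  ...   | true  | false = eq′ , λ { _ (here refl) _ t′ → case-⊥ (trans (sym t) t′) ; e′ (there e∈) → none e′ e∈ }
    where
    case-⊥ : false ≢ true
    case-⊥ ()
  ...   | false | _     = eq′ , λ { _ (here refl) l′ _ → case-⊥ (trans (sym l) l′) ; e′ (there e∈) → none e′ e∈ }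
    where
    case-⊥ : false ≢ true
    case-⊥ ()

  record Scheduled (r : Fin m → Rec) : Set where
    field
      partial : Partial r
      clear   : ∀ e → live (r e) ≡ true → touches v (r e) ≢ true
    open Partial partial public

  -- If an edge at `v` is left over, its level was scanned, so the strings have run out. With all
  -- strings taken, `load` says that the served edges have total rate at least 2, and the positive
  -- rate of the remaining edge exceeds that.
  try-spec : ∃[ r ] (try v (map r₀ (allFin m)) ≡ map r (allFin m)
    × (Scheduled r ⊎ (r ≡ r₀ × 2ℚ ℚ.< ∑ (λ e → (live (r₀ e) ∧ touches v (r₀ e)) ∣· g e))))
  try-spec with levels-spec (levels (map r₀ (allFin m))) initial
  ... | r , eq , lv with stuck v (assignAll v (map r₀ (allFin m))) in st
  ...   | false = r , eq , inj₁ record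
    { partial = Inv.partial (Levels.inv lv)
    ; clear   = λ e → proj₂ (stuck-false (allFin m) (trans (cong (stuck v) (sym eq)) st)) e (∈-allFin e)
    }
  ...   | true with stuck-true {r} (allFin m) (trans (cong (stuck v) (sym eq)) st)
  ...     | inj₂ (e , l , t) = r₀ , refl , inj₂ (refl , overload)
    where
    open Inv (Levels.inv lv)
    open ℚ.≤-Reasoning
    s = proj₁ (assignLevels v ((false , []) , map r₀ (allFin m)) (levels (map r₀ (allFin m))))
    L = 2 ^ length (proj₂ s)
    re≡ : r e ≡ r₀ e
    re≡ = live-old (Levels.inv lv) e l
    full : proj₁ s ≡ true
    full = Levels.swept lv e l t (≤-trans
      (≤-trans (≤-reflexive (cong (length ∘ counter) re≡)) (length-levels (allFin m) [] e (∈-allFin e)))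
      (≤-reflexive (sym (proj₁ (assignLevels-length v ((false , []) , map r₀ (allFin m)) (levels (map r₀ (allFin m))))))))
    saturated : 2ℚ ℚ.≤ ∑ (λ e′ → newᵇ r e′ ∣· g e′)
    saturated = ℚ.*-cancelˡ-≤-pos (ι L) ⦃ ℚ.positive (ι-positive (1≤^ (length (proj₂ s)) (s≤s z≤n))) ⦄ (begin
      ι L ℚ.* 2ℚ               ≡⟨ ℚ.*-comm (ι L) 2ℚ ⟩
      2ℚ ℚ.* ι L               ≤⟨ ℚ.*-monoˡ-≤-nonNeg 2ℚ (ι-mono (≤-trans (m≤n+m L (val (proj₂ s)))
                                    (≤-reflexive (cong (λ f → val (proj₂ s) + (if f then L else 0)) (sym full))))) ⟩
      2ℚ ℚ.* ι (used s)        ≤⟨ load ⟩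
      ι L ℚ.* ∑ (λ e′ → newᵇ r e′ ∣· g e′) ∎)
    pointwise : ∀ e′ → does (e ≟ e′) ∣· g e ℚ.+ newᵇ r e′ ∣· g e′ ℚ.≤ (live (r₀ e′) ∧ touches v (r₀ e′)) ∣· g e′
    pointwise e′ with e ≟ e′
    ... | yes refl rewrite l | trans (cong live (sym re≡)) l | trans (cong (touches v) (sym re≡)) t =
      ℚ.≤-reflexive (ℚ.+-identityʳ (g e))
    ... | no _ with live (r₀ e′) in l₀ | live (r e′) in l′
    ...   | false | _     = ℚ.≤-refl
    ...   | true  | true  = ℚ.≤-trans (ℚ.≤-reflexive (ℚ.+-identityˡ 0ℚ)) (∣·-nonneg (touches v (r₀ e′)) (g≥0 e′))
    ...   | true  | false rewrite touch e′ (l₀ , l′) = ℚ.≤-reflexive (ℚ.+-identityˡ (g e′))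
    overload : 2ℚ ℚ.< ∑ (λ e → (live (r₀ e) ∧ touches v (r₀ e)) ∣· g e)
    overload = begin-strict
      2ℚ                                                     ≡⟨ ℚ.+-identityˡ 2ℚ ⟨
      0ℚ ℚ.+ 2ℚ                                              <⟨ ℚ.+-mono-<-≤ (g>0 e (trans (cong live (sym re≡)) l)) saturated ⟩
      g e ℚ.+ ∑ (λ e′ → newᵇ r e′ ∣· g e′)                   ≡⟨ cong (ℚ._+ _) (∑-indicator e (g e)) ⟨
      ∑ (λ e′ → does (e ≟ e′) ∣· g e) ℚ.+ ∑ (λ e′ → newᵇ r e′ ∣· g e′)
        ≡⟨ ∑-+ (λ e′ → does (e ≟ e′) ∣· g e) (λ e′ → newᵇ r e′ ∣· g e′) ⟨
      ∑ (λ e′ → does (e ≟ e′) ∣· g e ℚ.+ newᵇ r e′ ∣· g e′)  ≤⟨ ∑-mono pointwise ⟩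
      ∑ (λ e → (live (r₀ e) ∧ touches v (r₀ e)) ∣· g e)      ∎

-- Rational rates as fractions of natural numbers

toℚᵘ-ι : ∀ n → toℚᵘ (ι n) ℚᵘ.≃ mkℚᵘ (+ n) 0
toℚᵘ-ι zero    = ℚᵘ.≃-refl
toℚᵘ-ι (suc n) = ℚᵘ.≃-trans (ℚ.toℚᵘ-homo-+ 1ℚ (ι n))
  (ℚᵘ.≃-trans (ℚᵘ.+-congʳ ℚᵘ.1ℚᵘ (toℚᵘ-ι n)) (*≡* (cong (ℤ._* + 1) (cong (λ k → (+ 1) ℤ.+ k) (ℤ.*-identityʳ (+ n))))))

ι-* : ∀ m n → ι (m * n) ≡ ι m ℚ.* ι n
ι-* zero    n = sym (ℚ.*-zeroˡ (ι n))
ι-* (suc m) n = begin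
  ι (n + m * n)                  ≡⟨ ι-+ n (m * n) ⟩
  ι n ℚ.+ ι (m * n)              ≡⟨ cong₂ ℚ._+_ (sym (ℚ.*-identityˡ (ι n))) (ι-* m n) ⟩
  1ℚ ℚ.* ι n ℚ.+ ι m ℚ.* ι n     ≡⟨ ℚ.*-distribʳ-+ (ι n) 1ℚ (ι m) ⟨
  ι (suc m) ℚ.* ι n              ∎
  where open ≡-Reasoning

clear-denominator : ∀ q → 0ℚ ℚ.≤ q → q ℚ.* ι (↧ₙ q) ≡ ι ℤ.∣ ↥ q ∣
clear-denominator q@(mkℚ (+ a) d c) 0≤q = ℚ.toℚᵘ-injective
  (ℚᵘ.≃-trans (ℚ.toℚᵘ-homo-* q (ι (suc d)))
  (ℚᵘ.≃-trans (ℚᵘ.*-congˡ (toℚᵘ-ι (suc d)))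
  (ℚᵘ.≃-trans (*≡* (trans (ℤ.*-identityʳ (+ a ℤ.* + suc d)) (cong (λ k → + a ℤ.* + k) (sym (*-identityʳ (suc d))))))
  (ℚᵘ.≃-sym (toℚᵘ-ι a)))))
clear-denominator q@(mkℚ -[1+ a ] d c) 0≤q with () ← ℚ.nonNegative 0≤q

ι-mono-< : ∀ {m n} → m < n → ι m ℚ.< ι n
ι-mono-< {m} m<n = ℚ.<-≤-trans
  (subst (ℚ._< ι (suc m)) (ℚ.+-identityˡ (ι m)) (ℚ.+-monoˡ-< (ι m) (ℚ.positive⁻¹ 1ℚ))) (ι-mono m<n)

1≤denominator : ∀ q → 1 ≤ ↧ₙ q
1≤denominator (mkℚ _ _ _) = s≤s z≤n

-- Multiplication by the denominator turns the comparisons of natural numbers made by the algorithm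
-- into bounds on the rate.
module Fraction (q : ℚ) (0≤q : 0ℚ ℚ.≤ q) where
  private
    N = ℤ.∣ ↥ q ∣
    D = ↧ₙ q

  ιD>0 : 0ℚ ℚ.< ι D
  ιD>0 = ι-positive (1≤denominator q)

  scale : ∀ n → ι n ℚ.* q ℚ.* ι D ≡ ι (n * N)
  scale n = trans (ℚ.*-assoc (ι n) q (ι D)) (trans (cong (ι n ℚ.*_) (clear-denominator q 0≤q)) (sym (ι-* n N)))

  fraction-≥ : ∀ c n → c * D ≤ n * N → ι c ℚ.≤ ι n ℚ.* q
  fraction-≥ c n h = ℚ.*-cancelʳ-≤-pos (ι D) ⦃ ℚ.positive ιD>0 ⦄
    (ℚ.≤-trans (ℚ.≤-reflexive (sym (ι-* c D))) (ℚ.≤-trans (ι-mono h) (ℚ.≤-reflexive (sym (scale n)))))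

  fraction-< : ∀ c n → n * N < c * D → ι n ℚ.* q ℚ.< ι c
  fraction-< c n h = ℚ.*-cancelʳ-<-nonNeg (ι D) ⦃ ℚ.nonNegative (ℚ.<⇒≤ ιD>0) ⦄
    (ℚ.≤-<-trans (ℚ.≤-reflexive (scale n)) (ℚ.<-≤-trans (ι-mono-< h) (ℚ.≤-reflexive (ι-* c D))))

  numerator≤denominator : q ℚ.≤ 1ℚ → N ≤ D
  numerator≤denominator q≤1 = ≮⇒≥ λ D<N → ℚ.<-irrefl refl (begin-strict
    ι D          <⟨ ι-mono-< D<N ⟩
    ι N          ≡⟨ clear-denominator q 0≤q ⟨
    q ℚ.* ι D    ≤⟨ ℚ.*-monoʳ-≤-nonNeg (ι D) ⦃ ℚ.nonNegative (ℚ.<⇒≤ ιD>0) ⦄ q≤1 ⟩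
    1ℚ ℚ.* ι D   ≡⟨ ℚ.*-identityˡ (ι D) ⟩
    ι D          ∎)
    where open ℚ.≤-Reasoning

  numerator-zero : N ≡ 0 → q ≡ 0ℚ
  numerator-zero N≡0 = ℚ.↥p≡0⇒p≡0 q (ℤ.∣i∣≡0⇒i≡0 N≡0)

-- Elimination of the vertices

∈-tabulate⁺ : ∀ {m} (f : Fin m → Bool) {e} → f e ≡ true → e ∈ Vec.tabulate f
∈-tabulate⁺ f {e} eq = Vec.lookup⇒[]= e _ (trans (Vec.lookup∘tabulate f e) eq)

∈-tabulate⁻ : ∀ {m} (f : Fin m → Bool) {e} → e ∈ Vec.tabulate f → f e ≡ true
∈-tabulate⁻ f {e} e∈ = trans (sym (Vec.lookup∘tabulate f e)) (Vec.[]=⇒lookup e∈)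

vertexBits : ∀ {n} → Fin n → Bits
vertexBits v = bits (toℕ v)

vertexBits-injective : ∀ {n} {u v : Fin n} → vertexBits u ≡ vertexBits v → u ≡ v
vertexBits-injective {u = u} {v} eq =
  toℕ-injective (trans (sym (val-bits (toℕ u))) (trans (cong val eq) (val-bits (toℕ v))))

sameBits-vertex : ∀ {n} (u v : Fin n) → sameBits (vertexBits u) (vertexBits v) ≡ does (v ≟ u)
sameBits-vertex u v with v ≟ u
... | yes refl = sameBits-refl (vertexBits u)
... | no v≢u with sameBits (vertexBits u) (vertexBits v) in eq
...   | true  = ⊥-elim (v≢u (sym (vertexBits-injective (sameBits-sound _ _ eq))))
...   | false = refl

module Run {n m : ℕ} (G : Graph n m) (g : Fin m → ℚ) (inst : IsCBGT (IsForest G) g) where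
  open IsCBGT inst
  open Walks G
  open Degrees G g inst

  rate-edge : Fin m → (Bits × Bits) × (Bits × Bits)
  rate-edge e = (vertexBits (proj₁ (G e)) , vertexBits (proj₂ (G e))) , bits ℤ.∣ ↥ g e ∣ , bits (↧ₙ g e)

  r₀ : Fin m → Rec
  r₀ e = edgeRecord (rate-edge e)

  g≤1 : ∀ e → g e ℚ.≤ 1ℚ
  g≤1 e = begin
    g e                                            ≡⟨ coeff-rate e ⟩
    ∑-subsets m (λ I → Vec.lookup I e ∣· coeff I)  ≤⟨ ∑-subsets-mono m (λ I → part (Vec.lookup I e) (coeff-nonneg I)) ⟩
    ∑-subsets m coeff                              ≡⟨ coeff-total ⟩
    1ℚ                                             ∎
    where
    open ℚ.≤-Reasoning
    part : ∀ b {q} → 0ℚ ℚ.≤ q → b ∣· q ℚ.≤ q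
    part true  _   = ℚ.≤-refl
    part false 0≤q = 0≤q

  -- A loop is a cycle by itself, so every set containing it has coefficient 0.
  loop-rate : ∀ {e v} → Joins G e v v → g e ≡ 0ℚ
  loop-rate {e} j = trans (coeff-rate e)
    (trans (∑-subsets-cong m vanishes) (sym (∑-subsets-∣· m false (λ _ → 0ℚ))))
    where
    vanishes : ∀ I → Vec.lookup I e ∣· coeff I ≡ 0ℚ
    vanishes I with Vec.lookup I e in eq
    ... | false = refl
    ... | true  = coeff-support I λ forest →
      forest (step e j stop) (Vec.lookup⇒[]= e I eq ∷ []) ((λ ()) , [] ∷ [] , [] ∷ [])

  record Rate (e : Fin m) (x : Bits) : Set where
    k = length x
    field
      positive : 0ℚ ℚ.< g e
      nonzero  : k ≢ 0
      large    : 2ℚ ℚ.≤ ι (2 ^ k) ℚ.* g e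
      small    : ι (2 ^ k) ℚ.* g e ℚ.< ι 4

  -- Rate 0 is recognised by an empty numerator, because `bits` produces no leading zeros.
  classify : ∀ e → (live (r₀ e) ≡ true × Rate e (counter (r₀ e))) ⊎ (live (r₀ e) ≡ false × counter (r₀ e) ≡ [] × g e ≡ 0ℚ)
  classify e with bits ℤ.∣ ↥ g e ∣ in eq
  ... | []     = inj₂ (refl , refl , numerator-zero (trans (sym (val-bits _)) (cong val eq)))
    where open Fraction (g e) (g-nonneg e)
  ... | b ∷ bs = inj₁ (refl , record
    { positive = ℚ.≰⇒> λ g≤0 → 1+n≰n (≤-trans N≥1 (≤-reflexive (cong (λ q → ℤ.∣ ↥ q ∣) (ℚ.≤-antisym g≤0 (g-nonneg e)))))
    ; nonzero  = exponent-positive val≥1 val≤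
    ; large    = fraction-≥ 2 (2 ^ length x) (subst₂ (λ d k → 2 * d ≤ 2 ^ length x * k) (val-bits D) val-num (exponent-large val≥1))
    ; small    = fraction-< 4 (2 ^ length x) (subst₂ (λ d k → 2 ^ length x * k < 4 * d) (val-bits D) val-num (exponent-small val≥1 val≤))
    })
    where
    open Fraction (g e) (g-nonneg e)
    open Exponent (b ∷ bs) (bits (↧ₙ g e))
    N = ℤ.∣ ↥ g e ∣
    D = ↧ₙ g e
    x = exponentList (b ∷ bs) (bits D)
    val-num : val (b ∷ bs) ≡ N
    val-num = trans (cong val (sym eq)) (val-bits N)
    N≥1 : 1 ≤ N
    N≥1 = n≢0⇒n>0 λ N≡0 → ∷≢[] (trans (sym eq) (cong bits N≡0))
      where
      ∷≢[] : b ∷ bs ≢ []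
      ∷≢[] ()
    val≥1 : 1 ≤ val (b ∷ bs)
    val≥1 = ≤-trans N≥1 (≤-reflexive (sym val-num))
    val≤ : val (b ∷ bs) ≤ val (bits D)
    val≤ = subst₂ _≤_ (sym val-num) (sym (val-bits D)) (numerator≤denominator (g≤1 e))

  live-rate : ∀ e → live (r₀ e) ≡ true → Rate e (counter (r₀ e))
  live-rate e l with classify e
  ... | inj₁ (_ , rate) = rate
  ... | inj₂ (l′ , _) with () ← trans (sym l) l′

  ends-r₀ : ∀ e → ends (r₀ e) ≡ (vertexBits (proj₁ (G e)) , vertexBits (proj₂ (G e)))
  ends-r₀ e with bits ℤ.∣ ↥ g e ∣
  ... | []    = refl
  ... | _ ∷ _ = refl

  -- Edges that are cut on the same day have no incompatible counters.
  Coherent : (Fin m → Rec) → List (Fin m) → Set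
  Coherent r es = ∀ {e e′} → e ∈ˡ es → e′ ∈ˡ es → live (r e) ≡ false → live (r e′) ≡ false →
                  ¬ (counter (r e) # counter (r e′))

  record Reached (r : Fin m → Rec) : Set where
    field
      ends-same   : ∀ e → ends (r e) ≡ ends (r₀ e)
      length-same : ∀ e → length (counter (r e)) ≡ length (counter (r₀ e))
      live-same   : ∀ e → live (r e) ≡ true → r e ≡ r₀ e
      dead-same   : ∀ e → live (r₀ e) ≡ false → r e ≡ r₀ e
      -- A closed trail of edges cut on the same day avoids every vertex that is already scheduled.
      trails-live : ∀ {a} (w : Walk G a a) → Unique (edges G w) → All (λ e → live (r₀ e) ≡ true) (edges G w) →
                    Coherent r (edges G w) → All (λ e → live (r e) ≡ true) (edges G w)

  reached₀ : Reached r₀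
  reached₀ = record
    { ends-same = λ _ → refl ; length-same = λ _ → refl ; live-same = λ _ _ → refl ; dead-same = λ _ _ → refl
    ; trails-live = λ _ _ ls _ → ls }

  liveSet : (Fin m → Rec) → Subset m
  liveSet r = Vec.tabulate (λ e → live (r e))

  touches≡ : ∀ {r} → Reached r → ∀ v e → touches (vertexBits v) (r e) ≡ touchesᵇ v e
  touches≡ rch v e rewrite Reached.ends-same rch e | ends-r₀ e
    | sameBits-vertex v (proj₁ (G e)) | sameBits-vertex v (proj₂ (G e)) with does (proj₁ (G e) ≟ v)
  ... | true  = refl
  ... | false = refl

  incident⇒touches : ∀ {r} → Reached r → ∀ {v e} → Incident e v → touches (vertexBits v) (r e) ≡ true
  incident⇒touches rch {v} {e} inc = trans (touches≡ rch v e) (dec-true (incident? e v) inc)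

  touches⇒incident : ∀ {r} → Reached r → ∀ {v e} → touches (vertexBits v) (r e) ≡ true → Incident e v
  touches⇒incident rch {v} {e} t with incident? e v
  ... | yes inc = inc
  ... | no ¬inc with () ← trans (sym t) (trans (touches≡ rch v e) (dec-false (incident? e v) ¬inc))

  records : (Fin m → Rec) → List Rec
  records r = map r (allFin m)

  record After (vs : List (Fin n)) (r : Fin m → Rec) (out : List Rec) : Set where
    field
      r′      : Fin m → Rec
      result  : out ≡ records r′
      reached : Reached r′
      mono    : ∀ e → live (r′ e) ≡ true → live (r e) ≡ true
      cleared : ∀ v → v ∈ˡ vs → degree (liveSet r) v ℚ.≤ 2ℚ → ∀ e → Incident e v → live (r′ e) ≢ true

  try-once : ∀ v {r} → Reached r → After (v ∷ []) r (try (vertexBits v) (records r))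
  try-once v {r} rch = go try-spec
    where
    open Reached rch
    rate : ∀ e → live (r e) ≡ true → Rate e (counter (r e))
    rate e l = subst (λ x → Rate e (counter x)) (sym (live-same e l))
      (live-rate e (trans (cong live (sym (live-same e l))) l))
    positive : ∀ e → live (r e) ≡ true → 0ℚ ℚ.< g e
    positive e l = Rate.positive (rate e l)
    large : ∀ e → live (r e) ≡ true → 2ℚ ℚ.≤ ι (2 ^ length (counter (r e))) ℚ.* g e
    large e l = Rate.large (rate e l)
    nonzero : ∀ e → live (r e) ≡ true → length (counter (r e)) ≢ 0
    nonzero e l = Rate.nonzero (rate e l)
    open Scheduling g (vertexBits v) r g-nonneg positive large nonzero using (New; Scheduled; try-spec)

    degree≡ : ∑ (λ e → (live (r e) ∧ touches (vertexBits v) (r e)) ∣· g e) ≡ degree (liveSet r) v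
    degree≡ = ∑-cong λ e → trans (cong (λ b → (live (r e) ∧ b) ∣· g e) (touches≡ rch v e))
      (trans (swap (live (r e)) (touchesᵇ v e)) (cong (λ b → touchesᵇ v e ∣· (b ∣· g e)) (sym (Vec.lookup∘tabulate _ e))))
      where
      swap : ∀ a b {q} → (a ∧ b) ∣· q ≡ b ∣· (a ∣· q)
      swap true  true  = refl
      swap true  false = refl
      swap false true  = refl
      swap false false = refl

    go : _ → After (v ∷ []) r (try (vertexBits v) (records r))
    go (r′ , eq , inj₂ (refl , overload)) = record
      { r′ = r ; result = eq ; reached = rch ; mono = λ _ l → l
      ; cleared = λ { _ (here refl) d≤2 → ⊥-elim (ℚ.<-irrefl refl
          (ℚ.<-≤-trans overload (ℚ.≤-trans (ℚ.≤-reflexive degree≡) d≤2))) } }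
    go (r′ , eq , inj₁ sch) = record
      { r′ = r′ ; result = eq ; mono = λ e l → trans (cong live (sym (unchanged e l))) l
      ; cleared = λ { _ (here refl) _ e inc l → S.clear e l
          (trans (cong (touches (vertexBits v)) (unchanged e l)) (incident⇒touches rch inc)) }
      ; reached = record
        { ends-same   = λ e → trans (proj₁ (S.shape e)) (ends-same e)
        ; length-same = λ e → trans (proj₂ (S.shape e)) (length-same e)
        ; live-same   = λ e l → trans (unchanged e l)
            (live-same e (trans (cong live (sym (unchanged e l))) l))
        ; dead-same   = λ e l → trans (still-dead e (trans (cong live (dead-same e l)) l)) (dead-same e l)
        ; trails-live = trails
        }
      }
      where
      module S = Scheduled sch
      unchanged : ∀ e → live (r′ e) ≡ true → r′ e ≡ r e
      unchanged e l with S.old e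
      ... | inj₁ p = p
      ... | inj₂ (_ , l′) with () ← trans (sym l) l′
      still-dead : ∀ e → live (r e) ≡ false → r′ e ≡ r e
      still-dead e l with S.old e
      ... | inj₁ p = p
      ... | inj₂ (l′ , _) with () ← trans (sym l) l′
      trails : ∀ {a} (w : Walk G a a) → Unique (edges G w) → All (λ e → live (r₀ e) ≡ true) (edges G w) →
               Coherent r′ (edges G w) → All (λ e → live (r′ e) ≡ true) (edges G w)
      -- Edges retired in earlier rounds are excluded by the invariant for `r`; those retired now
      -- all touch `v`, which the trail avoids.
      trails w uniq live₀ coh = All.tabulate remains
        where
        lives : All (λ e → live (r e) ≡ true) (edges G w)
        -- Edges retired before keep their counters, so coherence passes from `r′` back to `r`.
        lives = trails-live w uniq live₀ λ {e} {e′} e∈ e′∈ l l′ apart → coh e∈ e′∈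
          (trans (cong live (still-dead e l)) l) (trans (cong live (still-dead e′ l′)) l′)
          (subst₂ (λ x y → counter x # counter y) (sym (still-dead e l)) (sym (still-dead e′ l′)) apart)
        new : ∀ {e} → e ∈ˡ edges G w → Incident e v → New r′ e
        new {e} e∈ inc with live (r′ e) in l
        ... | false = All.lookup lives e∈ , refl
        ... | true  = ⊥-elim (S.clear e l (trans (cong (touches (vertexBits v)) (unchanged e l)) (incident⇒touches rch inc)))
        one : ∀ {e e′} → e ∈ˡ edges G w → e′ ∈ˡ edges G w → Incident e v → Incident e′ v → e ≡ e′
        one {e} {e′} e∈ e′∈ inc inc′ with e ≟ e′
        ... | yes e≡e′ = e≡e′
        ... | no e≢e′  = ⊥-elim (coh e∈ e′∈ (proj₂ (new e∈ inc)) (proj₂ (new e′∈ inc′))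
                           (S.apart e e′ e≢e′ (new e∈ inc) (new e′∈ inc′)))
        avoids : All (λ e → ¬ Incident e v) (edges G w)
        avoids = closed-trail-avoids v one
          -- Initially live edges have positive rate, hence none of them is a loop.
          (λ e∈ j → ℚ.<-irrefl (sym (loop-rate j)) (Rate.positive (live-rate _ (All.lookup live₀ e∈))))
          w (All.tabulate id) uniq
        remains : ∀ {e} → e ∈ˡ edges G w → live (r′ e) ≡ true
        remains {e} e∈ with S.old e
        ... | inj₁ p   = trans (cong live p) (All.lookup lives e∈)
        ... | inj₂ new = ⊥-elim (All.lookup avoids e∈ (touches⇒incident rch (S.touch e new)))

  degree-mono : ∀ {r r′} → (∀ e → live (r′ e) ≡ true → live (r e) ≡ true) → ∀ v →
                degree (liveSet r′) v ℚ.≤ degree (liveSet r) v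
  degree-mono {r} {r′} mono v = ∑-mono λ e → weight (touchesᵇ v e) e
    where
    weight : ∀ b e → b ∣· (Vec.lookup (liveSet r′) e ∣· g e) ℚ.≤ b ∣· (Vec.lookup (liveSet r) e ∣· g e)
    weight false e = ℚ.≤-refl
    weight true  e rewrite Vec.lookup∘tabulate (λ e → live (r′ e)) e | Vec.lookup∘tabulate (λ e → live (r e)) e
      with live (r′ e) in l
    ... | false = ∣·-nonneg (live (r e)) (g-nonneg e)
    ... | true  rewrite mono e l = ℚ.≤-refl

  -- Degrees only fall while edges are retired, so a vertex that is sparse at the start of the sweep
  -- is still sparse at its turn.
  sweep-once : ∀ vs {r} → Reached r → After vs r (sweep (map vertexBits vs) (records r))
  sweep-once []       {r} rch = record { r′ = r ; result = refl ; reached = rch ; mono = λ _ l → l ; cleared = λ _ () }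
  sweep-once (v ∷ vs) {r} rch = record
    { r′ = R.r′
    ; result = trans (cong (sweep (map vertexBits vs)) T.result) R.result
    ; reached = R.reached
    ; mono = λ e → T.mono e ∘ R.mono e
    ; cleared = λ
      { _  (here refl) d≤2 e inc l → T.cleared v (here refl) d≤2 e inc (R.mono e l)
      ; v′ (there v′∈) d≤2 → R.cleared v′ v′∈ (ℚ.≤-trans (degree-mono {r} {T.r′} T.mono v′) d≤2) }
    }
    where
    module T = After (try-once v rch)
    module R = After (sweep-once vs T.reached)

  -- While an edge is live, `sparse-vertex` provides a vertex of degree at most 2 with a live edge
  -- at it, and the next sweep retires that edge.
  sweeps-all : ∀ {A : Set} (es : List A) {r} → Reached r → card (liveSet r) ≤ length es →
    ∃[ r′ ] (foldl (λ s _ → sweep (map vertexBits (allFin n)) s) (records r) es ≡ records r′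
           × Reached r′ × (∀ e → live (r′ e) ≢ true))
  sweeps-all [] {r} rch c≤0 = r , refl , rch , λ e l →
    1+n≰n (≤-trans (≤-trans (s≤s z≤n) (x∈p⇒∣p-x∣<∣p∣ (∈-tabulate⁺ (live ∘ r) l))) c≤0)
  sweeps-all (_ ∷ es) {r} rch c≤ =
    let r′ , eq , rest = sweeps-all es R.reached fewer
    in r′ , trans (cong (λ s → foldl (λ s _ → sweep (map vertexBits (allFin n)) s) s es) R.result) eq , rest
    where
    module R = After (sweep-once (allFin n) rch)
    sub : liveSet R.r′ ⊆ liveSet r
    sub e∈ = ∈-tabulate⁺ (live ∘ r) (R.mono _ (∈-tabulate⁻ (live ∘ R.r′) e∈))
    fewer : card (liveSet R.r′) ≤ length es
    fewer with nonempty? (liveSet r)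
    ... | no empty = ≤-trans (p⊆q⇒∣p∣≤∣q∣ sub)
      (≤-trans (≤-reflexive (trans (cong card (Empty-unique empty)) (∣⊥∣≡0 m))) z≤n)
    ... | yes nonempty with sparse-vertex (liveSet r) nonempty
    ...   | v , (e , e∈ , inc) , d≤2 = ≤-pred (≤-trans
      (p⊂q⇒∣p∣<∣q∣ (sub , e , e∈ , λ e∈′ → R.cleared v (∈-allFin v) d≤2 e inc (∈-tabulate⁻ (live ∘ R.r′) e∈′))) c≤)

-- Validity and height of the schedule

max-below : ∀ {m} (b : Fin m → ℚ) {c} → 0ℚ ℚ.< c → (∀ e → b e ℚ.< c) → ∃[ B ] (B ℚ.< c × (∀ e → b e ℚ.≤ B))
max-below {zero}  b 0<c b<c = 0ℚ , 0<c , λ ()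
max-below {suc m} b 0<c b<c with max-below (b ∘ suc) 0<c (b<c ∘ suc)
... | B , B<c , b≤B with ℚ.≤-total (b zero) B
...   | inj₁ b₀≤B = B , B<c , λ { zero → b₀≤B ; (suc e) → b≤B e }
...   | inj₂ B≤b₀ = b zero , b<c zero , λ { zero → ℚ.≤-refl ; (suc e) → ℚ.≤-trans (b≤B e) B≤b₀ }

-- The number of days between the last cut of an edge and a day on which its counter of k bits has the given value
due : ℕ → ℕ → ℕ
due k zero    = 2 ^ k
due k (suc c) = suc c

1≤due : ∀ k c → 1 ≤ due k c
1≤due k zero    = 1≤^ k (s≤s z≤n)
1≤due k (suc c) = s≤s z≤n

due≤ : ∀ x → due (length x) (val x) ≤ 2 ^ length x
due≤ x with val x | val<2^length x
... | zero  | _  = ≤-refl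
... | suc c | c< = <⇒≤ c<

due-nonzero : ∀ k {c} → c ≢ 0 → due k c ≡ c
due-nonzero k {zero}  c≢0 = ⊥-elim (c≢0 refl)
due-nonzero k {suc c} _   = refl

-- Overflow occurs only when `val x` is one less than the power of two, and the resulting value 0
-- has that power as its `due`.
due-inc : ∀ x → due (length x) (val (proj₂ (inc x))) ≡ suc (val x)
due-inc x with proj₁ (inc x) | val-inc x
... | false | eq = trans (due-nonzero (length x) λ v≡0 → 1+n≢0 (trans (sym eq) (trans (+-identityʳ _) v≡0)))
                         (trans (sym (+-identityʳ _)) eq)
... | true  | eq = trans (cong (due (length x)) v≡0) (trans (cong (_+ 2 ^ length x) (sym v≡0)) eq)
  where
  v≡0 : val (proj₂ (inc x)) ≡ 0
  v≡0 = n≤0⇒n≡0 (+-cancelʳ-≤ (2 ^ length x) (val (proj₂ (inc x))) 0 (≤-trans (≤-reflexive eq) (val<2^length x)))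

module Timetable {n m : ℕ} (G : Graph n m) (g : Fin m → ℚ) (inst : IsCBGT (IsForest G) g)
  (r : Fin m → Rec) (rch : Run.Reached G g inst r) (done : ∀ e → live (r e) ≢ true) where
  open IsCBGT inst
  open Run G g inst
  open Reached rch

  on-day : ℕ → Fin m → Rec
  on-day zero    e = r e
  on-day (suc t) e = tick (on-day t e)

  π : Schedule m
  π t = Vec.tabulate (λ e → hit (on-day t e))

  length-on-day : ∀ t e → length (counter (on-day t e)) ≡ length (counter (r₀ e))
  length-on-day zero    e = length-same e
  length-on-day (suc t) e = trans (length-inc (counter (on-day t e))) (length-on-day t e)

  apart-on-day : ∀ t {e e′} → counter (r e) # counter (r e′) → counter (on-day t e) # counter (on-day t e′)
  apart-on-day zero    a = a
  apart-on-day (suc t) a = #-inc (apart-on-day t a)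

  -- The edges of a cycle cut on one day have positive rate, and no two of their counters are
  -- incompatible, as all are 0 on that day. By `trails-live` these edges would still be live at the
  -- end, when no edge is.
  valid : Valid (IsForest G) π
  valid t stop w⊆π (nonempty , _) = nonempty refl
  valid t w@(step e j _) w⊆π (_ , uniq , _) = done e (All.lookup lives (here refl))
    where
    hits : ∀ {e} → e ∈ˡ edges G w → counter (on-day t e) ≢ [] × val (counter (on-day t e)) ≡ 0
    hits {e} e∈ = hit-sound (on-day t e) (∈-tabulate⁻ (hit ∘ on-day t) (All.lookup w⊆π e∈))
    empty : ∀ {xs : Bits} → length xs ≡ 0 → xs ≡ []
    empty {[]} _ = refl
    live₀ : ∀ {e} → e ∈ˡ edges G w → live (r₀ e) ≡ true
    live₀ {e} e∈ with classify e
    ... | inj₁ (l , _)      = l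
    ... | inj₂ (_ , x≡ , _) = ⊥-elim (proj₁ (hits e∈) (empty (trans (length-on-day t e) (cong length x≡))))
    lives : All (λ e → live (r e) ≡ true) (edges G w)
    lives = trails-live w uniq (All.tabulate live₀) λ e∈ e′∈ _ _ a →
      #-not-both-zero (apart-on-day t a) (proj₂ (hits e∈)) (proj₂ (hits e′∈))

  one-day : ∀ e k → 1 ≤ k → g e ℚ.≤ ι k ℚ.* g e
  one-day e k 1≤k = ℚ.≤-trans (ℚ.≤-reflexive (sym (ℚ.*-identityˡ (g e))))
    (ℚ.*-monoʳ-≤-nonNeg (g e) ⦃ ℚ.nonNegative (g-nonneg e) ⦄ (ι-mono 1≤k))

  height≤due : ∀ t e → live (r₀ e) ≡ true →
    height g π t e ℚ.≤ ι (due (length (counter (on-day t e))) (val (counter (on-day t e)))) ℚ.* g e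
  -- The height starts at one day's growth, while `due` refers to a fictitious cut before the start
  -- and may be larger.
  height≤due zero    e l = one-day e _ (1≤due (length (counter (r e))) (val (counter (r e))))
  height≤due (suc t) e l rewrite Vec.lookup∘tabulate (λ e → hit (on-day t e)) e | length-inc (counter (on-day t e))
    with hit (on-day t e) in h
  ... | true  = one-day e _ (1≤due (length x) (val (proj₂ (inc x))))
    where x = counter (on-day t e)
  ... | false = begin
    height g π t e ℚ.+ g e            ≤⟨ ℚ.+-monoˡ-≤ (g e) (height≤due t e l) ⟩
    ι (due (length x) (val x)) ℚ.* g e ℚ.+ g e
      ≡⟨ cong₂ ℚ._+_ (cong (λ k → ι k ℚ.* g e) (due-nonzero (length x) uncut)) (sym (ℚ.*-identityˡ (g e))) ⟩
    ι (val x) ℚ.* g e ℚ.+ 1ℚ ℚ.* g e  ≡⟨ ℚ.+-comm (ι (val x) ℚ.* g e) (1ℚ ℚ.* g e) ⟩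
    1ℚ ℚ.* g e ℚ.+ ι (val x) ℚ.* g e  ≡⟨ ℚ.*-distribʳ-+ (g e) 1ℚ (ι (val x)) ⟨
    ι (suc (val x)) ℚ.* g e           ≡⟨ cong (λ k → ι k ℚ.* g e) (due-inc x) ⟨
    ι (due (length x) (val (proj₂ (inc x)))) ℚ.* g e ∎
    where
    open ℚ.≤-Reasoning
    x = counter (on-day t e)
    uncut : val x ≢ 0
    uncut v≡0 with () ← trans (sym h) (hit-complete (on-day t e)
      (λ x≡ → Rate.nonzero (live-rate e l) (trans (sym (length-on-day t e)) (cong length x≡))) v≡0)

  peak : Fin m → ℚ
  peak e = ι (2 ^ length (counter (r₀ e))) ℚ.* g e

  peak<4 : ∀ e → peak e ℚ.< + 4 / 1
  peak<4 e with classify e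
  ... | inj₁ (_ , rate)    = Rate.small rate
  ... | inj₂ (_ , _ , g≡0) = ℚ.≤-<-trans (ℚ.≤-reflexive (trans (cong (ι (2 ^ length (counter (r₀ e))) ℚ.*_) g≡0)
    (ℚ.*-zeroʳ (ι (2 ^ length (counter (r₀ e))))))) (ℚ.positive⁻¹ (+ 4 / 1))

  height≤peak : ∀ t e → height g π t e ℚ.≤ peak e
  height≤peak t e with classify e
  ... | inj₁ (l , _) = ℚ.≤-trans (height≤due t e l) (ℚ.*-monoʳ-≤-nonNeg (g e) ⦃ ℚ.nonNegative (g-nonneg e) ⦄
    (ι-mono (≤-trans (due≤ (counter (on-day t e))) (≤-reflexive (cong (2 ^_) (length-on-day t e))))))
  ... | inj₂ (_ , _ , g≡0) = ℚ.≤-reflexive (trans (zero-height t)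
    (sym (trans (cong (ι (2 ^ length (counter (r₀ e))) ℚ.*_) g≡0) (ℚ.*-zeroʳ (ι (2 ^ length (counter (r₀ e))))))))
    where
    zero-height : ∀ t → height g π t e ≡ 0ℚ
    zero-height zero    = g≡0
    zero-height (suc t) with Vec.lookup (π t) e
    ... | true  = g≡0
    ... | false = cong₂ ℚ._+_ (zero-height t) g≡0

  bounded-height : MaxHeight< g π (+ 4 / 1)
  bounded-height =
    -- The peaks do not depend on the day and are finitely many, so their maximum keeps the supremum
    -- strictly below 4.
    let B , B<4 , peak≤B = max-below peak (ℚ.positive⁻¹ (+ 4 / 1)) peak<4
    in B , B<4 , λ t e → ℚ.≤-trans (height≤peak t e) (peak≤B e)

  advance-day : ∀ t → advance (records (on-day t)) ≡ (Vec.toList (π t) , records (on-day (suc t)))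
  advance-day t = cong₂ _,_
    (trans (sym (map-∘ (allFin m))) (trans (map-tabulate id (hit ∘ on-day t)) (sym (toList-tabulate (hit ∘ on-day t)))))
    (sym (map-∘ (allFin m)))
    where
    toList-tabulate : ∀ {k} {A : Set} (f : Fin k → A) → Vec.toList (Vec.tabulate f) ≡ List.tabulate f
    toList-tabulate {zero}  f = refl
    toList-tabulate {suc k} f = cong (f zero ∷_) (toList-tabulate (f ∘ suc))

  -- Ticking changes the digits and with them the size of the tree, but not the width; this bounds
  -- the state independently of the day.
  width-on-day : ∀ t es → width (map (on-day t) es) ≡ width (map r es)
  width-on-day t       []       = refl
  width-on-day t       (e ∷ es) = cong₂ _+_ (cong₂ (λ uv l → 7 + ⟨ bitsT ⊗ bitsT ⟩∣ uv ∣ + 4 * l) (ends-on-day t)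
    (trans (length-on-day t e) (sym (length-same e)))) (width-on-day t es)
    where
    ends-on-day : ∀ t → ends (on-day t e) ≡ ends (r e)
    ends-on-day zero    = refl
    ends-on-day (suc t) = ends-on-day t

-- The algorithm and its running time

module _ {n m : ℕ} (G : Graph n m) (g : Fin m → ℚ) where

  input : El (list bitsT ⊗ list edgeT)
  input = map vertexBits (allFin n) ,
          map (λ e → (vertexBits (proj₁ (G e)) , vertexBits (proj₂ (G e))) , bits ℤ.∣ ↥ g e ∣ , bits (↧ₙ g e)) (allFin m)

  enc-input : enc (list bitsT ⊗ list edgeT) input ≡ encodeInstance G g
  enc-input = cong₂ _∙_ (cong encodeList (sym (map-∘ (allFin n)))) (cong encodeList (sym (map-∘ (allFin m))))

algorithm : Algorithm
algorithm = record { preprocess = Comp.program planC ; next = Comp.program advanceC }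

-- The daily program runs on a state whose size is at most three times that of the initial state;
-- the 3 is the loss between size and width.
time-bound : Poly
time-bound = Comp.time planC ⊕ Comp.time advanceC ⊙ (κ 3 ⊛ Comp.space planC)

abstract
  time-bounded : BoundedByMonomial ⟦ time-bound ⟧
  time-bounded = poly-bounded time-bound

open BoundedByMonomial time-bounded

1≤size : ∀ x → 1 ≤ size x
1≤size nil     = s≤s z≤n
1≤size (_ ∙ _) = s≤s z≤n

within-mono : ∀ {p x y S T} → S ≤ T → p ⊢ x ⇓ y within S → p ⊢ x ⇓ y within T
within-mono S≤T (c , c≤S , run) = c , ≤-trans c≤S S≤T , run

theorem4p10 : Σ[ A ∈ Algorithm ] ∃[ c ] ∃[ d ]
    (∀ (n m : ℕ) (G : Graph n m) (g : Fin m → ℚ) →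
    IsCBGT (IsForest G) g →
    Σ[ π ∈ Schedule m ]
    (Valid (IsForest G) π ×
    MaxHeight< g π (+ 4 / 1) ×
    ImplementsWithin (c * size (encodeInstance G g) ^ d) A (encodeInstance G g) π))
theorem4p10 = algorithm , coefficient , exponent , solution
  where
  solution : ∀ n m (G : Graph n m) (g : Fin m → ℚ) → IsCBGT (IsForest G) g →
    Σ[ π ∈ Schedule m ]
    (Valid (IsForest G) π × MaxHeight< g π (+ 4 / 1) ×
    ImplementsWithin (coefficient * size (encodeInstance G g) ^ exponent) algorithm (encodeInstance G g) π)
  solution n m G g inst = π , valid , bounded-height , state , preprocessing , daily
    where
    open Run G g inst
    final : ∃[ r ] (plan (input G g) ≡ records r × Reached r × (∀ e → live (r e) ≢ true))
    final =
      let r , eq , rest = sweeps-all (map rate-edge (allFin m)) reached₀ (card≤ (liveSet r₀))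
      in r , trans (cong (λ rs → foldl (λ s _ → sweep (map vertexBits (allFin n)) s) rs (map rate-edge (allFin m)))
                     (sym (map-∘ (allFin m)))) eq , rest
      where
      card≤ : ∀ p → card p ≤ length (map rate-edge (allFin m))
      card≤ p = ≤-trans (∣p∣≤n p) (≤-reflexive (sym (trans (length-map rate-edge (allFin m)) (length-tabulate {n = m} id))))
    r = proj₁ final
    open Timetable G g inst r (proj₁ (proj₂ (proj₂ final))) (proj₂ (proj₂ (proj₂ final)))

    N = size (encodeInstance G g)

    state : ℕ → Tree
    state t = enc (list recT) (records (on-day t))

    T≤ : ∀ {S} → S ≤ ⟦ time-bound ⟧ N → S ≤ coefficient * N ^ exponent
    T≤ S≤ = ≤-trans S≤ (bounded (1≤size (encodeInstance G g)))

    preprocessing : Comp.program planC ⊢ encodeInstance G g ⇓ state 0 within (coefficient * N ^ exponent)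
    preprocessing = within-mono (T≤ (m≤m+n _ _)) (subst₂ (λ x y → Comp.program planC ⊢ x ⇓ y within ⟦ Comp.time planC ⟧ (size x))
      (enc-input G g) (cong (enc (list recT)) (proj₁ (proj₂ final))) (Comp.runs planC (input G g)))

    size-state-day : ∀ t → ⟨ list recT ⟩∣ records (on-day t) ∣ ≤ ⟦ κ 3 ⊛ Comp.space planC ⟧ N
    size-state-day t = begin
      ⟨ list recT ⟩∣ records (on-day t) ∣          ≤⟨ size≤width (records (on-day t)) ⟩
      width (records (on-day t))                   ≡⟨ width-on-day t (allFin m) ⟩
      width (records r)                            ≤⟨ width≤size (records r) ⟩
      3 * ⟨ list recT ⟩∣ records r ∣               ≡⟨ cong (λ rs → 3 * ⟨ list recT ⟩∣ rs ∣) (proj₁ (proj₂ final)) ⟨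
      3 * ⟨ list recT ⟩∣ plan (input G g) ∣       ≤⟨ *-monoʳ-≤ 3 (Comp.fits planC (input G g)) ⟩
      3 * ⟦ Comp.space planC ⟧ (size (enc (list bitsT ⊗ list edgeT) (input G g)))
        ≡⟨ cong (λ x → 3 * ⟦ Comp.space planC ⟧ (size x)) (enc-input G g) ⟩
      3 * ⟦ Comp.space planC ⟧ N                  ∎
      where open ≤-Reasoning

    daily : ∀ t → Comp.program advanceC ⊢ state t ⇓ (encodeSubset (π t) ∙ state (suc t))
                    within (coefficient * N ^ exponent)
    daily t = within-mono (T≤ (≤-trans (⟦⟧-mono (Comp.time advanceC) (size-state-day t)) (m≤n+m _ _)))
      (subst (λ y → Comp.program advanceC ⊢ state t ⇓ enc (list bool ⊗ list recT) y
                    within ⟦ Comp.time advanceC ⟧ ⟨ list recT ⟩∣ records (on-day t) ∣)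
        (advance-day t) (Comp.runs advanceC (records (on-day t))))
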